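{- Let $\Phi=(D,\varphi)$ be a $\mathbb{T}$-gain unicyclic digraph on $n$ vertices whose unique directed cycle is $C_\ell$ (of length $\ell$), and let $g=\varphi(C_\ell)\in\mathbb{T}$. Then $$\operatorname{spec}(A(\Phi))=\{0^{\,n-\ell}\}\cup\{\lambda\in\mathbb{C}:\lambda^\ell=g\},$$ where $0^{\,n-\ell}$ denotes the eigenvalue $0$ with multiplicity $n-\ell$. Consequently, $\rho(\Phi)=1$.
   Context: A digraph $D=(V,\mathcal{A})$ has a finite vertex set $V=\{v_1,\dots,v_n\}$ and a set $\mathcal{A}$ of ordered pairs of distinct vertices, called arcs (no loops; at most one arc from $v_i$ to $v_j$ for each ordered pair). A directed cycle is a closed directed walk whose vertices are distinct except that the first and last coincide (so its length is at least $2$). A digraph is unicyclic if it is weakly connected and its underlying undirected graph (obtained by forgetting directions, each arc giving one edge, so a pair of opposite arcs is a cycle of length $2$) contains exactly one cycle. Throughout, only unicyclic digraphs whose unique cycle is a directed cycle are considered, and every remaining arc belongs to a directed tree whose arcs are oriented toward the cycle. Let $\mathbb{T}=\{z\in\mathbb{C}:|z|=1\}$. A $\mathbb{T}$-gain digraph is a pair $\Phi=(D,\varphi)$ with $\varphi:\mathcal{A}\to\mathbb{T}$ an arbitrary function; it is a $\mathbb{T}$-gain unicyclic digraph if $D$ is weakly connected, its underlying undirected graph (with one edge per arc) contains exactly one cycle, this cycle is a directed cycle of $D$, and every remaining arc of $D$ belongs to a directed tree whose arcs are oriented toward the cycle. Its gain adjacency matrix $A(\Phi)$ has entries $A(\Phi)_{ij}=\varphi(v_i,v_j)$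 if $(v_i,v_j)\in\mathcal{A}$ and $0$ otherwise. The gain $\varphi(C)$ of a directed cycle is the product of the gains of its arcs. $\operatorname{spec}(M)$ is the multiset of complex eigenvalues of $M$ (with algebraic multiplicity; the $\ell$ roots of $\lambda^\ell=g$ each occur once), and $\rho(\Phi)$ is the spectral radius (maximum modulus of an eigenvalue) of $A(\Phi)$. -}

module Defs where

open import Algebra.Bundles using (CommutativeRing)
open import Algebra.Bundles.Raw using (RawRing)
import Algebra.Definitions.RawSemiring as RawSemiringDefs
open import Data.Bool using (Bool; T; if_then_else_)
open import Data.Bool.Properties using (T?)
open import Data.Fin using (Fin; zero; suc; toℕ)
import Data.Fin.Properties as Fin
open import Data.List using (List; []; _∷_; map)
open import Data.Nat using (ℕ; zero; suc; NonZero)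
import Data.Nat as ℕ
open import Data.Nat.DivMod using (_mod_)
open import Data.Product using (Σ; ∃; ∃-syntax; _×_; _,_; proj₁; proj₂)
open import Data.Product.Relation.Binary.Pointwise.NonDependent using (Pointwise; ×-decidable)
open import Data.Vec.Functional using (Vector; removeAt)
open import Function.Bundles using (_⇔_)
open import Level using (0ℓ) renaming (suc to lsuc)
open import Relation.Binary.Construct.Closure.Equivalence using (EqClosure)
open import Relation.Binary.Construct.Closure.ReflexiveTransitive using (Star)
open import Relation.Binary.Construct.Closure.Symmetric using (SymClosure; fwd; bwd)
open import Relation.Binary.Core using (Rel)
open import Relation.Binary.Definitions using (Decidable)
open import Relation.Binary.PropositionalEquality using (_≡_; cong)
open import Relation.Binary.Structures using (IsDecTotalOrder)
open import Relation.Nullary using (¬_; Dec; yes; no; does)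
import Relation.Unary as U

------------------------------------------------------------------------
-- Real numbers

-- The standard library has no real numbers.  They are taken as the
-- (up to isomorphism unique) Dedekind-complete totally ordered field.
-- The order, and hence equality, is decidable as in classical mathematics.
record CompleteOrderedField : Set₁ where
  field
    commutativeRing : CommutativeRing 0ℓ 0ℓ
  open CommutativeRing commutativeRing public
  infix 4 _≤_
  field
    0≉1             : ¬ (0# ≈ 1#)
    inverse         : ∀ x → ¬ (x ≈ 0#) → ∃[ y ] x * y ≈ 1#
    _≤_             : Rel Carrier 0ℓ
    isDecTotalOrder : IsDecTotalOrder _≈_ _≤_
    +-monoˡ-≤       : ∀ {x y} z → x ≤ y → x + z ≤ y + z
    *-nonneg        : ∀ {x y} → 0# ≤ x → 0# ≤ y → 0# ≤ x * y

  open IsDecTotalOrder isDecTotalOrder public using (_≟_; _≤?_)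

  IsUpperBound : (Carrier → Set) → Carrier → Set
  IsUpperBound P b = ∀ x → P x → x ≤ b

  field
    supremum : (P : Carrier → Set) → ∃ P → ∃ (IsUpperBound P) →
               ∃[ s ] (IsUpperBound P s × (∀ b → IsUpperBound P b → s ≤ b))

------------------------------------------------------------------------
-- Polynomials and determinants

module Polynomials (R : RawRing 0ℓ 0ℓ) where
  open RawRing R

  -- Coefficients in order of increasing degree; trailing zeros are
  -- allowed, and _≈ₚ_ disregards them.
  Poly : Set
  Poly = List Carrier

  coeff : Poly → ℕ → Carrier
  coeff []      _       = 0#
  coeff (a ∷ p) zero    = a
  coeff (a ∷ p) (suc k) = coeff p k

  _≈ₚ_ : Rel Poly 0ℓ
  p ≈ₚ q = ∀ k → coeff p k ≈ coeff q k

  _+ₚ_ : Poly → Poly → Poly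
  []      +ₚ q       = q
  (a ∷ p) +ₚ []      = a ∷ p
  (a ∷ p) +ₚ (b ∷ q) = (a + b) ∷ (p +ₚ q)

  _*ₚ_ : Poly → Poly → Poly
  []      *ₚ q = []
  (a ∷ p) *ₚ q = map (a *_) q +ₚ (0# ∷ (p *ₚ q))

  const : Carrier → Poly
  const a = a ∷ []

  X : Poly
  X = 0# ∷ 1# ∷ []

  polyRing : RawRing 0ℓ 0ℓ
  polyRing = record
    { Carrier = Poly
    ; _≈_     = _≈ₚ_
    ; _+_     = _+ₚ_
    ; _*_     = _*ₚ_
    ; -_      = map -_
    ; 0#      = []
    ; 1#      = const 1#
    }

SquareMatrix : Set → ℕ → Set
SquareMatrix A n = Vector (Vector A n) n

module Determinant (R : RawRing 0ℓ 0ℓ) where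
  open RawRing R
  open RawSemiringDefs rawSemiring using (sum; _^_)

  -- Laplace expansion along the first row.
  det : ∀ {n} → SquareMatrix Carrier n → Carrier
  det {zero}  M = 1#
  det {suc n} M =
    sum λ j → (- 1#) ^ toℕ j * M zero j * det (λ i → removeAt (M (suc i)) j)

------------------------------------------------------------------------
-- Digraphs

record Digraph (n : ℕ) : Set where
  field
    adjacent : Fin n → Fin n → Bool
    loopless : ∀ i → ¬ T (adjacent i i)

  infix 4 _⟶_
  _⟶_ : Rel (Fin n) 0ℓ
  i ⟶ j = T (adjacent i j)

next : ∀ {ℓ} .{{_ : NonZero ℓ}} → Fin ℓ → Fin ℓ
next {ℓ} i = suc (toℕ i) mod ℓ

module _ {n : ℕ} (D : Digraph n) where
  open Digraph D

  WeaklyConnected : Set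
  WeaklyConnected = ∀ u v → EqClosure _⟶_ u v

  -- The arc used by a step of a walk in the underlying undirected
  -- (multi)graph, whose edges are the arcs of D.
  arcOf : ∀ {u v} → SymClosure _⟶_ u v → Fin n × Fin n
  arcOf {u} {v} (fwd _) = u , v
  arcOf {u} {v} (bwd _) = v , u

  -- Cycles of the underlying undirected multigraph: distinct vertices
  -- joined cyclically by distinct edges.  Looplessness excludes
  -- length 1; a pair of opposite arcs gives a cycle of length 2.
  record Cycle : Set where
    field
      length          : ℕ
      {{nonZero}}     : NonZero length
      vertex          : Fin length → Fin n
      vertex-distinct : ∀ {i j} → vertex i ≡ vertex j → i ≡ j
      step            : ∀ i → SymClosure _⟶_ (vertex i) (vertex (next i))
      edge-distinct   : ∀ {i j} → arcOf (step i) ≡ arcOf (step j) → i ≡ j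

  record DirectedCycle : Set where
    field
      length          : ℕ
      {{nonZero}}     : NonZero length
      vertex          : Fin length → Fin n
      vertex-distinct : ∀ {i j} → vertex i ≡ vertex j → i ≡ j
      arc             : ∀ i → vertex i ⟶ vertex (next i)

  underlying : DirectedCycle → Cycle
  underlying C = record
    { length          = length
    ; vertex          = vertex
    ; vertex-distinct = vertex-distinct
    ; step            = λ i → fwd (arc i)
    ; edge-distinct   = λ eq → vertex-distinct (cong proj₁ eq)
    }
    where open DirectedCycle C

  _∈ᵉ_ : Fin n × Fin n → Cycle → Set
  e ∈ᵉ K = ∃[ i ] arcOf (Cycle.step K i) ≡ e

-- K and K′ are the same subgraph (they may differ in starting point and
-- sense of traversal).
SameCycle : ∀ {n} (D : Digraph n) → Rel (Cycle D) 0ℓ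
SameCycle D K K′ = ∀ e → (_∈ᵉ_ D e K) ⇔ (_∈ᵉ_ D e K′)

-- The vertices of the tree are the root and the end points of the arcs of
-- S.  They are all joined to the root, so the tree is connected.
record IsTreeTowards {n} (S : Digraph n) (root : Fin n) : Set where
  open Digraph S
  field
    acyclic  : ¬ Cycle S
    oriented : ∀ {u v} → u ⟶ v → Star _⟶_ v root

record IsUnicyclic {n} (D : Digraph n) : Set where
  open Digraph D
  field
    weaklyConnected : WeaklyConnected D
    cycle           : DirectedCycle D
    unique          : ∀ (K : Cycle D) → SameCycle D K (underlying D cycle)

  OnCycle : Fin n → Fin n → Set
  OnCycle u v = _∈ᵉ_ D (u , v) (underlying D cycle)

  field
    remaining : ∀ {u v} → u ⟶ v → ¬ OnCycle u v →
      Σ (Digraph n) λ S → let open Digraph S renaming (_⟶_ to _⟶ₛ_) in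
        (∀ {a b} → a ⟶ₛ b → (a ⟶ b) × ¬ OnCycle a b)
        × u ⟶ₛ v
        × ∃[ i ] IsTreeTowards S (DirectedCycle.vertex cycle i)

------------------------------------------------------------------------
-- Complex numbers, spectra and gain digraphs

module Complex (ℝ : CompleteOrderedField) where
  private module ℝ = CompleteOrderedField ℝ

  ℂ-rawRing : RawRing 0ℓ 0ℓ
  ℂ-rawRing = record
    { Carrier = ℝ.Carrier × ℝ.Carrier
    ; _≈_     = Pointwise ℝ._≈_ ℝ._≈_
    ; _+_     = λ (a , b) (c , d) → a ℝ.+ c , b ℝ.+ d
    ; _*_     = λ (a , b) (c , d) →
                  (a ℝ.* c) ℝ.- (b ℝ.* d) , (a ℝ.* d) ℝ.+ (b ℝ.* c)
    ; -_      = λ (a , b) → (ℝ.- a) , (ℝ.- b)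
    ; 0#      = ℝ.0# , ℝ.0#
    ; 1#      = ℝ.1# , ℝ.0#
    }

  open RawRing ℂ-rawRing public renaming (Carrier to ℂ)
  open RawSemiringDefs rawSemiring public using (_^_; sum; product)
  open Polynomials ℂ-rawRing public
  private
    module P = RawRing polyRing
    module P′ = RawSemiringDefs P.rawSemiring

  _≟_ : Decidable _≈_
  _≟_ = ×-decidable ℝ._≟_ ℝ._≟_

  -- IsModulus z r means ∣z∣ = r.
  IsModulus : ℂ → ℝ.Carrier → Set
  IsModulus (a , b) r = ℝ.0# ℝ.≤ r × (r ℝ.* r) ℝ.≈ (a ℝ.* a) ℝ.+ (b ℝ.* b)

  𝕋 : Set
  𝕋 = Σ ℂ λ z → IsModulus z ℝ.1#

  Matrix : ℕ → Set
  Matrix = SquareMatrix ℂ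

  IsEigenvalue : ∀ {n} → Matrix n → ℂ → Set
  IsEigenvalue {n} M z = Σ (Vector ℂ n) λ v →
    ¬ (∀ i → v i ≈ 0#) × (∀ i → sum (λ j → M i j * v j) ≈ z * v i)

  charPoly : ∀ {n} → Matrix n → Poly
  charPoly M = Determinant.det polyRing λ i j →
    (if does (i Fin.≟ j) then X else P.0#) P.+ (P.- const (M i j))

  -- z is a root of charPoly M of multiplicity exactly k.
  HasMultiplicity : ∀ {n} → Matrix n → ℂ → ℕ → Set
  HasMultiplicity M z k =
    ((X-z P′.^ k) P′.∣ charPoly M) × ((X-z P′.^ suc k) P′.∤ charPoly M)
    where X-z = X P.+ (P.- const z)

  -- Multisets of complex numbers, as multiplicity functions.
  Multiset : Set
  Multiset = ℂ → ℕ

  zeros : ℕ → Multiset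
  zeros m z = if does (z ≟ 0#) then m else 0

  ⟦_⟧ : {Q : ℂ → Set} → U.Decidable Q → Multiset
  ⟦ Q? ⟧ z = if does (Q? z) then 1 else 0

  infixr 6 _∪_
  _∪_ : Multiset → Multiset → Multiset
  (S ∪ S′) z = S z ℕ.+ S′ z

  Spec_≐_ : ∀ {n} → Matrix n → Multiset → Set
  Spec M ≐ S = ∀ z → HasMultiplicity M z (S z)

  IsSpectralRadius : ∀ {n} → Matrix n → ℝ.Carrier → Set
  IsSpectralRadius M ρ =
    (∃[ z ] (IsEigenvalue M z × IsModulus z ρ))
    × (∀ z → IsEigenvalue M z → ∃[ r ] (IsModulus z r × r ℝ.≤ ρ))

  record GainDigraph (n : ℕ) : Set where
    field
      digraph : Digraph n
    open Digraph digraph public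
    field
      φ : ∀ i j → i ⟶ j → 𝕋

    adjacencyMatrix : Matrix n
    adjacencyMatrix i j = entry (T? (adjacent i j))
      where
      entry : Dec (i ⟶ j) → ℂ
      entry (yes a) = proj₁ (φ i j a)
      entry (no _)  = 0#

    cycleGain : DirectedCycle digraph → ℂ
    cycleGain C = product λ i → proj₁ (φ (vertex i) (vertex (next i)) (arc i))
      where open DirectedCycle C

-- The characteristic determinant det (x − A) is computed by a Cramer-type argument.  Let r be a
-- vertex of the cycle and W u the determinant of x − A with column r replaced by the unit vector
-- e u.  For v ≠ r, replacing column r by column v gives a matrix with two equal columns, so
-- x W v = Σ A u v · W u, summed over the arcs u → v.  Hence W vanishes off the cycle, where arcs only
-- come from vertices off the cycle, and along the cycle x W (c (k+1)) = φ (c k, c (k+1)) · W (c k).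
-- Going once around yields x^ℓ det (x − A) = (x^ℓ − g) · x W r, and x W r = xⁿ because cutting the
-- arcs into r leaves no directed cycle; x^ℓ is then cancelled.
--
-- The acyclicity facts all follow from one observation: an arc lying on a closed walk is an arc of
-- the cycle, since erasing loops from the walk gives a directed cycle.
--
-- The roots of X^ℓ − g are simple, as X^ℓ − z^ℓ is X − z times a polynomial with value ℓ z^(ℓ−1)
-- at z.  An ℓ-th root of g exists: square roots come from bisecting an angle, odd roots from the
-- intermediate value theorem.  The eigenvector for it is propagated backwards along the arcs from r.

{-# OPTIONS --safe #-}
module Submission where

open import Defs

open import Algebra.Bundles using (CommutativeRing)
open import Algebra.Bundles.Raw using (RawRing)
import Algebra.Definitions.RawMagma as RawMagmaDefs
import Algebra.Definitions.RawSemiring as RawSemiringDefs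
import Algebra.Properties.Ring
import Algebra.Properties.Semiring.Exp
import Algebra.Properties.Semiring.Mult
import Algebra.Properties.Semiring.Mult.TCOptimised
import Algebra.Properties.Semiring.Sum
import Algebra.Solver.Ring
open import Algebra.Solver.Ring.AlmostCommutativeRing using (fromCommutativeRing; _-Raw-AlmostCommutative⟶_)
open import Data.Bool using (if_then_else_)
open import Data.Bool.Properties using (T?; T-irrelevant)
open import Data.Fin using (Fin; zero; suc; toℕ; fromℕ; fromℕ<; inject₁; punchIn; punchOut)
open import Data.Fin.Induction using (spo-wellFounded; spo-noetherian)
import Data.Fin.Properties as Fin
open import Data.Fin.Relation.Unary.Top using (view; ‵fromℕ; ‵inject₁)
open import Data.Integer using (ℤ; +_; -[1+_]; _⊖_)
import Data.Integer as ℤ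
import Data.Integer.Properties as ℤ
open import Data.List using ([]; _∷_; map)
open import Data.Maybe using (Maybe; just; nothing)
open import Data.Nat using (ℕ; zero; suc; pred; _∸_; NonZero; z≤n; s≤s)
import Data.Nat as ℕ
open import Data.Nat.DivMod using (_mod_; _%_)
import Data.Nat.DivMod as ℕ
import Data.Nat.Induction as ℕ
import Data.Nat.Properties as ℕ
open import Data.Product using (∃-syntax; _×_; _,_; proj₁; proj₂)
open import Data.Product.Properties using (≡-dec)
open import Data.Sum using (_⊎_; inj₁; inj₂)
open import Data.Vec.Functional using (Vector; removeAt; updateAt; tail) renaming (_∷_ to _∷ᵛ_)
open import Data.Vec.Functional.Properties using (updateAt-updates; updateAt-minimal)
open import Function using (_∘_; flip)
open import Function.Bundles using (Equivalence)
open import Induction.WellFounded using (WellFounded; Acc; acc; WfRec; module All; module FixPoint)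
open import Level using (0ℓ)
open import Relation.Binary.Construct.Closure.ReflexiveTransitive as Star using (Star; ε; _◅_; _◅◅_)
open import Relation.Binary.Core using (Rel)
open import Relation.Binary.Definitions using (Irreflexive; Transitive; tri<; tri≈; tri>)
open import Relation.Binary.PropositionalEquality as ≡ using (_≡_; _≢_)
import Relation.Binary.Reasoning.Setoid
open import Relation.Binary.Structures using (IsDecTotalOrder; IsStrictPartialOrder)
open import Relation.Nullary using (¬_; Dec; yes; no; does; contradiction)

-- The determinant argument lives over an arbitrary commutative ring in which `x` can be cancelled,
-- because it is applied to `X` in the polynomial ring, where `X` has no inverse; hence Cramer's
-- rule appears only in identities multiplied through by powers of `x`. The strict order `_⊏_`,
-- generated by the arcs that do not enter the root, replaces a sorting of the vertices: on a finite
-- vertex set it is well-founded in both directions, and determinants descend along it while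
-- eigenvectors climb it.
--
-- The spectral radius is not read off from the characteristic polynomial: `IsEigenvalue` asks for
-- an eigenvector, and getting one from a root would need a kernel for every singular matrix. On the
-- cycle, however, each vertex has a single out-arc, so an eigenvector satisfies
-- `z ^ ℓ * v r = g * v r` directly, and if `z` is nonzero and `v r` vanishes, so does all of `v`.
-- That the modulus 1 is attained requires an actual root of `g`, built from the supremum axiom;
-- functions that are Lipschitz on a bounded interval suffice for the intermediate values, in place
-- of a theory of continuity.

module IntegerSolver (R : CommutativeRing 0ℓ 0ℓ) where
  open CommutativeRing R
  open Algebra.Properties.Ring ring
  open Algebra.Properties.Semiring.Mult.TCOptimised semiring renaming (_×_ to infixr 8 _·_)
  open Relation.Binary.Reasoning.Setoid setoid

  private
    -- Coefficients come from ℤ because its equality is decidable, while that of the ring need not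
    -- be. The optimised multiple makes `ι (+ 1)` reduce to `1#`, so that `con (+ 1)` stands for the
    -- unit itself.
    ι : ℤ → Carrier
    ι (+ n)      = n · 1#
    ι -[1+ n ]   = - (suc n · 1#)

    1+n×1 : ∀ n → suc n · 1# ≈ 1# + n · 1#
    1+n×1 n = ×-homo-+ 1# 1 n

    shift : ∀ x y → x - y ≈ (1# + x) - (1# + y)
    shift x y = begin
      x - y                    ≈⟨ +-identityˡ _ ⟨
      0# + (x - y)             ≈⟨ +-congʳ (-‿inverseʳ 1#) ⟨
      (1# - 1#) + (x - y)      ≈⟨ +-assoc _ _ _ ⟩
      1# + (- 1# + (x - y))    ≈⟨ +-congˡ (+-assoc _ _ _) ⟨
      1# + ((- 1# + x) - y)    ≈⟨ +-congˡ (+-congʳ (+-comm _ _)) ⟩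
      1# + ((x - 1#) - y)      ≈⟨ +-congˡ (+-assoc _ _ _) ⟩
      1# + (x + (- 1# - y))    ≈⟨ +-assoc _ _ _ ⟨
      (1# + x) + (- 1# - y)    ≈⟨ +-congˡ (-‿+-comm 1# y) ⟩
      (1# + x) - (1# + y)      ∎

    ⊖-homo : ∀ m n → ι (m ⊖ n) ≈ m · 1# - n · 1#
    ⊖-homo zero    zero    = sym (-‿inverseʳ 0#)
    ⊖-homo zero    (suc n) = sym (+-identityˡ _)
    ⊖-homo (suc m) zero    = sym (trans (+-congˡ -0#≈0#) (+-identityʳ _))
    ⊖-homo (suc m) (suc n) = begin
      ι (suc m ⊖ suc n)               ≡⟨ ≡.cong ι (ℤ.[1+m]⊖[1+n]≡m⊖n m n) ⟩
      ι (m ⊖ n)                       ≈⟨ ⊖-homo m n ⟩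
      m · 1# - n · 1#                 ≈⟨ shift _ _ ⟩
      (1# + m · 1#) - (1# + n · 1#)   ≈⟨ +-cong (1+n×1 m) (-‿cong (1+n×1 n)) ⟨
      suc m · 1# - suc n · 1#         ∎

    -‿homo : ∀ i → ι (ℤ.- i) ≈ - ι i
    -‿homo (+ zero)   = sym -0#≈0#
    -‿homo (+ suc n)  = refl
    -‿homo -[1+ n ]   = sym (-‿involutive _)

    +-homo : ∀ i j → ι (i ℤ.+ j) ≈ ι i + ι j
    +-homo (+ m)    (+ n)    = ×-homo-+ 1# m n
    +-homo (+ m)    -[1+ n ] = ⊖-homo m (suc n)
    +-homo -[1+ m ] (+ n)    = trans (⊖-homo n (suc m)) (+-comm _ _)
    +-homo -[1+ m ] -[1+ n ] = begin
      - (suc (suc (m ℕ.+ n)) · 1#)       ≡⟨ ≡.cong (λ k → - (suc k · 1#)) (ℕ.+-suc m n) ⟨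
      - ((suc m ℕ.+ suc n) · 1#)         ≈⟨ -‿cong (×-homo-+ 1# (suc m) (suc n)) ⟩
      - (suc m · 1# + suc n · 1#)        ≈⟨ -‿+-comm _ _ ⟨
      - (suc m · 1#) - (suc n · 1#)      ∎

    *-homo⁺ : ∀ m j → ι (+ m ℤ.* j) ≈ ι (+ m) * ι j
    *-homo⁺ m (+ n) = begin
      ι (+ m ℤ.* + n)     ≡⟨ ≡.cong ι (ℤ.pos-* m n) ⟨
      (m ℕ.* n) · 1#      ≈⟨ ×1-homo-* m n ⟩
      m · 1# * n · 1#     ∎
    *-homo⁺ m -[1+ n ] = begin
      ι (+ m ℤ.* -[1+ n ])        ≡⟨ ≡.cong ι (ℤ.neg-distribʳ-* (+ m) (+ suc n)) ⟨
      ι (ℤ.- (+ m ℤ.* + suc n))   ≈⟨ -‿homo (+ m ℤ.* + suc n) ⟩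
      - ι (+ m ℤ.* + suc n)       ≈⟨ -‿cong (*-homo⁺ m (+ suc n)) ⟩
      - (m · 1# * suc n · 1#)     ≈⟨ -‿distribʳ-* _ _ ⟩
      m · 1# * - (suc n · 1#)     ∎

    *-homo : ∀ i j → ι (i ℤ.* j) ≈ ι i * ι j
    *-homo (+ m)    j = *-homo⁺ m j
    *-homo -[1+ m ] j = begin
      ι (-[1+ m ] ℤ.* j)          ≡⟨ ≡.cong ι (ℤ.neg-distribˡ-* (+ suc m) j) ⟨
      ι (ℤ.- (+ suc m ℤ.* j))     ≈⟨ -‿homo (+ suc m ℤ.* j) ⟩
      - ι (+ suc m ℤ.* j)         ≈⟨ -‿cong (*-homo⁺ (suc m) j) ⟩
      - (suc m · 1# * ι j)        ≈⟨ -‿distribˡ-* _ _ ⟩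
      - (suc m · 1#) * ι j        ∎

    morphism : ℤ.+-*-rawRing -Raw-AlmostCommutative⟶ fromCommutativeRing R
    morphism = record
      { ⟦_⟧    = ι
      ; +-homo = +-homo
      ; *-homo = *-homo
      ; -‿homo = -‿homo
      ; 0-homo = refl
      ; 1-homo = refl
      }

    _coeff≟_ : ∀ i j → Maybe (ι i ≈ ι j)
    i coeff≟ j with i ℤ.≟ j
    ... | yes ≡.refl = just refl
    ... | no  _      = nothing

  open Algebra.Solver.Ring ℤ.+-*-rawRing (fromCommutativeRing R) morphism _coeff≟_ public
    using (Polynomial; solve; _:=_; _:+_; _:*_; _:-_; :-_; con)

-- Powers, geometric sums and cancellation

module Powers (R : CommutativeRing 0ℓ 0ℓ) where
  open CommutativeRing R hiding (zero)
  open Algebra.Properties.Semiring.Exp semiring using (_^_; ^-congˡ) public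
  open IntegerSolver R
  open Relation.Binary.Reasoning.Setoid setoid

  Cancellable : Carrier → Set
  Cancellable x = ∀ {p q} → x * p ≈ x * q → p ≈ q

  NoZeroDivisors : Set
  NoZeroDivisors = ∀ {a b} → a * b ≈ 0# → ¬ a ≈ 0# → b ≈ 0#

  ^-cancel : ∀ {x} → Cancellable x → ∀ k → Cancellable (x ^ k)
  ^-cancel x-cancel zero    eq = trans (sym (*-identityˡ _)) (trans eq (*-identityˡ _))
  ^-cancel x-cancel (suc k) eq =
    ^-cancel x-cancel k (x-cancel (trans (sym (*-assoc _ _ _)) (trans eq (*-assoc _ _ _))))

  *-^ : ∀ x y k → (x * y) ^ k ≈ x ^ k * y ^ k
  *-^ x y zero    = sym (*-identityˡ 1#)
  *-^ x y (suc k) = trans (*-congˡ (*-^ x y k))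
    (solve 4 (λ x y p q → x :* y :* (p :* q) := x :* p :* (y :* q)) refl x y (x ^ k) (y ^ k))

  1^ : ∀ k → 1# ^ k ≈ 1#
  1^ zero    = refl
  1^ (suc k) = trans (*-identityˡ _) (1^ k)

  -- The homogeneous sum of all `x ^ i * y ^ (k ∸ i)`, the cofactor of `x - y` in
  -- `x ^ suc k - y ^ suc k`.
  geometric : Carrier → Carrier → ℕ → Carrier
  geometric x y zero    = 1#
  geometric x y (suc k) = x ^ suc k + y * geometric x y k

  geometric-sum : ∀ x y k → (x - y) * geometric x y k ≈ x ^ suc k - y ^ suc k
  geometric-sum x y zero    = solve 2 (λ x y → (x :- y) :* con (+ 1) := x :* con (+ 1) :- y :* con (+ 1)) refl x y
  geometric-sum x y (suc k) = begin
    (x - y) * (x ^ suc k + y * geometric x y k)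
      ≈⟨ solve 4 (λ x y p g → (x :- y) :* (p :+ y :* g) := (x :- y) :* p :+ y :* ((x :- y) :* g)) refl x y (x ^ suc k) _ ⟩
    (x - y) * x ^ suc k + y * ((x - y) * geometric x y k)
      ≈⟨ +-congˡ (*-congˡ (geometric-sum x y k)) ⟩
    (x - y) * x ^ suc k + y * (x ^ suc k - y ^ suc k)
      ≈⟨ solve 4 (λ x y p q → (x :- y) :* p :+ y :* (p :- q) := x :* p :- y :* q) refl x y (x ^ suc k) (y ^ suc k) ⟩
    x ^ suc (suc k) - y ^ suc (suc k) ∎

  -- For multiplicities: if one factor `x` too many divides `y * x ^ m`, then `x` already divides
  -- `y`.
  cancel-power : ∀ {x} → Cancellable x → ∀ m {q y} → q * x ^ suc m ≈ y * x ^ m → q * x ≈ y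
  cancel-power {x} x-cancel m {q} {y} eq = ^-cancel x-cancel m (begin
    x ^ m * (q * x)  ≈⟨ solve 3 (λ p q x → p :* (q :* x) := q :* (x :* p)) refl (x ^ m) q x ⟩
    q * x ^ suc m    ≈⟨ eq ⟩
    y * x ^ m        ≈⟨ *-comm _ _ ⟩
    x ^ m * y        ∎)

  -- For simple roots: a double factor `l` of `(l * s) * t` leaves one factor `l` in `s * t`, where
  -- evaluation can refute it.
  cancel-double : ∀ {l} → Cancellable l → ∀ {q s t} → q * l ^ 2 ≈ (l * s) * t → q * l ≈ s * t
  cancel-double {l} l-cancel {q} {s} {t} eq = l-cancel (begin
    l * (q * l)  ≈⟨ solve 2 (λ l q → l :* (q :* l) := q :* (l :* (l :* con (+ 1)))) refl l q ⟩
    q * l ^ 2    ≈⟨ eq ⟩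
    l * s * t    ≈⟨ *-assoc _ _ _ ⟩
    l * (s * t)  ∎)

  divides-product : ∀ l s t → (s * t) * l ^ 1 ≈ (l * s) * t
  divides-product = solve 3 (λ l s t → (s :* t) :* (l :* con (+ 1)) := (l :* s) :* t) refl

-- Determinants

infixl 5 _[_≔_]
_[_≔_] : ∀ {A : Set} {n} → Vector A n → Fin n → A → Vector A n
xs [ i ≔ x ] = updateAt xs i (λ _ → x)

module _ {A : Set} where

  ≔-at : ∀ {n} (xs : Vector A n) i {x} → (xs [ i ≔ x ]) i ≡ x
  ≔-at xs i = updateAt-updates i xs

  ≔-off : ∀ {n} (xs : Vector A n) {i j} {x} → j ≢ i → (xs [ i ≔ x ]) j ≡ xs j
  ≔-off xs {i} {j} = updateAt-minimal j i xs

  ≔-commute : ∀ {n} (xs : Vector A n) {p q x y} → p ≢ q →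
              ∀ i → (xs [ p ≔ x ] [ q ≔ y ]) i ≡ (xs [ q ≔ y ] [ p ≔ x ]) i
  ≔-commute xs {p} {q} p≢q i with i Fin.≟ p | i Fin.≟ q
  ... | yes ≡.refl | _          = ≡.trans (≔-off (xs [ p ≔ _ ]) p≢q)
                                    (≡.trans (≔-at xs p) (≡.sym (≔-at (xs [ q ≔ _ ]) p)))
  ... | no i≢p     | yes ≡.refl = ≡.trans (≔-at (xs [ p ≔ _ ]) q)
                                    (≡.sym (≡.trans (≔-off (xs [ q ≔ _ ]) i≢p) (≔-at xs q)))
  ... | no i≢p     | no i≢q     = ≡.trans (≔-off (xs [ p ≔ _ ]) i≢q)
                                    (≡.trans (≔-off xs i≢p)
                                    (≡.sym (≡.trans (≔-off (xs [ q ≔ _ ]) i≢p) (≔-off xs i≢q))))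

  ≔-≡ : ∀ {n} (xs ys : Vector A n) {p x} → ys p ≡ x → (∀ i → i ≢ p → ys i ≡ xs i) →
        ∀ i → ys i ≡ (xs [ p ≔ x ]) i
  ≔-≡ xs ys {p} eq h i with i Fin.≟ p
  ... | yes ≡.refl = ≡.trans eq (≡.sym (≔-at xs p))
  ... | no i≢p     = ≡.trans (h i i≢p) (≡.sym (≔-off xs i≢p))

-- Two adjacent columns stay adjacent in a minor that deletes neither of them, so an induction on
-- the size can pass to such minors.
punchIn-adjacent : ∀ {n} (j : Fin (2 ℕ.+ n)) (p : Fin (1 ℕ.+ n)) → j ≢ inject₁ p → j ≢ suc p →
                   ∃[ q ] punchIn j (inject₁ q) ≡ inject₁ p × punchIn j (suc q) ≡ suc p
punchIn-adjacent         zero          zero    j≢p _    = contradiction ≡.refl j≢p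
punchIn-adjacent         (suc zero)    zero    _   j≢sp = contradiction ≡.refl j≢sp
punchIn-adjacent {suc n} (suc (suc j)) zero    _   _    = zero , ≡.refl , ≡.refl
punchIn-adjacent         zero          (suc p) _   _    = p , ≡.refl , ≡.refl
punchIn-adjacent {suc n} (suc j)       (suc p) j≢p j≢sp
  with q , eq₁ , eq₂ ← punchIn-adjacent j p (j≢p ∘ ≡.cong suc) (j≢sp ∘ ≡.cong suc)
  = suc q , ≡.cong suc eq₁ , ≡.cong suc eq₂

-- The enumerations that skip one of two neighbours differ in a single place, where each names the
-- neighbour that the other skips. If the two columns are equal, the two minors therefore agree.
punchIn-neighbours : ∀ {n} (p k : Fin n) → punchIn (inject₁ p) k ≡ punchIn (suc p) k
                     ⊎ punchIn (inject₁ p) k ≡ suc p × punchIn (suc p) k ≡ inject₁ p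
punchIn-neighbours zero    zero    = inj₂ (≡.refl , ≡.refl)
punchIn-neighbours zero    (suc k) = inj₁ ≡.refl
punchIn-neighbours (suc p) zero    = inj₁ ≡.refl
punchIn-neighbours (suc p) (suc k) with punchIn-neighbours p k
... | inj₁ eq          = inj₁ (≡.cong suc eq)
... | inj₂ (eq₁ , eq₂) = inj₂ (≡.cong suc eq₁ , ≡.cong suc eq₂)

module FiniteSums (R : CommutativeRing 0ℓ 0ℓ) where
  open CommutativeRing R hiding (zero)
  open Algebra.Properties.Semiring.Sum semiring
  open Relation.Binary.Reasoning.Setoid setoid

  sum-zero : ∀ {n} {t : Vector Carrier n} → (∀ i → t i ≈ 0#) → sum t ≈ 0#
  sum-zero {n} t≈0 = trans (sum-cong-≋ t≈0) (sum-replicate-zero n)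

  sum-single : ∀ {n} {t : Vector Carrier n} p → (∀ i → i ≢ p → t i ≈ 0#) → sum t ≈ t p
  sum-single {suc n} {t} p t≈0 = begin
    sum t                      ≈⟨ sum-remove {i = p} t ⟩
    t p + sum (removeAt t p)   ≈⟨ +-congˡ (sum-zero λ i → t≈0 _ (Fin.punchInᵢ≢i p i)) ⟩
    t p + 0#                   ≈⟨ +-identityʳ _ ⟩
    t p                        ∎

  sum-pair : ∀ {n} {t : Vector Carrier (suc n)} p →
             (∀ i → i ≢ inject₁ p → i ≢ suc p → t i ≈ 0#) → sum t ≈ t (inject₁ p) + t (suc p)
  sum-pair zero t≈0 =
    +-congˡ (sum-single zero λ i i≢0 → t≈0 (suc i) (λ ()) (i≢0 ∘ Fin.suc-injective))
  sum-pair (suc p) t≈0 =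
    trans (+-cong (t≈0 zero (λ ()) (λ ()))
                  (sum-pair p λ i i≢p i≢sp →
                    t≈0 (suc i) (i≢p ∘ Fin.suc-injective) (i≢sp ∘ Fin.suc-injective)))
          (+-identityˡ _)

module DeterminantProperties (R : CommutativeRing 0ℓ 0ℓ) where
  open CommutativeRing R hiding (zero)
  open Determinant rawRing
  open Algebra.Properties.Semiring.Sum semiring
  open Algebra.Properties.Semiring.Exp semiring using (_^_)
  open FiniteSums R
  open IntegerSolver R
  open Relation.Binary.Reasoning.Setoid setoid

  private
    Matrix : ℕ → Set
    Matrix = SquareMatrix Carrier

    minor : ∀ {n} → Matrix (suc n) → Fin (suc n) → Matrix n
    minor M j i = removeAt (M (suc i)) j

  det-cong : ∀ {n} {M N : Matrix n} → (∀ i j → M i j ≈ N i j) → det M ≈ det N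
  det-cong {zero}  M≈N = refl
  det-cong {suc n} M≈N = sum-cong-≋ λ j →
    *-cong (*-congˡ {(- 1#) ^ toℕ j} (M≈N zero j)) (det-cong λ i k → M≈N (suc i) (punchIn j k))

  -- The expansion along the first row meets column `p` once per term: for `j = p` it supplies the
  -- entry, and the minors of the three matrices coincide; otherwise it lies in the minor, at the
  -- position `punchOut j≢p`, and the induction hypothesis applies. Additivity and homogeneity come
  -- out of the same induction.
  det-linear : ∀ {n} {M P Q : Matrix n} p a b →
               (∀ i j → j ≢ p → M i j ≈ P i j) → (∀ i j → j ≢ p → M i j ≈ Q i j) →
               (∀ i → M i p ≈ a * P i p + b * Q i p) →
               det M ≈ a * det P + b * det Q
  det-linear {suc n} {M} {P} {Q} p a b M≈P M≈Q Mp = begin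
    sum (term M)                                      ≈⟨ sum-cong-≋ linear ⟩
    sum (λ j → a * term P j + b * term Q j)           ≈⟨ ∑-distrib-+ (λ j → a * term P j) (λ j → b * term Q j) ⟩
    sum (λ j → a * term P j) + sum (λ j → b * term Q j)
      ≈⟨ +-cong (*-distribˡ-sum a (term P)) (*-distribˡ-sum b (term Q)) ⟨
    a * sum (term P) + b * sum (term Q)               ∎
    where
    s : Fin (suc n) → Carrier
    s j = (- 1#) ^ toℕ j

    term : Matrix (suc n) → Fin (suc n) → Carrier
    term N j = s j * N zero j * det (minor N j)

    linear : ∀ j → term M j ≈ a * term P j + b * term Q j
    linear j with j Fin.≟ p
    ... | yes ≡.refl = begin
      s j * M zero j * det (minor M j)
        ≈⟨ *-congʳ (*-congˡ (Mp zero)) ⟩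
      s j * (a * P zero j + b * Q zero j) * det (minor M j)
        ≈⟨ solve 6 (λ s a p b q d → s :* (a :* p :+ b :* q) :* d :=
                                     a :* (s :* p :* d) :+ b :* (s :* q :* d)) refl
             (s j) a (P zero j) b (Q zero j) (det (minor M j)) ⟩
      a * (s j * P zero j * det (minor M j)) + b * (s j * Q zero j * det (minor M j))
        ≈⟨ +-cong (*-congˡ (*-congˡ (det-cong λ i k → M≈P (suc i) _ (Fin.punchInᵢ≢i j k))))
                  (*-congˡ (*-congˡ (det-cong λ i k → M≈Q (suc i) _ (Fin.punchInᵢ≢i j k)))) ⟩
      a * term P j + b * term Q j ∎
    ... | no j≢p = begin
      s j * M zero j * det (minor M j)
        ≈⟨ *-congˡ (det-linear (punchOut j≢p) a b
             (λ i k k≢ → M≈P (suc i) _ (avoid k k≢)) (λ i k k≢ → M≈Q (suc i) _ (avoid k k≢)) column) ⟩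
      s j * M zero j * (a * det (minor P j) + b * det (minor Q j))
        ≈⟨ solve 6 (λ s m a p b q → s :* m :* (a :* p :+ b :* q) :=
                                     a :* (s :* m :* p) :+ b :* (s :* m :* q)) refl
             (s j) (M zero j) a (det (minor P j)) b (det (minor Q j)) ⟩
      a * (s j * M zero j * det (minor P j)) + b * (s j * M zero j * det (minor Q j))
        ≈⟨ +-cong (*-congˡ (*-congʳ (*-congˡ (M≈P zero j j≢p))))
                  (*-congˡ (*-congʳ (*-congˡ (M≈Q zero j j≢p)))) ⟩
      a * term P j + b * term Q j ∎
      where
      avoid : ∀ k → k ≢ punchOut j≢p → punchIn j k ≢ p
      avoid k k≢ eq = k≢ (Fin.punchIn-injective j k _ (≡.trans eq (≡.sym (Fin.punchIn-punchOut j≢p))))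

      column : ∀ i → minor M j i (punchOut j≢p) ≈
                     a * minor P j i (punchOut j≢p) + b * minor Q j i (punchOut j≢p)
      column i rewrite Fin.punchIn-punchOut j≢p = Mp (suc i)

  -- In the expansion the terms that delete another column vanish by induction, and the two
  -- remaining terms have opposite signs, equal entries and equal minors.
  det-adjacent : ∀ {n} (p : Fin n) (M : Matrix (suc n)) → (∀ i → M i (inject₁ p) ≈ M i (suc p)) →
                 det M ≈ 0#
  det-adjacent {suc n} p M eq = begin
    sum term                        ≈⟨ sum-pair p vanish ⟩
    term (inject₁ p) + term (suc p) ≈⟨ +-congʳ (*-cong (*-cong (reflexive (≡.cong ((- 1#) ^_) (Fin.toℕ-inject₁ p)))
                                                               (eq zero)) (det-cong same)) ⟩
    s * m * d + - 1# * s * m * d    ≈⟨ solve 3 (λ s m d → s :* m :* d :+ (:- con (+ 1)) :* s :* m :* d := con (+ 0))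
                                         refl s m d ⟩
    0#                              ∎
    where
    term : Fin (suc (suc n)) → Carrier
    term j = (- 1#) ^ toℕ j * M zero j * det (minor M j)

    s = (- 1#) ^ toℕ p
    m = M zero (suc p)
    d = det (minor M (suc p))

    same : ∀ i k → M (suc i) (punchIn (inject₁ p) k) ≈ M (suc i) (punchIn (suc p) k)
    same i k with punchIn-neighbours p k
    ... | inj₁ e          = reflexive (≡.cong (M (suc i)) e)
    ... | inj₂ (e₁ , e₂)  = begin
      M (suc i) (punchIn (inject₁ p) k) ≡⟨ ≡.cong (M (suc i)) e₁ ⟩
      M (suc i) (suc p)                 ≈⟨ eq (suc i) ⟨
      M (suc i) (inject₁ p)             ≡⟨ ≡.cong (M (suc i)) e₂ ⟨
      M (suc i) (punchIn (suc p) k)     ∎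

    vanish : ∀ j → j ≢ inject₁ p → j ≢ suc p → term j ≈ 0#
    vanish j j≢p j≢sp with q , e₁ , e₂ ← punchIn-adjacent j p j≢p j≢sp =
      trans (*-congˡ (det-adjacent q (minor M j) λ i → begin
        M (suc i) (punchIn j (inject₁ q)) ≡⟨ ≡.cong (M (suc i)) e₁ ⟩
        M (suc i) (inject₁ p)             ≈⟨ eq (suc i) ⟩
        M (suc i) (suc p)                 ≡⟨ ≡.cong (M (suc i)) e₂ ⟨
        M (suc i) (punchIn j (suc q))     ∎)) (zeroʳ _)

  -- With columns as the outer index, the replacement of a column in Cramer's rule is an update of a
  -- vector.
  detᶜ : ∀ {n} → Vector (Vector Carrier n) n → Carrier
  detᶜ N = det λ i j → N j i

  e : ∀ {n} → Fin n → Vector Carrier n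
  e u i = if does (i Fin.≟ u) then 1# else 0#

  module _ {n} (N : Vector (Vector Carrier n) n) where

    detᶜ-≗ : ∀ {M} → (∀ j → N j ≡ M j) → detᶜ N ≈ detᶜ M
    detᶜ-≗ eq = det-cong λ i j → reflexive (≡.cong (λ c → c i) (eq j))

    detᶜ-updateᶜ : ∀ v {c d} → (∀ i → c i ≈ d i) → detᶜ (N [ v ≔ c ]) ≈ detᶜ (N [ v ≔ d ])
    detᶜ-updateᶜ v {c} {d} c≈d = det-cong pointwise
      where
      pointwise : ∀ i j → (N [ v ≔ c ]) j i ≈ (N [ v ≔ d ]) j i
      pointwise i j with j Fin.≟ v
      ... | yes ≡.refl rewrite ≔-at N v {c} | ≔-at N v {d} = c≈d i
      ... | no j≢v rewrite ≔-off N {v} {j} {c} j≢v | ≔-off N {v} {j} {d} j≢v = refl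

    detᶜ-linear : ∀ v a b c d →
      detᶜ (N [ v ≔ (λ i → a * c i + b * d i) ]) ≈ a * detᶜ (N [ v ≔ c ]) + b * detᶜ (N [ v ≔ d ])
    detᶜ-linear v a b c d = det-linear v a b off off column
      where
      off : ∀ {c d} i j → j ≢ v → (N [ v ≔ c ]) j i ≈ (N [ v ≔ d ]) j i
      off {c} {d} i j j≢v = reflexive (≡.cong (λ c → c i) (≡.trans (≔-off N {x = c} j≢v) (≡.sym (≔-off N {x = d} j≢v))))

      column : ∀ i → (N [ v ≔ (λ i → a * c i + b * d i) ]) v i ≈
                     a * (N [ v ≔ c ]) v i + b * (N [ v ≔ d ]) v i
      column i rewrite ≔-at N v {λ i → a * c i + b * d i} | ≔-at N v {c} | ≔-at N v {d} = refl

    detᶜ-+ : ∀ v c d → detᶜ (N [ v ≔ (λ i → c i + d i) ]) ≈ detᶜ (N [ v ≔ c ]) + detᶜ (N [ v ≔ d ])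
    detᶜ-+ v c d = begin
      detᶜ (N [ v ≔ (λ i → c i + d i) ])             ≈⟨ detᶜ-updateᶜ v (λ i → +-cong (sym (*-identityˡ _)) (sym (*-identityˡ _))) ⟩
      detᶜ (N [ v ≔ (λ i → 1# * c i + 1# * d i) ])   ≈⟨ detᶜ-linear v 1# 1# c d ⟩
      1# * detᶜ (N [ v ≔ c ]) + 1# * detᶜ (N [ v ≔ d ]) ≈⟨ +-cong (*-identityˡ _) (*-identityˡ _) ⟩
      detᶜ (N [ v ≔ c ]) + detᶜ (N [ v ≔ d ])        ∎

    detᶜ-* : ∀ v a c → detᶜ (N [ v ≔ (λ i → a * c i) ]) ≈ a * detᶜ (N [ v ≔ c ])
    detᶜ-* v a c = begin
      detᶜ (N [ v ≔ (λ i → a * c i) ])               ≈⟨ detᶜ-updateᶜ v (λ i → sym (trans (+-congˡ (zeroˡ _)) (+-identityʳ _))) ⟩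
      detᶜ (N [ v ≔ (λ i → a * c i + 0# * c i) ])    ≈⟨ detᶜ-linear v a 0# c c ⟩
      a * detᶜ (N [ v ≔ c ]) + 0# * detᶜ (N [ v ≔ c ]) ≈⟨ trans (+-congˡ (zeroˡ _)) (+-identityʳ _) ⟩
      a * detᶜ (N [ v ≔ c ])                         ∎

  private
    basis-expansion : ∀ {n} (L : Vector Carrier n → Carrier) →
      (∀ {c d} → (∀ i → c i ≈ d i) → L c ≈ L d) →
      (∀ c d → L (λ i → c i + d i) ≈ L c + L d) →
      (∀ a c → L (λ i → a * c i) ≈ a * L c) →
      ∀ c → L c ≈ sum (λ u → c u * L (e u))
    basis-expansion {zero} L L-cong L-+ L-* c = begin
      -- All empty vectors agree, so `c` may be scaled by `0#`, and homogeneity kills the value.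
      L c                  ≈⟨ L-cong (λ ()) ⟩
      L (λ i → 0# * c i)   ≈⟨ L-* 0# c ⟩
      0# * L c             ≈⟨ zeroˡ _ ⟩
      0#                   ∎
    basis-expansion {suc n} L L-cong L-+ L-* c = begin
      L c
        ≈⟨ L-cong split ⟩
      L (λ i → c zero * e zero i + (0# ∷ᵛ tail c) i)
        ≈⟨ L-+ _ _ ⟩
      L (λ i → c zero * e zero i) + L (0# ∷ᵛ tail c)
        ≈⟨ +-cong (L-* _ _) (basis-expansion (λ t → L (0# ∷ᵛ t)) (λ eq → L-cong (cong-∷ eq))
             (λ t t′ → trans (L-cong (+-∷ t t′)) (L-+ _ _)) (λ a t → trans (L-cong (*-∷ a t)) (L-* _ _)) (tail c)) ⟩
      c zero * L (e zero) + sum (λ u → c (suc u) * L (0# ∷ᵛ e u))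
        ≈⟨ +-congˡ (sum-cong-≋ λ u → *-congˡ {c (suc u)} (L-cong (e-∷ u))) ⟩
      c zero * L (e zero) + sum (λ u → c (suc u) * L (e (suc u))) ∎
      where
      split : ∀ i → c i ≈ c zero * e zero i + (0# ∷ᵛ tail c) i
      split zero    = sym (trans (+-identityʳ _) (*-identityʳ _))
      split (suc i) = sym (trans (+-congʳ (zeroʳ _)) (+-identityˡ _))
      cong-∷ : ∀ {t t′ : Vector Carrier n} → (∀ i → t i ≈ t′ i) → ∀ i → (0# ∷ᵛ t) i ≈ (0# ∷ᵛ t′) i
      cong-∷ eq zero    = refl
      cong-∷ eq (suc i) = eq i
      +-∷ : ∀ (t t′ : Vector Carrier n) i → (0# ∷ᵛ λ i → t i + t′ i) i ≈ (0# ∷ᵛ t) i + (0# ∷ᵛ t′) i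
      +-∷ t t′ zero    = sym (+-identityˡ _)
      +-∷ t t′ (suc i) = refl
      *-∷ : ∀ a (t : Vector Carrier n) i → (0# ∷ᵛ λ i → a * t i) i ≈ a * (0# ∷ᵛ t) i
      *-∷ a t zero    = sym (zeroʳ a)
      *-∷ a t (suc i) = refl
      e-∷ : ∀ u i → (0# ∷ᵛ e u) i ≈ e (suc u) i
      e-∷ u zero    = refl
      e-∷ u (suc i) = refl

  -- Laplace expansion along a column, with each cofactor written as a determinant having a unit
  -- column. It follows from linearity in that column alone, although `det` is defined by rows.
  detᶜ-expand : ∀ {n} (N : Vector (Vector Carrier n) n) v c →
                detᶜ (N [ v ≔ c ]) ≈ sum (λ u → c u * detᶜ (N [ v ≔ e u ]))
  detᶜ-expand N v = basis-expansion (λ c → detᶜ (N [ v ≔ c ])) (detᶜ-updateᶜ N v) (detᶜ-+ N v) (detᶜ-* N v)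

  -- Antisymmetry under exchange of adjacent columns moves two equal columns
  -- next to each other.
  private
    det-equal-columns-< : ∀ {n} (N : Vector (Vector Carrier n) n) m {p q : Fin n} →
      toℕ q ≡ m → toℕ p ℕ.< m → (∀ i → N p i ≈ N q i) → detᶜ N ≈ 0#
    det-equal-columns-< {suc n} N (suc m) {p} {suc q} q≡m (s≤s p≤m) eq with p Fin.≟ inject₁ q
    ... | yes ≡.refl = det-adjacent q (λ i j → N j i) eq
    ... | no p≢q = begin
      detᶜ N            ≈⟨ detᶜ-≗ N (≔-≡ (N [ a ≔ w ]) N {b} ≡.refl λ i _ → ≔-≡ N N {a} ≡.refl (λ _ _ → ≡.refl) i) ⟩
      -- Polarisation: `G` vanishes on equal arguments, so `G w u + G u w` is the expansion of `G`
      -- at `u + w` twice, which vanishes. In `G u w` the column equal to `p` has moved from `b` to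
      -- `a`, one step closer to `p`.
      G w u             ≈⟨ solve 2 (λ x y → x := (con (+ 0) :+ y) :+ (x :+ con (+ 0)) :- y) refl (G w u) (G u w) ⟩
      ((0# + G u w) + (G w u + 0#)) - G u w
                        ≈⟨ +-cong (+-cong (+-congʳ (sym (G-diag u))) (+-congˡ (sym (G-diag w)))) (-‿cong equal) ⟩
      ((G u u + G u w) + (G w u + G w w)) - 0#
                        ≈⟨ +-congʳ (sym G-sum) ⟩
      G (λ i → u i + w i) (λ i → u i + w i) - 0#
                        ≈⟨ +-congʳ (G-diag _) ⟩
      0# - 0#           ≈⟨ -‿inverseʳ 0# ⟩
      0#                ∎
      where
      a b : Fin (suc n)
      a = inject₁ q
      b = suc q
      u w : Vector Carrier (suc n)
      u = N b
      w = N a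
      a≢b : a ≢ b
      a≢b a≡b = ℕ.<⇒≢ (ℕ.n<1+n (toℕ q)) (≡.trans (≡.sym (Fin.toℕ-inject₁ q)) (≡.cong toℕ a≡b))
      a≡m : toℕ a ≡ m
      a≡m = ≡.trans (Fin.toℕ-inject₁ q) (ℕ.suc-injective q≡m)
      p≢b : p ≢ b
      p≢b ≡.refl = ℕ.<-irrefl q≡m (s≤s p≤m)

      G : Vector Carrier (suc n) → Vector Carrier (suc n) → Carrier
      G x y = detᶜ (N [ a ≔ x ] [ b ≔ y ])

      G-diag : ∀ x → G x x ≈ 0#
      G-diag x = det-adjacent q (λ i j → (N [ a ≔ x ] [ b ≔ x ]) j i) λ i → reflexive (≡.cong (λ c → c i)
        (≡.trans (≔-off (N [ a ≔ x ]) {b} {a} {x} a≢b) (≡.trans (≔-at N a) (≡.sym (≔-at (N [ a ≔ x ]) b)))))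

      G-+ˡ : ∀ x x′ y → G (λ i → x i + x′ i) y ≈ G x y + G x′ y
      G-+ˡ x x′ y = begin
        G (λ i → x i + x′ i) y                           ≈⟨ detᶜ-≗ _ (≔-commute N a≢b) ⟩
        detᶜ (N [ b ≔ y ] [ a ≔ (λ i → x i + x′ i) ])    ≈⟨ detᶜ-+ (N [ b ≔ y ]) a x x′ ⟩
        detᶜ (N [ b ≔ y ] [ a ≔ x ]) + detᶜ (N [ b ≔ y ] [ a ≔ x′ ])
          ≈⟨ +-cong (detᶜ-≗ _ (≔-commute N (a≢b ∘ ≡.sym))) (detᶜ-≗ _ (≔-commute N (a≢b ∘ ≡.sym))) ⟩
        G x y + G x′ y ∎

      G-sum : G (λ i → u i + w i) (λ i → u i + w i) ≈ (G u u + G u w) + (G w u + G w w)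
      G-sum = trans (G-+ˡ u w _) (+-cong (detᶜ-+ (N [ a ≔ u ]) b u w) (detᶜ-+ (N [ a ≔ w ]) b u w))

      equal : G u w ≈ 0#
      equal = det-equal-columns-< (N [ a ≔ u ] [ b ≔ w ]) m {p} {a} a≡m
        (ℕ.≤∧≢⇒< p≤m (λ p≡m → p≢q (Fin.toℕ-injective (≡.trans p≡m (≡.sym a≡m))))) λ i → begin
          (N [ a ≔ u ] [ b ≔ w ]) p i  ≡⟨ ≡.cong (λ c → c i) (≡.trans (≔-off (N [ a ≔ u ]) p≢b) (≔-off N p≢q)) ⟩
          N p i                        ≈⟨ eq i ⟩
          u i                          ≡⟨ ≡.cong (λ c → c i) (≡.trans (≔-off (N [ a ≔ u ]) a≢b) (≔-at N a)) ⟨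
          (N [ a ≔ u ] [ b ≔ w ]) a i  ∎

  det-equal-columns : ∀ {n} (N : Vector (Vector Carrier n) n) {p q : Fin n} →
                      p ≢ q → (∀ i → N p i ≈ N q i) → detᶜ N ≈ 0#
  det-equal-columns N {p} {q} p≢q eq with ℕ.<-cmp (toℕ p) (toℕ q)
  ... | tri< p<q _ _ = det-equal-columns-< N (toℕ q) ≡.refl p<q eq

  ... | tri≈ _ p≡q _ = contradiction (Fin.toℕ-injective p≡q) p≢q
  ... | tri> _ _ q<p = det-equal-columns-< N (toℕ p) ≡.refl q<p (sym ∘ eq)

  det-scalar : ∀ n x → detᶜ {n} (λ v i → x * e v i) ≈ x ^ n
  det-scalar zero    x = refl
  det-scalar (suc n) x = begin
    sum term       ≈⟨ sum-single zero vanish ⟩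
    term zero      ≈⟨ *-cong (trans (*-congˡ (*-identityʳ x)) (*-identityˡ x)) (det-scalar n x) ⟩
    x * x ^ n      ∎
    where
    term : Fin (suc n) → Carrier
    term j = (- 1#) ^ toℕ j * (x * e j zero) * det (minor {n} (λ i k → x * e k i) j)
    vanish : ∀ j → j ≢ zero → term j ≈ 0#
    vanish zero    j≢0 = contradiction ≡.refl j≢0
    vanish (suc j) _   = trans (*-congʳ (trans (*-congˡ (zeroʳ x)) (zeroʳ _))) (zeroˡ _)

-- The determinant of x − a for a weighted unicyclic digraph

module CharacteristicDeterminant
  (R : CommutativeRing 0ℓ 0ℓ) (x : CommutativeRing.Carrier R) (x-cancel : Powers.Cancellable R x) {n : ℕ}
  where
  open CommutativeRing R hiding (zero)
  open Algebra.Properties.Semiring.Sum semiring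
  open Algebra.Properties.Semiring.Exp semiring using (_^_)
  open FiniteSums R
  open DeterminantProperties R
  open IntegerSolver R
  open Relation.Binary.Reasoning.Setoid setoid

  private
    Columns : Set
    Columns = Vector (Vector Carrier n) n

  x*p≈0⇒p≈0 : ∀ {p} → x * p ≈ 0# → p ≈ 0#
  x*p≈0⇒p≈0 eq = x-cancel (trans eq (sym (zeroʳ x)))

  diag : Columns
  diag v i = x * e v i

  col : (Fin n → Fin n → Carrier) → Columns
  col a v i = diag v i - a i v

  module _ (a : Fin n → Fin n → Carrier) where

    -- The vector `x * e u` is column `u` of `x − a` plus column `u` of `a`. Putting both into slot
    -- `v` gives the recurrence that drives all later computations; its first summand vanishes
    -- whenever column `u` is present elsewhere.
    diag-expand : ∀ (N : Columns) v u →
      x * detᶜ (N [ v ≔ e u ]) ≈ detᶜ (N [ v ≔ col a u ]) + sum (λ w → a w u * detᶜ (N [ v ≔ e w ]))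
    diag-expand N v u = begin
      x * detᶜ (N [ v ≔ e u ])         ≈⟨ detᶜ-* N v x (e u) ⟨
      detᶜ (N [ v ≔ diag u ])          ≈⟨ detᶜ-updateᶜ N v (λ i → solve 2 (λ y a → y := (y :- a) :+ a) refl (diag u i) (a i u)) ⟩
      detᶜ (N [ v ≔ (λ i → col a u i + a i u) ])  ≈⟨ detᶜ-+ N v (col a u) (λ i → a i u) ⟩
      detᶜ (N [ v ≔ col a u ]) + detᶜ (N [ v ≔ (λ i → a i u) ])  ≈⟨ +-congˡ (detᶜ-expand N v (λ i → a i u)) ⟩
      detᶜ (N [ v ≔ col a u ]) + sum (λ w → a w u * detᶜ (N [ v ≔ e w ])) ∎

    copy-vanishes : ∀ (N : Columns) {v u c} → v ≢ u → N u ≡ c → detᶜ (N [ v ≔ c ]) ≈ 0#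
    copy-vanishes N {v} {u} {c} v≢u Nu≡c = det-equal-columns (N [ v ≔ c ]) v≢u λ i → reflexive
      (≡.cong (λ d → d i) (≡.trans (≔-at N v) (≡.trans (≡.sym Nu≡c) (≡.sym (≔-off N (v≢u ∘ ≡.sym))))))

  a*p≈0 : ∀ {a p} → a ≈ 0# ⊎ p ≈ 0# → a * p ≈ 0#
  a*p≈0 (inj₁ a≈0) = trans (*-congʳ a≈0) (zeroˡ _)
  a*p≈0 (inj₂ p≈0) = trans (*-congˡ p≈0) (zeroʳ _)

  module Acyclic
    (a : Fin n → Fin n → Carrier)
    {_⊏_ : Rel (Fin n) 0ℓ}
    (⊏-wellFounded : WellFounded _⊏_) (⊏-trans : Transitive _⊏_) (⊏-irrefl : Irreflexive _≡_ _⊏_)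
    (support : ∀ u v → a u v ≈ 0# ⊎ u ⊏ v)
    where

    private
      -- The columns of `x − a` are exchanged for those of the scalar matrix one at a time; this is
      -- the invariant of the intermediate matrices.
      Mixed : Columns → Set
      Mixed N = ∀ w → N w ≡ col a w ⊎ N w ≡ diag w

      -- Multiplied by `x`, slot `v` holds the diagonal column `u`. If `N` still has that column at
      -- `u`, two columns agree. If `N` has column `u` of `x − a` there, the recurrence leaves only
      -- predecessors `w ⊏ u`, which also precede `v`.
      unit-vanishes : ∀ {N} → Mixed N → ∀ {v u} → Acc _⊏_ u → u ⊏ v → detᶜ (N [ v ≔ e u ]) ≈ 0#
      unit-vanishes {N} mixed {v} {u} (acc rs) u⊏v = x*p≈0⇒p≈0 (case (mixed u))
        where
        v≢u : v ≢ u
        v≢u v≡u = ⊏-irrefl (≡.sym v≡u) u⊏v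

        predecessor : ∀ w → a w u ≈ 0# ⊎ detᶜ (N [ v ≔ e w ]) ≈ 0#
        predecessor w with support w u
        ... | inj₁ a≈0 = inj₁ a≈0
        ... | inj₂ w⊏u = inj₂ (unit-vanishes mixed (rs w⊏u) (⊏-trans w⊏u u⊏v))

        case : N u ≡ col a u ⊎ N u ≡ diag u → x * detᶜ (N [ v ≔ e u ]) ≈ 0#
        case (inj₂ Nu≡diag) = trans (sym (detᶜ-* N v x (e u))) (copy-vanishes a N v≢u Nu≡diag)
        case (inj₁ Nu≡col)  = begin
          x * detᶜ (N [ v ≔ e u ])      ≈⟨ diag-expand a N v u ⟩
          detᶜ (N [ v ≔ col a u ]) + sum (λ w → a w u * detᶜ (N [ v ≔ e w ]))
            ≈⟨ +-cong (copy-vanishes a N v≢u Nu≡col) (sum-zero (a*p≈0 ∘ predecessor)) ⟩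
          0# + 0#                       ≈⟨ +-identityˡ _ ⟩
          0#                            ∎

      replace : ∀ {N} → Mixed N → ∀ v → detᶜ (N [ v ≔ col a v ]) ≈ detᶜ (N [ v ≔ diag v ])
      replace {N} mixed v = begin
        detᶜ (N [ v ≔ col a v ])        ≈⟨ +-identityʳ _ ⟨
        detᶜ (N [ v ≔ col a v ]) + 0#   ≈⟨ +-congˡ (sum-zero (a*p≈0 ∘ predecessor)) ⟨
        detᶜ (N [ v ≔ col a v ]) + sum (λ u → a u v * detᶜ (N [ v ≔ e u ])) ≈⟨ diag-expand a N v v ⟨
        x * detᶜ (N [ v ≔ e v ])        ≈⟨ detᶜ-* N v x (e v) ⟨
        detᶜ (N [ v ≔ diag v ])         ∎
        where
        predecessor : ∀ u → a u v ≈ 0# ⊎ detᶜ (N [ v ≔ e u ]) ≈ 0#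
        predecessor u with support u v
        ... | inj₁ a≈0 = inj₁ a≈0
        ... | inj₂ u⊏v = inj₂ (unit-vanishes mixed (⊏-wellFounded u) u⊏v)

      stage : ℕ → Columns
      stage k v with toℕ v ℕ.<? k
      ... | yes _ = diag v
      ... | no  _ = col a v

      stage-< : ∀ {k v} → toℕ v ℕ.< k → stage k v ≡ diag v
      stage-< {k} {v} v<k with toℕ v ℕ.<? k
      ... | yes _  = ≡.refl
      ... | no v≮k = contradiction v<k v≮k

      stage-≮ : ∀ {k v} → ¬ toℕ v ℕ.< k → stage k v ≡ col a v
      stage-≮ {k} {v} v≮k with toℕ v ℕ.<? k
      ... | yes v<k = contradiction v<k v≮k
      ... | no  _   = ≡.refl

      stage-mixed : ∀ k → Mixed (stage k)
      stage-mixed k v with toℕ v ℕ.<? k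
      ... | yes _ = inj₂ ≡.refl
      ... | no  _ = inj₁ ≡.refl

      stage-step : ∀ {k} → k ℕ.< n → detᶜ (stage k) ≈ detᶜ (stage (suc k))
      stage-step {k} k<n = begin
        detᶜ (stage k)                  ≈⟨ detᶜ-≗ (stage k) (≔-≡ (stage k) (stage k) before λ _ _ → ≡.refl) ⟩
        detᶜ (stage k [ v ≔ col a v ])  ≈⟨ replace (stage-mixed k) v ⟩
        detᶜ (stage k [ v ≔ diag v ])   ≈⟨ detᶜ-≗ (stage (suc k)) (≔-≡ (stage k) (stage (suc k)) after others) ⟨
        detᶜ (stage (suc k))            ∎
        where
        v : Fin n
        v = fromℕ< k<n
        v≡k : toℕ v ≡ k
        v≡k = Fin.toℕ-fromℕ< k<n
        before : stage k v ≡ col a v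
        before = stage-≮ (ℕ.<-irrefl v≡k)
        after : stage (suc k) v ≡ diag v
        after = stage-< (s≤s (ℕ.≤-reflexive v≡k))
        others : ∀ i → i ≢ v → stage (suc k) i ≡ stage k i
        others i i≢v with toℕ i ℕ.<? k
        ... | yes i<k = stage-< (ℕ.m<n⇒m<1+n i<k)
        ... | no i≮k  = stage-≮ λ i<1+k → i≮k (ℕ.≤∧≢⇒< (ℕ.s≤s⁻¹ i<1+k) λ i≡k →
                          i≢v (Fin.toℕ-injective (≡.trans i≡k (≡.sym v≡k))))

      stages : ∀ {k} → k ℕ.≤ n → detᶜ (stage 0) ≈ detᶜ (stage k)
      stages {zero}  _   = refl
      stages {suc k} k<n = trans (stages (ℕ.<⇒≤ k<n)) (stage-step k<n)

    det-acyclic : detᶜ (col a) ≈ x ^ n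
    det-acyclic = begin
      detᶜ (col a)    ≈⟨ detᶜ-≗ (col a) (λ v → ≡.sym (stage-≮ {0} λ ())) ⟩
      detᶜ (stage 0)  ≈⟨ stages ℕ.≤-refl ⟩
      detᶜ (stage n)  ≈⟨ detᶜ-≗ (stage n) (λ v → stage-< (Fin.toℕ<n v)) ⟩
      detᶜ diag       ≈⟨ det-scalar n x ⟩
      x ^ n           ∎

  -- The digraph enters only through where `a` may be nonzero. The cycle is a sequence `c` that
  -- returns to its start after `suc L` steps, and `_⊏_` increases along every arc that does not
  -- enter `c 0`.
  module Unicyclic
    (a : Fin n → Fin n → Carrier)
    {_⊏_ : Rel (Fin n) 0ℓ}
    (⊏-wellFounded : WellFounded _⊏_) (⊏-trans : Transitive _⊏_) (⊏-irrefl : Irreflexive _≡_ _⊏_)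
    (L : ℕ) (c : ℕ → Fin n) (c-closed : c (suc L) ≡ c 0) (c-distinct : ∀ k → k ℕ.< L → c (suc k) ≢ c 0)
    (Off : Fin n → Set) (off≢root : ∀ {v} → Off v → v ≢ c 0)
    (support : ∀ u v → v ≢ c 0 → a u v ≈ 0# ⊎ u ⊏ v)
    (support-off : ∀ u v → Off v → a u v ≈ 0# ⊎ Off u)
    (support-on : ∀ k → k ℕ.≤ L → ∀ u → u ≢ c k → a u (c (suc k)) ≈ 0# ⊎ Off u)
    where

    private
      r : Fin n
      r = c 0

    gain : ℕ → Carrier
    gain zero    = 1#
    gain (suc k) = gain k * a (c k) (c (suc k))

    private
      W : Fin n → Carrier
      W u = detᶜ (col a [ r ≔ e u ])

      W-relation : ∀ {v} → v ≢ r → x * W v ≈ sum (λ u → a u v * W u)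
      W-relation {v} v≢r = begin
        x * W v                                      ≈⟨ diag-expand a (col a) r v ⟩
        detᶜ (col a [ r ≔ col a v ]) + sum (λ u → a u v * W u)
          ≈⟨ +-congʳ (copy-vanishes a (col a) (v≢r ∘ ≡.sym) ≡.refl) ⟩
        0# + sum (λ u → a u v * W u)                 ≈⟨ +-identityˡ _ ⟩
        sum (λ u → a u v * W u)                      ∎

      W-off-acc : ∀ {v} → Acc _⊏_ v → Off v → W v ≈ 0#
      W-off-acc {v} (acc rs) off = x*p≈0⇒p≈0 (trans (W-relation (off≢root off)) (sum-zero (a*p≈0 ∘ predecessor)))
        where
        predecessor : ∀ u → a u v ≈ 0# ⊎ W u ≈ 0#
        -- `support-off` keeps the induction off the cycle, and `support` provides the descent in
        -- `_⊏_`.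
        predecessor u with support-off u v off | support u v (off≢root off)
        ... | inj₁ a≈0   | _         = inj₁ a≈0
        ... | inj₂ _     | inj₁ a≈0  = inj₁ a≈0
        ... | inj₂ off-u | inj₂ u⊏v  = inj₂ (W-off-acc (rs u⊏v) off-u)

      W-off : ∀ {v} → Off v → W v ≈ 0#
      W-off {v} = W-off-acc (⊏-wellFounded v)

      into-cycle : ∀ {k} → k ℕ.≤ L →
                   sum (λ u → a u (c (suc k)) * W u) ≈ a (c k) (c (suc k)) * W (c k)
      into-cycle {k} k≤L = sum-single (c k) λ u u≢ → a*p≈0 (predecessor u u≢)
        where
        predecessor : ∀ u → u ≢ c k → a u (c (suc k)) ≈ 0# ⊎ W u ≈ 0#
        predecessor u u≢ with support-on k k≤L u u≢
        ... | inj₁ a≈0 = inj₁ a≈0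
        ... | inj₂ off = inj₂ (W-off off)

      W-cycle : ∀ k → k ℕ.≤ L → x ^ k * W (c k) ≈ gain k * W r
      W-cycle zero    _   = refl
      W-cycle (suc k) k<L = begin
        x * x ^ k * W (c (suc k))                       ≈⟨ solve 3 (λ x y w → x :* y :* w := y :* (x :* w)) refl x (x ^ k) _ ⟩
        x ^ k * (x * W (c (suc k)))                     ≈⟨ *-congˡ (trans (W-relation (c-distinct k k<L)) (into-cycle (ℕ.<⇒≤ k<L))) ⟩
        x ^ k * (a (c k) (c (suc k)) * W (c k))         ≈⟨ solve 3 (λ y a w → y :* (a :* w) := a :* (y :* w)) refl (x ^ k) _ _ ⟩
        a (c k) (c (suc k)) * (x ^ k * W (c k))         ≈⟨ *-congˡ (W-cycle k (ℕ.<⇒≤ k<L)) ⟩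
        a (c k) (c (suc k)) * (gain k * W r)            ≈⟨ solve 3 (λ a g w → a :* (g :* w) := g :* a :* w) refl _ (gain k) (W r) ⟩
        gain k * a (c k) (c (suc k)) * W r              ∎

      W-root : x * W r ≈ detᶜ (col a) + a (c L) (c (suc L)) * W (c L)
      W-root = begin
        x * W r                                         ≈⟨ diag-expand a (col a) r r ⟩
        detᶜ (col a [ r ≔ col a r ]) + sum (λ u → a u r * W u)
          ≈⟨ +-cong (sym (detᶜ-≗ (col a) (≔-≡ (col a) (col a) ≡.refl λ _ _ → ≡.refl)))
                    (reflexive (≡.cong (λ v → sum (λ u → a u v * W u)) (≡.sym c-closed))) ⟩
        detᶜ (col a) + sum (λ u → a u (c (suc L)) * W u)
          ≈⟨ +-congˡ (into-cycle ℕ.≤-refl) ⟩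
        detᶜ (col a) + a (c L) (c (suc L)) * W (c L)    ∎

      cut : Fin n → Fin n → Carrier
      cut u v with v Fin.≟ r
      ... | yes _ = 0#
      ... | no  _ = a u v

      cut-support : ∀ u v → cut u v ≈ 0# ⊎ u ⊏ v
      cut-support u v with v Fin.≟ r
      ... | yes _  = inj₁ refl
      ... | no v≢r = support u v v≢r

      -- Multiplication by `x` turns the unit column into `diag r`, which is column `r` of
      -- `x − cut`; the other columns are those of `x − a`.
      W-root-acyclic : x * W r ≈ x ^ n
      W-root-acyclic = begin
        x * W r                      ≈⟨ detᶜ-* (col a) r x (e r) ⟨
        detᶜ (col a [ r ≔ diag r ])  ≈⟨ det-cong pointwise ⟩
        detᶜ (col cut)               ≈⟨ Acyclic.det-acyclic cut ⊏-wellFounded ⊏-trans ⊏-irrefl cut-support ⟩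
        x ^ n                        ∎
        where
        pointwise : ∀ i v → (col a [ r ≔ diag r ]) v i ≈ col cut v i
        pointwise i v with v Fin.≟ r
        ... | yes ≡.refl = begin
          (col a [ r ≔ diag r ]) r i   ≡⟨ ≡.cong (λ d → d i) (≔-at (col a) r) ⟩
          diag r i                     ≈⟨ solve 1 (λ d → d := d :- con (+ 0)) refl (diag r i) ⟩
          diag r i - 0#                ∎
        ... | no v≢r = reflexive (≡.cong (λ d → d i) (≔-off (col a) v≢r))

    det-unicyclic : x ^ suc L * detᶜ (col a) ≈ (x ^ suc L - gain (suc L)) * x ^ n
    det-unicyclic = begin
      -- The term `aL * W (c L)` is added and subtracted, so that `W-root` rewrites one half and
      -- `W-cycle` at `L` the other.
      x * x ^ L * D                        ≈⟨ solve 4 (λ x y d w → x :* y :* d := x :* (y :* (d :+ w) :- y :* w)) refl x (x ^ L) D (aL * W (c L)) ⟩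
      x * (x ^ L * (D + aL * W (c L)) - x ^ L * (aL * W (c L)))
        ≈⟨ *-congˡ (+-cong (*-congˡ (sym W-root)) (-‿cong (trans (solve 3 (λ y a w → y :* (a :* w) := a :* (y :* w)) refl (x ^ L) aL (W (c L)))
                                                                (*-congˡ (W-cycle L ℕ.≤-refl))))) ⟩
      x * (x ^ L * (x * W r) - aL * (gain L * W r))
        ≈⟨ solve 5 (λ x y a g w → x :* (y :* (x :* w) :- a :* (g :* w)) := (x :* y :- g :* a) :* (x :* w)) refl x (x ^ L) aL (gain L) (W r) ⟩
      (x * x ^ L - gain L * aL) * (x * W r)  ≈⟨ *-congˡ W-root-acyclic ⟩
      (x * x ^ L - gain L * aL) * x ^ n      ∎
      where
      D  = detᶜ (col a)
      aL = a (c L) (c (suc L))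

-- Directed cycles

toℕ-mod : ∀ m ℓ .{{_ : NonZero ℓ}} → toℕ (m mod ℓ) ≡ m % ℓ
toℕ-mod m ℓ = Fin.toℕ-fromℕ< _

mod-cong : ∀ {j k} ℓ .{{_ : NonZero ℓ}} → j % ℓ ≡ k % ℓ → j mod ℓ ≡ k mod ℓ
mod-cong {j} {k} ℓ eq = Fin.toℕ-injective (≡.trans (toℕ-mod j ℓ) (≡.trans eq (≡.sym (toℕ-mod k ℓ))))

suc-mod : ∀ k ℓ .{{_ : NonZero ℓ}} → suc k mod ℓ ≡ next (k mod ℓ)
suc-mod k ℓ = mod-cong ℓ (begin
  suc k % ℓ                       ≡⟨ ℕ.%-distribˡ-+ 1 k ℓ ⟩
  (1 % ℓ ℕ.+ k % ℓ) % ℓ           ≡⟨ ≡.cong (λ m → (1 % ℓ ℕ.+ m) % ℓ) (ℕ.m%n%n≡m%n k ℓ) ⟨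
  (1 % ℓ ℕ.+ k % ℓ % ℓ) % ℓ       ≡⟨ ℕ.%-distribˡ-+ 1 (k % ℓ) ℓ ⟨
  suc (k % ℓ) % ℓ                 ≡⟨ ≡.cong (λ m → suc m % ℓ) (toℕ-mod k ℓ) ⟨
  suc (toℕ (k mod ℓ)) % ℓ         ∎)
  where open ≡.≡-Reasoning

next-inject₁ : ∀ {k} (i : Fin k) → next (inject₁ i) ≡ suc i
next-inject₁ {k} i = Fin.toℕ-injective (begin
  toℕ (next (inject₁ i))            ≡⟨ toℕ-mod (suc (toℕ (inject₁ i))) (suc k) ⟩
  suc (toℕ (inject₁ i)) % suc k     ≡⟨ ≡.cong (λ m → suc m % suc k) (Fin.toℕ-inject₁ i) ⟩
  suc (toℕ i) % suc k               ≡⟨ ℕ.m<n⇒m%n≡m (s≤s (Fin.toℕ<n i)) ⟩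
  suc (toℕ i)                       ∎)
  where open ≡.≡-Reasoning

next-fromℕ : ∀ k → next (fromℕ k) ≡ zero
next-fromℕ k = Fin.toℕ-injective (begin
  toℕ (next (fromℕ k))            ≡⟨ toℕ-mod (suc (toℕ (fromℕ k))) (suc k) ⟩
  suc (toℕ (fromℕ k)) % suc k     ≡⟨ ≡.cong (λ m → suc m % suc k) (Fin.toℕ-fromℕ k) ⟩
  suc k % suc k                   ≡⟨ ℕ.n%n≡0 (suc k) ⟩
  0                               ∎)
  where open ≡.≡-Reasoning

module Paths {n} (D : Digraph n) where
  open Digraph D

  record Path (u v : Fin n) : Set where
    field
      size     : ℕ
      vertex   : Fin (suc size) → Fin n
      distinct : ∀ {i j} → vertex i ≡ vertex j → i ≡ j
      arc      : ∀ i → vertex (inject₁ i) ⟶ vertex (suc i)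
      start    : vertex zero ≡ u
      end      : vertex (fromℕ size) ≡ v

  trivial : ∀ v → Path v v
  trivial v = record
    { size = 0 ; vertex = λ _ → v ; distinct = λ { {zero} {zero} _ → ≡.refl }
    ; arc = λ () ; start = ≡.refl ; end = ≡.refl }

  suffix : ∀ {u v} (p : Path u v) (i : Fin (suc (Path.size p))) → Path (Path.vertex p i) v
  suffix p zero = record
    { size = size ; vertex = vertex ; distinct = distinct ; arc = arc ; start = ≡.refl ; end = end }
    where open Path p
  suffix record { size = suc m ; vertex = vertex ; distinct = distinct ; arc = arc ; end = end } (suc i) =
    suffix record
      { size = m ; vertex = vertex ∘ suc ; distinct = Fin.suc-injective ∘ distinct
      ; arc = arc ∘ suc ; start = ≡.refl ; end = end } i

  extend : ∀ {u v w} → w ⟶ u → (p : Path u v) → (∀ i → Path.vertex p i ≢ w) → Path w v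
  extend {w = w} w⟶u p fresh = record
    { size = suc size
    ; vertex = w ∷ᵛ vertex
    ; distinct = λ
        { {zero}  {zero}  _  → ≡.refl
        ; {zero}  {suc j} eq → contradiction (≡.sym eq) (fresh j)
        ; {suc i} {zero}  eq → contradiction eq (fresh i)
        ; {suc i} {suc j} eq → ≡.cong suc (distinct eq) }
    ; arc = λ
        { zero    → ≡.subst (w ⟶_) (≡.sym start) w⟶u
        ; (suc i) → arc i }
    ; start = ≡.refl
    ; end = end }
    where open Path p

  -- If `u` already occurs on the loop-free remainder, the part of the remainder from that
  -- occurrence on is itself a path from `u`, and the new arc is dropped.
  erase-loops : ∀ {u v} → Star _⟶_ u v → Path u v
  erase-loops ε = trivial _
  erase-loops {u} (u⟶w ◅ walk) with p ← erase-loops walk | Fin.any? (λ i → Path.vertex p i Fin.≟ u)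
  ... | yes (i , ≡.refl) = suffix p i
  ... | no fresh         = extend u⟶w p (λ i eq → fresh (i , eq))

  close : ∀ {u v} → u ⟶ v → Path v u → DirectedCycle D
  close {u} {v} u⟶v p = record
    { length = suc size ; vertex = vertex ; vertex-distinct = distinct ; arc = closed-arc }
    where
    open Path p
    closed-arc : ∀ i → vertex i ⟶ vertex (next i)
    closed-arc i with view i
    ... | ‵fromℕ     rewrite next-fromℕ size | end | start = u⟶v
    ... | ‵inject₁ j rewrite next-inject₁ j = arc j

  ∈-close : ∀ {u v} (u⟶v : u ⟶ v) (p : Path v u) →
            _∈ᵉ_ D (u , v) (underlying D (close u⟶v p))
  ∈-close u⟶v p = fromℕ size , ≡.cong₂ _,_ end (≡.trans (≡.cong vertex (next-fromℕ size)) start)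
    where open Path p

-- Arcs and acyclicity in a unicyclic digraph

module UnicyclicStructure {n} {D : Digraph n} (U : IsUnicyclic D) where
  open Digraph D
  open IsUnicyclic U
  open DirectedCycle cycle renaming (length to ℓ)
  open Paths D

  closed-walk-on-cycle : ∀ {u v} → u ⟶ v → Star _⟶_ v u → OnCycle u v
  closed-walk-on-cycle u⟶v walk =
    Equivalence.to (unique (underlying D (close u⟶v p)) _) (∈-close u⟶v p)
    where p = erase-loops walk

  -- The cycle unrolled over ℕ: a step is `suc` instead of the wrapping `next`, and wrapping
  -- survives only as `c-period`.
  c : ℕ → Fin n
  c k = vertex (k mod ℓ)

  L : ℕ
  L = pred ℓ

  1+L≡ℓ : suc L ≡ ℓ
  1+L≡ℓ = ℕ.suc-pred ℓ

  c-arc : ∀ k → c k ⟶ c (suc k)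
  c-arc k = ≡.subst (λ i → c k ⟶ vertex i) (≡.sym (suc-mod k ℓ)) (arc (k mod ℓ))

  c-toℕ : ∀ i → c (toℕ i) ≡ vertex i
  c-toℕ i = ≡.cong vertex (Fin.toℕ-injective (≡.trans (toℕ-mod (toℕ i) ℓ) (ℕ.m<n⇒m%n≡m (Fin.toℕ<n i))))

  c-period : c ℓ ≡ c 0
  c-period = ≡.cong vertex (mod-cong ℓ (≡.trans (ℕ.n%n≡0 ℓ) (≡.sym (ℕ.m<n⇒m%n≡m (ℕ.>-nonZero⁻¹ ℓ)))))

  c-injective : ∀ {j k} → j ℕ.< ℓ → k ℕ.< ℓ → c j ≡ c k → j ≡ k
  c-injective {j} {k} j<ℓ k<ℓ eq = begin
    j                  ≡⟨ ℕ.m<n⇒m%n≡m j<ℓ ⟨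
    j % ℓ              ≡⟨ toℕ-mod j ℓ ⟨
    toℕ (j mod ℓ)      ≡⟨ ≡.cong toℕ (vertex-distinct eq) ⟩
    toℕ (k mod ℓ)      ≡⟨ toℕ-mod k ℓ ⟩
    k % ℓ              ≡⟨ ℕ.m<n⇒m%n≡m k<ℓ ⟩
    k                  ∎
    where open ≡.≡-Reasoning

  Off : Fin n → Set
  Off v = ∀ k → k ℕ.< ℓ → v ≢ c k

  on-or-off : ∀ v → (∃[ k ] k ℕ.< ℓ × v ≡ c k) ⊎ Off v
  on-or-off v with Fin.any? (λ i → vertex i Fin.≟ v)
  ... | yes (i , vᵢ≡v) = inj₁ (toℕ i , Fin.toℕ<n i , ≡.trans (≡.sym vᵢ≡v) (≡.sym (c-toℕ i)))
  ... | no  v-off      = inj₂ λ k k<ℓ v≡cₖ → v-off (k mod ℓ , ≡.sym v≡cₖ)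

  OnCycle⇒c : ∀ {u v} → OnCycle u v → ∃[ k ] k ℕ.< ℓ × u ≡ c k × v ≡ c (suc k)
  OnCycle⇒c (i , ≡.refl) = toℕ i , Fin.toℕ<n i , ≡.sym (c-toℕ i) , ≡.refl

  private
    forward : ∀ m j → Star _⟶_ (c j) (c (m ℕ.+ j))
    forward zero    j = ε
    forward (suc m) j = forward m j ◅◅ c-arc (m ℕ.+ j) ◅ ε

    -- Going on from position `j` to position `ℓ` arrives at `c 0`, from where every `c k` is ahead;
    -- thus `j` and `k` never have to be compared.
    around : ∀ {j} → j ℕ.< ℓ → ∀ k → Star _⟶_ (c j) (c k)
    around {j} j<ℓ k =
      ≡.subst (Star _⟶_ (c j)) (≡.trans (≡.cong c (ℕ.m∸n+n≡m (ℕ.<⇒≤ j<ℓ))) c-period) (forward (ℓ ℕ.∸ j) j)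
      ◅◅ ≡.subst (Star _⟶_ (c 0) ∘ c) (ℕ.+-identityʳ k) (forward k 0)

  OnCycle? : ∀ u v → Dec (OnCycle u v)
  OnCycle? u v = Fin.any? λ i → ≡-dec Fin._≟_ Fin._≟_ (vertex i , vertex (next i)) (u , v)

  -- A remaining arc leaving the cycle would lie on a closed walk, since its
  -- tree leads back to the cycle.
  arc-from-cycle : ∀ {k w} → k ℕ.< ℓ → c k ⟶ w → w ≡ c (suc k)
  arc-from-cycle {k} {w} k<ℓ cₖ⟶w = successor (OnCycle⇒c on-cycle)
    where
    successor : ∃[ j ] j ℕ.< ℓ × c k ≡ c j × w ≡ c (suc j) → w ≡ c (suc k)
    successor (j , j<ℓ , cₖ≡cⱼ , w≡) =
      ≡.trans w≡ (≡.cong (c ∘ suc) (c-injective j<ℓ k<ℓ (≡.sym cₖ≡cⱼ)))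

    back : ¬ OnCycle (c k) w → Star _⟶_ w (c k)
    back ¬on with S , S⊆ , cₖ⟶ₛw , i , tree ← remaining cₖ⟶w ¬on =
      Star.map (proj₁ ∘ S⊆) (IsTreeTowards.oriented tree cₖ⟶ₛw)
      ◅◅ ≡.subst (λ v → Star _⟶_ v (c k)) (c-toℕ i) (around (Fin.toℕ<n i) k)

    on-cycle : OnCycle (c k) w
    on-cycle with OnCycle? (c k) w
    ... | yes on = on
    ... | no ¬on = closed-walk-on-cycle cₖ⟶w (back ¬on)

  -- If `u` were `c k`, its only out-arc would lead to `c (suc k)`, which is on the cycle again; for
  -- the last `k` that vertex has to be read as `c 0`.
  arc-into-off : ∀ {u v} → u ⟶ v → Off v → Off u
  arc-into-off u⟶v off k k<ℓ ≡.refl with ℕ.m≤n⇒m<n∨m≡n k<ℓ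
  ... | inj₁ 1+k<ℓ = off (suc k) 1+k<ℓ (arc-from-cycle k<ℓ u⟶v)
  ... | inj₂ 1+k≡ℓ = off 0 (ℕ.≤-<-trans z≤n k<ℓ)
    (≡.trans (arc-from-cycle k<ℓ u⟶v) (≡.trans (≡.cong c 1+k≡ℓ) c-period))

  0<ℓ : 0 ℕ.< ℓ
  0<ℓ = ℕ.>-nonZero⁻¹ ℓ

  off≢root : ∀ {v} → Off v → v ≢ c 0
  off≢root off = off 0 0<ℓ

  c-suc≢root : ∀ {k} → suc k ℕ.< ℓ → c (suc k) ≢ c 0
  c-suc≢root 1+k<ℓ eq with () ← c-injective 1+k<ℓ 0<ℓ eq

  arc-into-cycle : ∀ {k u} → k ℕ.< ℓ → u ⟶ c (suc k) → u ≡ c k ⊎ Off u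
  arc-into-cycle {k} {u} k<ℓ u⟶c with on-or-off u
  ... | inj₂ off = inj₂ off
  ... | inj₁ (j , j<ℓ , ≡.refl) = inj₁ (≡.cong c (same (arc-from-cycle j<ℓ u⟶c)))
    where
    same : c (suc k) ≡ c (suc j) → j ≡ k
    -- `c` is injective only below `ℓ`, so an index that has reached `ℓ` is first replaced by 0.
    same eq with ℕ.m≤n⇒m<n∨m≡n j<ℓ | ℕ.m≤n⇒m<n∨m≡n k<ℓ
    ... | inj₁ 1+j<ℓ | inj₁ 1+k<ℓ = ℕ.suc-injective (c-injective 1+j<ℓ 1+k<ℓ (≡.sym eq))
    ... | inj₂ 1+j≡ℓ | inj₂ 1+k≡ℓ = ℕ.suc-injective (≡.trans 1+j≡ℓ (≡.sym 1+k≡ℓ))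
    ... | inj₁ 1+j<ℓ | inj₂ 1+k≡ℓ =
      contradiction (≡.trans (≡.sym eq) (≡.trans (≡.cong c 1+k≡ℓ) c-period)) (c-suc≢root 1+j<ℓ)
    ... | inj₂ 1+j≡ℓ | inj₁ 1+k<ℓ =
      contradiction (≡.trans eq (≡.trans (≡.cong c 1+j≡ℓ) c-period)) (c-suc≢root 1+k<ℓ)

  -- Removing the arcs into the root c 0 breaks the only directed cycle.
  _⟶′_ : Rel (Fin n) 0ℓ
  u ⟶′ v = u ⟶ v × v ≢ c 0

  -- The transitive closure of `_⟶′_`. Its first arc is kept apart because `⊏-irrefl` places exactly
  -- this arc on the cycle.
  _⊏_ : Rel (Fin n) 0ℓ
  u ⊏ v = ∃[ w ] u ⟶′ w × Star _⟶′_ w v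

  ⊏-arc : ∀ {u v} → u ⟶ v → v ≢ c 0 → u ⊏ v
  ⊏-arc u⟶v v≢ = _ , (u⟶v , v≢) , ε

  ⊏-trans : Transitive _⊏_
  ⊏-trans (_ , a , s) (_ , b , t) = _ , a , s ◅◅ b ◅ t

  private
    not-last : ∀ {j} → j ℕ.< ℓ → c (suc j) ≢ c 0 → suc j ℕ.< ℓ
    not-last j<ℓ ≢root = ℕ.≤∧≢⇒< j<ℓ λ 1+j≡ℓ → ≢root (≡.trans (≡.cong c 1+j≡ℓ) c-period)

    -- On the cycle each arc leads to the next position, and since no arc of the walk enters `c 0`
    -- the position cannot wrap around: it never decreases.
    ahead : ∀ {j y} → j ℕ.< ℓ → Star _⟶′_ (c j) y → ∃[ k ] j ℕ.≤ k × k ℕ.< ℓ × y ≡ c k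
    ahead {j} j<ℓ ε = j , ℕ.≤-refl , j<ℓ , ≡.refl
    ahead {j} j<ℓ ((cⱼ⟶w , w≢) ◅ walk) with ≡.refl ← arc-from-cycle j<ℓ cⱼ⟶w
      with k , j<k , k<ℓ , y≡ ← ahead (not-last j<ℓ w≢) walk
      = k , ℕ.<⇒≤ j<k , k<ℓ , y≡

  -- On a closed walk the first arc lies on the cycle, going from some `c j` to `c (suc j)`. The
  -- rest of the walk stays at positions above `j` and so cannot return to `c j`.
  ⊏-irrefl : Irreflexive _≡_ _⊏_
  ⊏-irrefl ≡.refl (w , (u⟶w , w≢) , walk)
    with j , j<ℓ , ≡.refl , ≡.refl ← OnCycle⇒c (closed-walk-on-cycle u⟶w (Star.map proj₁ walk))
    with k , j<k , k<ℓ , cⱼ≡cₖ ← ahead (not-last j<ℓ w≢) walk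
    = ℕ.<⇒≢ j<k (c-injective j<ℓ k<ℓ cⱼ≡cₖ)

  private
    ⊏-isStrictPartialOrder : IsStrictPartialOrder _≡_ _⊏_
    ⊏-isStrictPartialOrder = record
      { isEquivalence = ≡.isEquivalence
      ; irrefl = ⊏-irrefl
      ; trans = ⊏-trans
      ; <-resp-≈ = ≡.resp₂ _⊏_
      }

  ⊏-wellFounded : WellFounded _⊏_
  ⊏-wellFounded = spo-wellFounded ⊏-isStrictPartialOrder

  -- The upward direction serves the eigenvectors, whose value at a vertex depends on the heads of
  -- its arcs.
  ⊏-noetherian : WellFounded (flip _⊏_)
  ⊏-noetherian = spo-noetherian ⊏-isStrictPartialOrder

  ℓ≤n : ℓ ℕ.≤ n
  ℓ≤n = Fin.injective⇒≤ vertex-distinct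

-- Polynomials

module PolynomialRing (K : CommutativeRing 0ℓ 0ℓ) where
  open CommutativeRing K hiding (zero)
  open Algebra.Properties.Ring ring
  open Polynomials rawRing
  open IntegerSolver K
  open Relation.Binary.Reasoning.Setoid setoid

  private
    0+0 : 0# ≈ 0# + 0#
    0+0 = sym (+-identityʳ 0#)

  ∷-cong : ∀ {a b p q} → a ≈ b → p ≈ₚ q → (a ∷ p) ≈ₚ (b ∷ q)
  ∷-cong a≈b p≈q zero    = a≈b
  ∷-cong a≈b p≈q (suc k) = p≈q k

  coeff-+ : ∀ p q k → coeff (p +ₚ q) k ≈ coeff p k + coeff q k
  coeff-+ []      q       k       = sym (+-identityˡ _)
  coeff-+ (a ∷ p) []      k       = sym (+-identityʳ _)
  coeff-+ (a ∷ p) (b ∷ q) zero    = refl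
  coeff-+ (a ∷ p) (b ∷ q) (suc k) = coeff-+ p q k

  coeff-scale : ∀ a p k → coeff (map (a *_) p) k ≈ a * coeff p k
  coeff-scale a []      k       = sym (zeroʳ a)
  coeff-scale a (b ∷ p) zero    = refl
  coeff-scale a (b ∷ p) (suc k) = coeff-scale a p k

  coeff-neg : ∀ p k → coeff (map (-_) p) k ≈ - coeff p k
  coeff-neg []      k       = sym -0#≈0#
  coeff-neg (b ∷ p) zero    = refl
  coeff-neg (b ∷ p) (suc k) = coeff-neg p k

  coeff-∷* : ∀ a p q k → coeff ((a ∷ p) *ₚ q) k ≈ a * coeff q k + coeff (0# ∷ (p *ₚ q)) k
  coeff-∷* a p q k = trans (coeff-+ (map (a *_) q) _ k) (+-congʳ (coeff-scale a q k))

  *ₚ-congˡ : ∀ p {q r} → q ≈ₚ r → (p *ₚ q) ≈ₚ (p *ₚ r)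
  *ₚ-congˡ []      q≈r k = refl
  *ₚ-congˡ (a ∷ p) {q} {r} q≈r k = begin
    coeff ((a ∷ p) *ₚ q) k                     ≈⟨ coeff-∷* a p q k ⟩
    a * coeff q k + coeff (0# ∷ (p *ₚ q)) k    ≈⟨ +-cong (*-congˡ (q≈r k)) (∷-cong refl (*ₚ-congˡ p q≈r) k) ⟩
    a * coeff r k + coeff (0# ∷ (p *ₚ r)) k    ≈⟨ coeff-∷* a p r k ⟨
    coeff ((a ∷ p) *ₚ r) k                     ∎

  *ₚ-zeroʳ : ∀ p → (p *ₚ []) ≈ₚ []
  *ₚ-zeroʳ []      k       = refl
  *ₚ-zeroʳ (a ∷ p) zero    = refl
  *ₚ-zeroʳ (a ∷ p) (suc k) = *ₚ-zeroʳ p k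

  -- The defining recursion of `_*ₚ_` mirrored to the right factor. With it commutativity is a plain
  -- induction, and congruence and distributivity on the other side follow by commuting.
  coeff-*∷ : ∀ p b q k → coeff (p *ₚ (b ∷ q)) k ≈ b * coeff p k + coeff (0# ∷ (p *ₚ q)) k
  coeff-*∷ []      b q zero    = sym (trans (+-congʳ (zeroʳ b)) (+-identityˡ 0#))
  coeff-*∷ []      b q (suc k) = sym (trans (+-congʳ (zeroʳ b)) (+-identityˡ 0#))
  coeff-*∷ (a ∷ p) b q zero    = +-congʳ (*-comm a b)
  coeff-*∷ (a ∷ p) b q (suc k) = begin
    coeff (map (a *_) q +ₚ (p *ₚ (b ∷ q))) k                     ≈⟨ coeff-+ (map (a *_) q) _ k ⟩
    coeff (map (a *_) q) k + coeff (p *ₚ (b ∷ q)) k              ≈⟨ +-cong (coeff-scale a q k) (coeff-*∷ p b q k) ⟩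
    a * coeff q k + (b * coeff p k + coeff (0# ∷ (p *ₚ q)) k)    ≈⟨ solve 3 (λ x y z → x :+ (y :+ z) := y :+ (x :+ z)) refl _ _ _ ⟩
    b * coeff p k + (a * coeff q k + coeff (0# ∷ (p *ₚ q)) k)    ≈⟨ +-congˡ (coeff-∷* a p q k) ⟨
    b * coeff p k + coeff ((a ∷ p) *ₚ q) k                       ∎

  *ₚ-comm : ∀ p q → (p *ₚ q) ≈ₚ (q *ₚ p)
  *ₚ-comm []      q k = sym (*ₚ-zeroʳ q k)
  *ₚ-comm (a ∷ p) q k = begin
    coeff ((a ∷ p) *ₚ q) k                     ≈⟨ coeff-∷* a p q k ⟩
    a * coeff q k + coeff (0# ∷ (p *ₚ q)) k    ≈⟨ +-congˡ (∷-cong refl (*ₚ-comm p q) k) ⟩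
    a * coeff q k + coeff (0# ∷ (q *ₚ p)) k    ≈⟨ coeff-*∷ q a p k ⟨
    coeff (q *ₚ (a ∷ p)) k                     ∎

  *ₚ-cong : ∀ {p q r s} → p ≈ₚ q → r ≈ₚ s → (p *ₚ r) ≈ₚ (q *ₚ s)
  *ₚ-cong {p} {q} {r} {s} p≈q r≈s k = begin
    coeff (p *ₚ r) k   ≈⟨ *ₚ-congˡ p r≈s k ⟩
    coeff (p *ₚ s) k   ≈⟨ *ₚ-comm p s k ⟩
    coeff (s *ₚ p) k   ≈⟨ *ₚ-congˡ s p≈q k ⟩
    coeff (s *ₚ q) k   ≈⟨ *ₚ-comm s q k ⟩
    coeff (q *ₚ s) k   ∎

  +ₚ-shift : ∀ p q k → coeff (0# ∷ (p +ₚ q)) k ≈ coeff (0# ∷ p) k + coeff (0# ∷ q) k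
  +ₚ-shift p q zero    = 0+0
  +ₚ-shift p q (suc k) = coeff-+ p q k

  *ₚ-distribˡ : ∀ p q r → (p *ₚ (q +ₚ r)) ≈ₚ ((p *ₚ q) +ₚ (p *ₚ r))
  *ₚ-distribˡ []      q r k = refl
  *ₚ-distribˡ (a ∷ p) q r k = begin
    coeff ((a ∷ p) *ₚ (q +ₚ r)) k
      ≈⟨ coeff-∷* a p (q +ₚ r) k ⟩
    a * coeff (q +ₚ r) k + coeff (0# ∷ (p *ₚ (q +ₚ r))) k
      ≈⟨ +-cong (*-congˡ (coeff-+ q r k)) (trans (∷-cong refl (*ₚ-distribˡ p q r) k) (+ₚ-shift (p *ₚ q) _ k)) ⟩
    a * (coeff q k + coeff r k) + (coeff (0# ∷ (p *ₚ q)) k + coeff (0# ∷ (p *ₚ r)) k)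
      ≈⟨ solve 5 (λ a q r x y → a :* (q :+ r) :+ (x :+ y) := (a :* q :+ x) :+ (a :* r :+ y)) refl a _ _ _ _ ⟩
    (a * coeff q k + coeff (0# ∷ (p *ₚ q)) k) + (a * coeff r k + coeff (0# ∷ (p *ₚ r)) k)
      ≈⟨ +-cong (coeff-∷* a p q k) (coeff-∷* a p r k) ⟨
    coeff ((a ∷ p) *ₚ q) k + coeff ((a ∷ p) *ₚ r) k
      ≈⟨ coeff-+ ((a ∷ p) *ₚ q) _ k ⟨
    coeff (((a ∷ p) *ₚ q) +ₚ ((a ∷ p) *ₚ r)) k ∎

  +ₚ-cong : ∀ {p q r s} → p ≈ₚ q → r ≈ₚ s → (p +ₚ r) ≈ₚ (q +ₚ s)
  +ₚ-cong {p} {q} {r} {s} p≈q r≈s k =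
    trans (coeff-+ p r k) (trans (+-cong (p≈q k) (r≈s k)) (sym (coeff-+ q s k)))

  *ₚ-distribʳ : ∀ p q r → ((q +ₚ r) *ₚ p) ≈ₚ ((q *ₚ p) +ₚ (r *ₚ p))
  *ₚ-distribʳ p q r k = begin
    coeff ((q +ₚ r) *ₚ p) k             ≈⟨ *ₚ-comm (q +ₚ r) p k ⟩
    coeff (p *ₚ (q +ₚ r)) k             ≈⟨ *ₚ-distribˡ p q r k ⟩
    coeff ((p *ₚ q) +ₚ (p *ₚ r)) k      ≈⟨ +ₚ-cong {p *ₚ q} {q *ₚ p} {p *ₚ r} (*ₚ-comm p q) (*ₚ-comm p r) k ⟩
    coeff ((q *ₚ p) +ₚ (r *ₚ p)) k      ∎

  scale-*ₚ : ∀ a p q k → coeff (map (a *_) p *ₚ q) k ≈ a * coeff (p *ₚ q) k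
  scale-*ₚ a []      q k = sym (zeroʳ a)
  scale-*ₚ a (b ∷ p) q k = begin
    coeff ((a * b ∷ map (a *_) p) *ₚ q) k                             ≈⟨ coeff-∷* (a * b) (map (a *_) p) q k ⟩
    a * b * coeff q k + coeff (0# ∷ (map (a *_) p *ₚ q)) k            ≈⟨ +-congˡ (shift k) ⟩
    a * b * coeff q k + a * coeff (0# ∷ (p *ₚ q)) k                   ≈⟨ solve 4 (λ a b q x → a :* b :* q :+ a :* x := a :* (b :* q :+ x)) refl a b _ _ ⟩
    a * (b * coeff q k + coeff (0# ∷ (p *ₚ q)) k)                     ≈⟨ *-congˡ (coeff-∷* b p q k) ⟨
    a * coeff ((b ∷ p) *ₚ q) k                                        ∎
    where
    shift : ∀ k → coeff (0# ∷ (map (a *_) p *ₚ q)) k ≈ a * coeff (0# ∷ (p *ₚ q)) k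
    shift zero    = sym (zeroʳ a)
    shift (suc k) = scale-*ₚ a p q k

  *ₚ-assoc : ∀ p q r → ((p *ₚ q) *ₚ r) ≈ₚ (p *ₚ (q *ₚ r))
  *ₚ-assoc []      q r k = refl
  *ₚ-assoc (a ∷ p) q r k = begin
    coeff ((map (a *_) q +ₚ (0# ∷ (p *ₚ q))) *ₚ r) k
      ≈⟨ *ₚ-distribʳ r (map (a *_) q) (0# ∷ (p *ₚ q)) k ⟩
    coeff ((map (a *_) q *ₚ r) +ₚ ((0# ∷ (p *ₚ q)) *ₚ r)) k
      ≈⟨ coeff-+ (map (a *_) q *ₚ r) _ k ⟩
    coeff (map (a *_) q *ₚ r) k + coeff ((0# ∷ (p *ₚ q)) *ₚ r) k
      ≈⟨ +-cong (scale-*ₚ a q r k) (coeff-∷* 0# (p *ₚ q) r k) ⟩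
    a * coeff (q *ₚ r) k + (0# * coeff r k + coeff (0# ∷ ((p *ₚ q) *ₚ r)) k)
      ≈⟨ +-congˡ (trans (+-cong (zeroˡ _) (∷-cong refl (*ₚ-assoc p q r) k)) (+-identityˡ _)) ⟩
    a * coeff (q *ₚ r) k + coeff (0# ∷ (p *ₚ (q *ₚ r))) k
      ≈⟨ coeff-∷* a p (q *ₚ r) k ⟨
    coeff ((a ∷ p) *ₚ (q *ₚ r)) k ∎

  coeff-const* : ∀ a p k → coeff (const a *ₚ p) k ≈ a * coeff p k
  coeff-const* a p k = trans (coeff-∷* a [] p k) (trans (+-congˡ (coeff-0∷[] k)) (+-identityʳ _))
    where
    coeff-0∷[] : ∀ k → coeff (0# ∷ []) k ≈ 0#
    coeff-0∷[] zero    = refl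
    coeff-0∷[] (suc k) = refl

  -- Its operations are literally those of `polyRing`, so that `charPoly` is a determinant over this
  -- ring.
  polynomialRing : CommutativeRing 0ℓ 0ℓ
  polynomialRing = record
    { Carrier = Poly ; _≈_ = _≈ₚ_ ; _+_ = _+ₚ_ ; _*_ = _*ₚ_ ; -_ = map (-_) ; 0# = [] ; 1# = const 1#
    ; isCommutativeRing = record
      { isRing = record
        { +-isAbelianGroup = record
          { isGroup = record
            { isMonoid = record
              { isSemigroup = record
                { isMagma = record
                  { isEquivalence = record
                    { refl = λ k → refl ; sym = λ p≈q k → sym (p≈q k) ; trans = λ p≈q q≈r k → trans (p≈q k) (q≈r k) }
                  ; ∙-cong = λ {p} {q} {r} {s} → +ₚ-cong {p} {q} {r} {s} }
                ; assoc = λ p q r k → begin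
                    coeff ((p +ₚ q) +ₚ r) k                  ≈⟨ trans (coeff-+ (p +ₚ q) r k) (+-congʳ (coeff-+ p q k)) ⟩
                    (coeff p k + coeff q k) + coeff r k      ≈⟨ +-assoc _ _ _ ⟩
                    coeff p k + (coeff q k + coeff r k)      ≈⟨ trans (coeff-+ p (q +ₚ r) k) (+-congˡ (coeff-+ q r k)) ⟨
                    coeff (p +ₚ (q +ₚ r)) k                  ∎ }
              ; identity = (λ p k → refl) , (λ p k → trans (coeff-+ p [] k) (+-identityʳ _)) }
            ; inverse = (λ p k → trans (coeff-+ (map (-_) p) p k) (trans (+-congʳ (coeff-neg p k)) (-‿inverseˡ _)))
                      , (λ p k → trans (coeff-+ p (map (-_) p) k) (trans (+-congˡ (coeff-neg p k)) (-‿inverseʳ _)))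
            ; ⁻¹-cong = λ {p} {q} p≈q k → trans (coeff-neg p k) (trans (-‿cong (p≈q k)) (sym (coeff-neg q k))) }
          ; comm = λ p q k → trans (coeff-+ p q k) (trans (+-comm _ _) (sym (coeff-+ q p k))) }
        ; *-cong = λ {p} {q} {r} {s} → *ₚ-cong {p} {q} {r} {s}
        ; *-assoc = *ₚ-assoc
        ; *-identity = (λ p k → trans (coeff-const* 1# p k) (*-identityˡ _))
                     , (λ p k → trans (*ₚ-comm p _ k) (trans (coeff-const* 1# p k) (*-identityˡ _)))
        ; distrib = *ₚ-distribˡ , *ₚ-distribʳ }
      ; *-comm = *ₚ-comm } }

  linear : Carrier → Poly
  linear z = X +ₚ map (-_) (const z)

  coeff-linear*-zero : ∀ z p → coeff (linear z *ₚ p) 0 ≈ - z * coeff p 0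
  coeff-linear*-zero z p = begin
    coeff (linear z *ₚ p) 0                   ≈⟨ coeff-∷* (0# - z) (1# ∷ []) p 0 ⟩
    (0# - z) * coeff p 0 + 0#                 ≈⟨ +-identityʳ _ ⟩
    (0# - z) * coeff p 0                      ≈⟨ *-congʳ (+-identityˡ _) ⟩
    - z * coeff p 0                           ∎

  coeff-linear*-suc : ∀ z p k → coeff (linear z *ₚ p) (suc k) ≈ - z * coeff p (suc k) + coeff p k
  coeff-linear*-suc z p k = begin
    coeff (linear z *ₚ p) (suc k)             ≈⟨ coeff-∷* (0# - z) (1# ∷ []) p (suc k) ⟩
    (0# - z) * coeff p (suc k) + coeff ((1# ∷ []) *ₚ p) k
      ≈⟨ +-cong (*-congʳ (+-identityˡ _)) (trans (coeff-const* 1# p k) (*-identityˡ _)) ⟩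
    - z * coeff p (suc k) + coeff p k         ∎

  -- Coefficients are recovered from the lowest upwards, since lists with trailing zeros show no
  -- leading coefficient to start from. Each step cancels the constant coefficient `- z`; at
  -- `z ≈ 0#` the factor is `X`, which `X-cancel` treats.
  linear-cancel : ∀ z → (∀ {a b} → z * a ≈ z * b → a ≈ b) →
                  ∀ {p q} → (linear z *ₚ p) ≈ₚ (linear z *ₚ q) → p ≈ₚ q
  linear-cancel z z-cancel {p} {q} eq = coefficients
    where
    -z-cancel : ∀ {a b} → - z * a ≈ - z * b → a ≈ b
    -z-cancel {a} {b} h = z-cancel (begin
      z * a          ≈⟨ solve 2 (λ z a → z :* a := :- ((:- z) :* a)) refl z a ⟩
      - (- z * a)    ≈⟨ -‿cong h ⟩
      - (- z * b)    ≈⟨ solve 2 (λ z a → z :* a := :- ((:- z) :* a)) refl z b ⟨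
      z * b          ∎)

    coefficients : ∀ k → coeff p k ≈ coeff q k
    coefficients zero = -z-cancel (trans (sym (coeff-linear*-zero z p)) (trans (eq 0) (coeff-linear*-zero z q)))
    coefficients (suc k) = -z-cancel (+-cancelʳ (coeff q k) _ _ (begin
      - z * coeff p (suc k) + coeff q k   ≈⟨ +-congˡ (coefficients k) ⟨
      - z * coeff p (suc k) + coeff p k   ≈⟨ coeff-linear*-suc z p k ⟨
      coeff (linear z *ₚ p) (suc k)       ≈⟨ eq (suc k) ⟩
      coeff (linear z *ₚ q) (suc k)       ≈⟨ coeff-linear*-suc z q k ⟩
      - z * coeff q (suc k) + coeff q k   ∎))

  X-cancel : ∀ {p q} → (X *ₚ p) ≈ₚ (X *ₚ q) → p ≈ₚ q
  X-cancel {p} {q} eq k = trans (sym (coeff-X* p k)) (trans (eq (suc k)) (coeff-X* q k))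
    where
    coeff-X* : ∀ p k → coeff (X *ₚ p) (suc k) ≈ coeff p k
    coeff-X* p k = begin
      coeff (X *ₚ p) (suc k)                                 ≈⟨ coeff-∷* 0# (1# ∷ []) p (suc k) ⟩
      0# * coeff p (suc k) + coeff ((1# ∷ []) *ₚ p) k        ≈⟨ +-cong (zeroˡ _) (trans (coeff-const* 1# p k) (*-identityˡ _)) ⟩
      0# + coeff p k                                         ≈⟨ +-identityˡ _ ⟩
      coeff p k                                              ∎

  module _ (z : Carrier) where

    eval : Poly → Carrier
    eval []      = 0#
    eval (a ∷ p) = a + z * eval p

    private
      -- Since `_≈ₚ_` disregards trailing zeros, evaluation respects it only if every list of zeros
      -- evaluates like the empty list.
      eval-[] : ∀ p → p ≈ₚ [] → eval p ≈ 0#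
      eval-[] []      _   = refl
      eval-[] (a ∷ p) p≈0 = trans (+-cong (p≈0 0) (trans (*-congˡ (eval-[] p (p≈0 ∘ suc))) (zeroʳ z))) (+-identityʳ 0#)

    eval-cong : ∀ p q → p ≈ₚ q → eval p ≈ eval q
    eval-cong []      q       p≈q = sym (eval-[] q (λ k → sym (p≈q k)))
    eval-cong (a ∷ p) []      p≈q = eval-[] (a ∷ p) p≈q
    eval-cong (a ∷ p) (b ∷ q) p≈q = +-cong (p≈q 0) (*-congˡ (eval-cong p q (p≈q ∘ suc)))

    eval-+ : ∀ p q → eval (p +ₚ q) ≈ eval p + eval q
    eval-+ []      q       = sym (+-identityˡ _)
    eval-+ (a ∷ p) []      = sym (+-identityʳ _)
    eval-+ (a ∷ p) (b ∷ q) = trans (+-congˡ (*-congˡ (eval-+ p q)))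
      (solve 5 (λ a b z p q → a :+ b :+ z :* (p :+ q) := (a :+ z :* p) :+ (b :+ z :* q)) refl a b z _ _)

    eval-scale : ∀ a p → eval (map (a *_) p) ≈ a * eval p
    eval-scale a []      = sym (zeroʳ a)
    eval-scale a (b ∷ p) = trans (+-congˡ (*-congˡ (eval-scale a p)))
      (solve 4 (λ a b z p → a :* b :+ z :* (a :* p) := a :* (b :+ z :* p)) refl a b z _)

    eval-neg : ∀ p → eval (map (-_) p) ≈ - eval p
    eval-neg []      = sym -0#≈0#
    eval-neg (b ∷ p) = trans (+-congˡ (*-congˡ (eval-neg p)))
      (solve 3 (λ b z p → :- b :+ z :* (:- p) := :- (b :+ z :* p)) refl b z _)

    eval-* : ∀ p q → eval (p *ₚ q) ≈ eval p * eval q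
    eval-* []      q = sym (zeroˡ _)
    eval-* (a ∷ p) q = begin
      eval (map (a *_) q +ₚ (0# ∷ (p *ₚ q)))     ≈⟨ eval-+ (map (a *_) q) _ ⟩
      eval (map (a *_) q) + (0# + z * eval (p *ₚ q))
        ≈⟨ +-cong (eval-scale a q) (trans (+-identityˡ _) (*-congˡ (eval-* p q))) ⟩
      a * eval q + z * (eval p * eval q)         ≈⟨ solve 4 (λ a z p q → a :* q :+ z :* (p :* q) := (a :+ z :* p) :* q) refl a z _ _ ⟩
      (a + z * eval p) * eval q                  ∎

    eval-const : ∀ a → eval (const a) ≈ a
    eval-const a = trans (+-congˡ (zeroʳ z)) (+-identityʳ a)

    eval-X : eval X ≈ z
    eval-X = trans (+-identityˡ _) (trans (*-congˡ (eval-const 1#)) (*-identityʳ z))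

    eval-linear : eval (linear z) ≈ 0#
    eval-linear = trans (eval-+ X (map (-_) (const z))) (trans (+-cong eval-X (trans (eval-neg (z ∷ [])) (-‿cong (eval-const z)))) (-‿inverseʳ z))

    private
      module P = CommutativeRing polynomialRing
      open Algebra.Properties.Semiring.Exp semiring using (_^_)
      module P^ = Algebra.Properties.Semiring.Exp P.semiring

    eval-^ : ∀ p k → eval (p P^.^ k) ≈ eval p ^ k
    eval-^ p zero    = eval-const 1#
    eval-^ p (suc k) = trans (eval-* p _) (*-congˡ (eval-^ p k))

-- Root multiplicities of (X^ℓ - g) X^m

module RootMultiplicity
  (K : CommutativeRing 0ℓ 0ℓ) (integral : Powers.NoZeroDivisors K)
  where
  open CommutativeRing K hiding (zero)
  open Algebra.Properties.Ring ring
  open Algebra.Properties.Semiring.Mult semiring using () renaming (_×_ to _×ᴿ_)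
  open Polynomials rawRing
  open PolynomialRing K
  open IntegerSolver K
  open Powers K
  open Relation.Binary.Reasoning.Setoid setoid
  private
    module P  = CommutativeRing polynomialRing
    module P^ = Powers polynomialRing
  open RawSemiringDefs (RawRing.rawSemiring polyRing) using (_∣_; _∤_)
  open RawMagmaDefs (RawRing.*-rawMagma polyRing) using (_,_)

  nonzero-^ : ∀ {z} → ¬ z ≈ 0# → ∀ k → ¬ 1# ≈ 0# → ¬ z ^ k ≈ 0#
  nonzero-^ z≉0 zero    1≉0 eq = 1≉0 eq
  nonzero-^ z≉0 (suc k) 1≉0 eq = nonzero-^ z≉0 k 1≉0 (integral eq z≉0)

  nonzero-cancel : ∀ {z} → ¬ z ≈ 0# → Cancellable z
  nonzero-cancel {z} z≉0 {p} {q} eq = x∙y⁻¹≈ε⇒x≈y p q (integral (begin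
    z * (p - q)      ≈⟨ solve 3 (λ z p q → z :* (p :- q) := z :* p :- z :* q) refl z p q ⟩
    z * p - z * q    ≈⟨ +-congʳ eq ⟩
    z * q - z * q    ≈⟨ -‿inverseʳ _ ⟩
    0#               ∎) z≉0)

  const-* : ∀ a b → const (a * b) ≈ₚ (const a *ₚ const b)
  const-* a b = ∷-cong (sym (+-identityʳ _)) (λ k → refl)

  const-^ : ∀ a k → const (a ^ k) ≈ₚ (const a P^.^ k)
  const-^ a zero    = λ k → refl
  const-^ a (suc k) = P.trans {const (a * a ^ k)} {const a *ₚ const (a ^ k)} {const a P^.^ suc k} (const-* a (a ^ k)) (*ₚ-congˡ (const a) {const (a ^ k)} {const a P^.^ k} (const-^ a k))

  -- On the diagonal all `suc k` summands are equal. This is the derivative of `X ^ suc k` at `z`,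
  -- reached without differentiating.
  geometric-diagonal : ∀ z k → geometric z z k ≈ (suc k ×ᴿ 1#) * z ^ k
  geometric-diagonal z zero    = solve 0 (con (+ 1) := (con (+ 1) :+ con (+ 0)) :* con (+ 1)) refl
  geometric-diagonal z (suc k) = begin
    z ^ suc k + z * geometric z z k             ≈⟨ +-congˡ (*-congˡ (geometric-diagonal z k)) ⟩
    z * z ^ k + z * ((suc k ×ᴿ 1#) * z ^ k)     ≈⟨ solve 3 (λ z p n → z :* p :+ z :* (n :* p) := (con (+ 1) :+ n) :* (z :* p)) refl z (z ^ k) _ ⟩
    (1# + suc k ×ᴿ 1#) * z ^ suc k              ∎

  eval-geometric : ∀ z p q k → eval z (P^.geometric p q k) ≈ geometric (eval z p) (eval z q) k
  eval-geometric z p q zero    = eval-const z 1#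
  eval-geometric z p q (suc k) = trans (eval-+ z (p P^.^ suc k) (q *ₚ P^.geometric p q k))
    (+-cong (eval-^ z p (suc k)) (trans (eval-* z q _) (*-congˡ (eval-geometric z p q k))))

  eval-X^-const : ∀ z g k → eval z ((X P^.^ k) +ₚ map (-_) (const g)) ≈ z ^ k - g
  eval-X^-const z g k = trans (eval-+ z (X P^.^ k) _)
    (+-cong (trans (eval-^ z X k) (^-congˡ k (eval-X z)))
            (trans (eval-neg z (const g)) (-‿cong (eval-const z g))))

  eval-*-linear : ∀ z q → eval z (q *ₚ linear z) ≈ 0#
  eval-*-linear z q = trans (eval-* z q (linear z)) (trans (*-congˡ (eval-linear z)) (zeroʳ _))

  HasRootMultiplicity : Poly → Carrier → ℕ → Set
  HasRootMultiplicity p z k = (linear z P^.^ k) ∣ p × (linear z P^.^ suc k) ∤ p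

  module _
    (1≉0 : ¬ 1# ≈ 0#) {p : Poly} (L m : ℕ) (g : Carrier)
    (p≈ : p ≈ₚ (((X P^.^ suc L) +ₚ map (-_) (const g)) *ₚ (X P^.^ m)))
    (z : Carrier)
    where

    private
      Y : Poly
      Y = (X P^.^ suc L) +ₚ map (-_) (const g)

    -- Here the linear factor is `X` itself. One more factor `X` would have to divide `Y`, whose
    -- value at 0 is `- g`.
    multiplicity-zero : ¬ g ≈ 0# → z ≈ 0# → HasRootMultiplicity p z m
    multiplicity-zero g≉0 z≈0 = divides , not-divides
      where
      linear≈X : linear z ≈ₚ X
      linear≈X = ∷-cong (trans (+-congˡ (trans (-‿cong z≈0) -0#≈0#)) (+-identityˡ 0#)) λ k → refl
      powers : ∀ k → (linear z P^.^ k) ≈ₚ (X P^.^ k)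
      powers k = P^.^-congˡ k {linear z} {X} linear≈X
      divides : (linear z P^.^ m) ∣ p
      divides = Y , λ k → trans (*ₚ-congˡ Y (powers m) k) (sym (p≈ k))
      not-divides : (linear z P^.^ suc m) ∤ p
      not-divides (q , eq) = g≉0 (begin
        g                       ≈⟨ solve 2 (λ g w → g := w :- (w :- g)) refl g (z ^ suc L) ⟩
        z ^ suc L - (z ^ suc L - g)
          ≈⟨ +-cong (trans (*-congʳ z≈0) (zeroˡ _)) (-‿cong (sym (eval-X^-const z g (suc L)))) ⟩
        0# - eval z Y           ≈⟨ +-congˡ (-‿cong (eval-cong z (q *ₚ X) Y q*X≈Y)) ⟨
        0# - eval z (q *ₚ X)    ≈⟨ +-congˡ (-‿cong (trans (eval-* z q X) (*-congˡ (trans (eval-X z) z≈0)))) ⟩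
        0# - eval z q * 0#      ≈⟨ solve 1 (λ q → con (+ 0) :- q :* con (+ 0) := con (+ 0)) refl (eval z q) ⟩
        0#                      ∎)
        where
        q*X≈Y : (q *ₚ X) ≈ₚ Y
        q*X≈Y = P^.cancel-power {X} (λ {a} {b} → X-cancel {a} {b}) m {q} {Y} λ k →
          trans (sym (*ₚ-congˡ q (powers (suc m)) k)) (trans (eq k) (p≈ k))

    multiplicity-root : ¬ (suc L ×ᴿ 1#) ≈ 0# → ¬ z ≈ 0# → z ^ suc L ≈ g → HasRootMultiplicity p z 1
    multiplicity-root char z≉0 root = divides , not-divides
      where
      S : Poly
      S = P^.geometric X (const z) L
      Y≈ : Y ≈ₚ (linear z *ₚ S)
      Y≈ = P.trans {Y} {(X P^.^ suc L) P.- (const z P^.^ suc L)} {linear z *ₚ S}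
        (P.+-congˡ {X P^.^ suc L} (P.-‿cong {const g} {const z P^.^ suc L}
          λ k → trans (∷-cong (sym root) (λ _ → refl) k) (const-^ z (suc L) k)))
        (P.sym {linear z *ₚ S} {(X P^.^ suc L) P.- (const z P^.^ suc L)} (P^.geometric-sum X (const z) L))
      p≈′ : p ≈ₚ ((linear z *ₚ S) *ₚ (X P^.^ m))
      p≈′ = P.trans {p} {Y *ₚ (X P^.^ m)} {(linear z *ₚ S) *ₚ (X P^.^ m)} p≈ (P.*-congʳ {X P^.^ m} {Y} {linear z *ₚ S} Y≈)
      divides : (linear z P^.^ 1) ∣ p
      divides = S *ₚ (X P^.^ m) , P.trans {(S *ₚ (X P^.^ m)) *ₚ (linear z P^.^ 1)} {(linear z *ₚ S) *ₚ (X P^.^ m)} {p}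
        (P^.divides-product (linear z) S (X P^.^ m)) (P.sym {p} {(linear z *ₚ S) *ₚ (X P^.^ m)} p≈′)
      not-divides : (linear z P^.^ 2) ∤ p
      not-divides (q , eq) = char (integral (trans (*-comm _ _) product≈0) (nonzero-^ z≉0 L 1≉0))
        where
        -- After cancelling one factor, a double root makes `linear z` divide `S *ₚ (X P^.^ m)`,
        -- whose value at `z` is a nonzero multiple of a power of `z`.
        q*l≈ : (q *ₚ linear z) ≈ₚ (S *ₚ (X P^.^ m))
        q*l≈ = P^.cancel-double {linear z} (λ {a} {b} → linear-cancel z (nonzero-cancel z≉0) {a} {b})
          {q} {S} {X P^.^ m} (λ k → trans (eq k) (p≈′ k))
        product≈0 : (suc L ×ᴿ 1#) * z ^ L ≈ 0#
        product≈0 = integral (begin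
          z ^ m * ((suc L ×ᴿ 1#) * z ^ L)   ≈⟨ *-comm _ _ ⟩
          (suc L ×ᴿ 1#) * z ^ L * z ^ m     ≈⟨ *-congʳ (geometric-diagonal z L) ⟨
          geometric z z L * z ^ m           ≈⟨ *-cong (eval-S L) (trans (eval-^ z X m) (^-congˡ m (eval-X z))) ⟨
          eval z S * eval z (X P^.^ m)      ≈⟨ eval-* z S _ ⟨
          eval z (S *ₚ (X P^.^ m))          ≈⟨ eval-cong z (q *ₚ linear z) (S *ₚ (X P^.^ m)) q*l≈ ⟨
          eval z (q *ₚ linear z)            ≈⟨ eval-*-linear z q ⟩
          0#                                ∎) (nonzero-^ z≉0 m 1≉0)
          where
          geometric-cong : ∀ {x x′ y y′} k → x ≈ x′ → y ≈ y′ → geometric x y k ≈ geometric x′ y′ k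
          geometric-cong zero    _  _  = refl
          geometric-cong (suc k) x≈ y≈ = +-cong (^-congˡ (suc k) x≈) (*-cong y≈ (geometric-cong k x≈ y≈))
          eval-S : ∀ k → eval z (P^.geometric X (const z) k) ≈ geometric z z k
          eval-S k = trans (eval-geometric z X (const z) k) (geometric-cong k (eval-X z) (eval-const z z))

    -- If `linear z` divided `p`, then evaluation at `z` would annihilate `(z ^ suc L - g) * z ^ m`,
    -- both of whose factors are nonzero.
    multiplicity-none : ¬ z ≈ 0# → ¬ z ^ suc L ≈ g → HasRootMultiplicity p z 0
    multiplicity-none z≉0 ¬root = (p , P.*-identityʳ p) , not-divides
      where
      not-divides : (linear z P^.^ 1) ∤ p
      not-divides (q , eq) = ¬root (x∙y⁻¹≈ε⇒x≈y _ _ (integral (begin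
        z ^ m * (z ^ suc L - g)              ≈⟨ *-comm _ _ ⟩
        (z ^ suc L - g) * z ^ m              ≈⟨ *-cong (eval-X^-const z g (suc L)) (trans (eval-^ z X m) (^-congˡ m (eval-X z))) ⟨
        eval z Y * eval z (X P^.^ m)         ≈⟨ eval-* z Y _ ⟨
        eval z (Y *ₚ (X P^.^ m))             ≈⟨ eval-cong z p (Y *ₚ (X P^.^ m)) p≈ ⟨
        eval z p                             ≈⟨ eval-cong z (q *ₚ (linear z P^.^ 1)) p eq ⟨
        eval z (q *ₚ (linear z P^.^ 1))      ≈⟨ eval-cong z (q *ₚ (linear z P^.^ 1)) (q *ₚ linear z) (*ₚ-congˡ q (P.*-identityʳ (linear z))) ⟩
        eval z (q *ₚ linear z)               ≈⟨ eval-*-linear z q ⟩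
        0#                                   ∎) (nonzero-^ z≉0 m 1≉0)))

-- Real and complex numbers

module OrderedField (ℝ : CompleteOrderedField) where
  open CompleteOrderedField ℝ hiding (zero)
  open IsDecTotalOrder isDecTotalOrder
    using (total; antisym; ≤-respˡ-≈; ≤-respʳ-≈) renaming (refl to ≤-refl; trans to ≤-trans; reflexive to ≤-reflexive)
  open Algebra.Properties.Ring ring
  open IntegerSolver commutativeRing
  open Powers commutativeRing
  open Relation.Binary.Reasoning.Setoid setoid

  integral : ∀ {a b} → a * b ≈ 0# → ¬ a ≈ 0# → b ≈ 0#
  integral {a} {b} ab≈0 a≉0 with i , ai≈1 ← inverse a a≉0 = begin
    b              ≈⟨ *-identityˡ b ⟨
    1# * b         ≈⟨ *-congʳ ai≈1 ⟨
    a * i * b      ≈⟨ solve 3 (λ a i b → a :* i :* b := i :* (a :* b)) refl a i b ⟩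
    i * (a * b)    ≈⟨ *-congˡ ab≈0 ⟩
    i * 0#         ≈⟨ zeroʳ i ⟩
    0#             ∎

  -- Inequalities are carried as nonnegative differences: to prove one is to write the difference as
  -- a sum of products of nonnegative terms, an identity that the ring solver checks.
  NonNegative : Carrier → Set
  NonNegative x = 0# ≤ x

  ≤⇒≥0 : ∀ {x y} → x ≤ y → NonNegative (y - x)
  ≤⇒≥0 {x} {y} x≤y = ≤-respˡ-≈ (-‿inverseʳ x) (+-monoˡ-≤ (- x) x≤y)

  ≥0⇒≤ : ∀ {x y} → NonNegative (y - x) → x ≤ y
  ≥0⇒≤ {x} {y} h = ≤-respˡ-≈ (+-identityˡ x)
    (≤-respʳ-≈ (solve 2 (λ x y → y :- x :+ x := y) refl x y) (+-monoˡ-≤ x h))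

  ≥0-resp : ∀ {x y} → x ≈ y → NonNegative x → NonNegative y
  ≥0-resp = ≤-respʳ-≈

  ≥0-+ : ∀ {x y} → NonNegative x → NonNegative y → NonNegative (x + y)
  ≥0-+ {x} {y} x≥0 y≥0 = ≤-trans y≥0 (≤-respˡ-≈ (+-identityˡ y) (+-monoˡ-≤ y x≥0))

  ≥0-antisym : ∀ {x} → NonNegative x → NonNegative (- x) → x ≈ 0#
  ≥0-antisym {x} x≥0 -x≥0 = antisym (≥0⇒≤ (≥0-resp (sym (+-identityˡ _)) -x≥0)) x≥0

  ≥0-total : ∀ x → NonNegative x ⊎ NonNegative (- x)
  ≥0-total x with total 0# x
  ... | inj₁ 0≤x = inj₁ 0≤x
  ... | inj₂ x≤0 = inj₂ (≥0-resp (+-identityˡ _) (≤⇒≥0 x≤0))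

  ≥0-square : ∀ x → NonNegative (x * x)
  ≥0-square x with ≥0-total x
  ... | inj₁ x≥0  = *-nonneg x≥0 x≥0
  ... | inj₂ -x≥0 = ≥0-resp (solve 1 (λ x → (:- x) :* (:- x) := x :* x) refl x) (*-nonneg -x≥0 -x≥0)

  ≥0-1 : NonNegative 1#
  ≥0-1 = ≥0-resp (*-identityˡ 1#) (≥0-square 1#)

  ≥0-half : ∀ {x} → NonNegative (x + x) → NonNegative x
  ≥0-half {x} 2x≥0 with ≥0-total x
  ... | inj₁ x≥0  = x≥0
  ... | inj₂ -x≥0 = ≥0-resp (solve 1 (λ x → x :+ x :+ :- x := x) refl x) (≥0-+ 2x≥0 -x≥0)

  1+≥0≉0 : ∀ {x} → NonNegative x → ¬ 1# + x ≈ 0#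
  1+≥0≉0 {x} x≥0 1+x≈0 = 0≉1 (sym (≥0-antisym ≥0-1 (≥0-resp (begin
    x               ≈⟨ solve 1 (λ x → x := (con (+ 1) :+ x) :- con (+ 1)) refl x ⟩
    1# + x - 1#     ≈⟨ +-congʳ 1+x≈0 ⟩
    0# - 1#         ≈⟨ +-identityˡ _ ⟩
    - 1#            ∎) x≥0)))

  ≥0-inverse : ∀ {x i} → NonNegative x → x * i ≈ 1# → NonNegative i
  ≥0-inverse {x} {i} x≥0 xi≈1 with ≥0-total i
  ... | inj₁ i≥0  = i≥0
  ... | inj₂ -i≥0 = contradiction (sym (≥0-antisym ≥0-1 (≥0-resp (begin
    x * - i     ≈⟨ solve 2 (λ x i → x :* (:- i) := :- (x :* i)) refl x i ⟩
    - (x * i)   ≈⟨ -‿cong xi≈1 ⟩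
    - 1#        ∎) (*-nonneg x≥0 -i≥0)))) 0≉1

  sum-of-squares≈0 : ∀ {x y} → x * x + y * y ≈ 0# → x ≈ 0#
  sum-of-squares≈0 {x} {y} eq with x ≟ 0#
  ... | yes x≈0 = x≈0
  ... | no  x≉0 = integral (≥0-antisym (≥0-square x) (≥0-resp (begin
    y * y                      ≈⟨ solve 2 (λ p q → q := p :+ q :- p) refl (x * x) (y * y) ⟩
    x * x + y * y - x * x      ≈⟨ +-congʳ eq ⟩
    0# - x * x                 ≈⟨ +-identityˡ _ ⟩
    - (x * x)                  ∎) (≥0-square y))) x≉0

  ≥0-^ : ∀ {x} → NonNegative x → ∀ k → NonNegative (x ^ k)
  ≥0-^ x≥0 zero    = ≥0-1
  ≥0-^ x≥0 (suc k) = *-nonneg x≥0 (≥0-^ x≥0 k)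

  -- For nonnegative `x` the cofactor of `x - 1#` in `x ^ suc k - 1#` is at least 1, hence nonzero,
  -- and can be cancelled.
  ≥0-root-of-unity : ∀ {x} → NonNegative x → ∀ k → x ^ suc k ≈ 1# → x ≈ 1#
  ≥0-root-of-unity {x} x≥0 k eq = x∙y⁻¹≈ε⇒x≈y x 1# (integral (begin
    geometric x 1# k * (x - 1#)   ≈⟨ *-comm _ _ ⟩
    (x - 1#) * geometric x 1# k   ≈⟨ geometric-sum x 1# k ⟩
    x ^ suc k - 1# ^ suc k        ≈⟨ +-cong eq (-‿cong (1^ (suc k))) ⟩
    1# - 1#                       ≈⟨ -‿inverseʳ 1# ⟩
    0#                            ∎) (geometric≉0 k))
    where
    geometric-≥1 : ∀ k → NonNegative (geometric x 1# k - 1#)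
    geometric-≥1 zero    = ≤⇒≥0 ≤-refl
    geometric-≥1 (suc k) = ≥0-resp (solve 2 (λ p g → p :+ (g :- con (+ 1)) := p :+ con (+ 1) :* g :- con (+ 1)) refl _ _)
      (≥0-+ (≥0-^ x≥0 (suc k)) (geometric-≥1 k))
    geometric≉0 : ∀ k → ¬ geometric x 1# k ≈ 0#
    geometric≉0 k g≈0 = 1+≥0≉0 (geometric-≥1 k)
      (trans (solve 1 (λ g → con (+ 1) :+ (g :- con (+ 1)) := g) refl _) g≈0)

  -- A bound on the absolute value as a pair of inequalities, free of case distinctions on the sign.
  ∣_∣≤_ : Carrier → Carrier → Set
  ∣ d ∣≤ c = NonNegative (c - d) × NonNegative (c + d)

  ∣∣≤-resp : ∀ {c c′ d d′} → c ≈ c′ → d ≈ d′ → ∣ d ∣≤ c → ∣ d′ ∣≤ c′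
  ∣∣≤-resp c≈ d≈ (p , q) = ≥0-resp (+-cong c≈ (-‿cong d≈)) p , ≥0-resp (+-cong c≈ d≈) q

  ∣∣≤-+ : ∀ {c c′ d d′} → ∣ d ∣≤ c → ∣ d′ ∣≤ c′ → ∣ d + d′ ∣≤ (c + c′)
  ∣∣≤-+ {c} {c′} {d} {d′} (p , q) (p′ , q′) =
      ≥0-resp (solve 4 (λ c c′ d d′ → (c :- d) :+ (c′ :- d′) := c :+ c′ :- (d :+ d′)) refl c c′ d d′) (≥0-+ p p′)
    , ≥0-resp (solve 4 (λ c c′ d d′ → (c :+ d) :+ (c′ :+ d′) := c :+ c′ :+ (d :+ d′)) refl c c′ d d′) (≥0-+ q q′)

  -- Twice the difference of `c * c′` and `d * d′` is `(c - d) * (c′ + d′) + (c + d) * (c′ -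
  -- d′)`; the doubling is undone by `≥0-half`.
  ∣∣≤-* : ∀ {c c′ d d′} → ∣ d ∣≤ c → ∣ d′ ∣≤ c′ → ∣ d * d′ ∣≤ (c * c′)
  ∣∣≤-* {c} {c′} {d} {d′} (p , q) (p′ , q′) =
      ≥0-half (≥0-resp (solve 4 (λ c c′ d d′ → (c :- d) :* (c′ :+ d′) :+ (c :+ d) :* (c′ :- d′) :=
                                                (c :* c′ :- d :* d′) :+ (c :* c′ :- d :* d′)) refl c c′ d d′)
                       (≥0-+ (*-nonneg p q′) (*-nonneg q p′)))
    , ≥0-half (≥0-resp (solve 4 (λ c c′ d d′ → (c :- d) :* (c′ :- d′) :+ (c :+ d) :* (c′ :+ d′) :=
                                                (c :* c′ :+ d :* d′) :+ (c :* c′ :+ d :* d′)) refl c c′ d d′)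
                       (≥0-+ (*-nonneg p p′) (*-nonneg q q′)))

  ∣∣≤⇒≥0 : ∀ {c d} → ∣ d ∣≤ c → NonNegative c
  ∣∣≤⇒≥0 {c} {d} (p , q) = ≥0-half (≥0-resp (solve 2 (λ c d → (c :- d) :+ (c :+ d) := c :+ c) refl c d) (≥0-+ p q))

  ∣≥0∣≤ : ∀ {d} → NonNegative d → ∣ d ∣≤ d
  ∣≥0∣≤ d≥0 = ≤⇒≥0 ≤-refl , ≥0-+ d≥0 d≥0

  ∣-∣≤ : ∀ {c d} → ∣ d ∣≤ c → ∣ - d ∣≤ c
  ∣-∣≤ (p , q) = ≥0-resp (+-congˡ (sym (-‿involutive _))) q , p

  module _ (β : Carrier) where

    -- Takes the place of continuity on the interval from `- β` to `β`. The bound is what lets the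
    -- class be closed under products, and ordered pairs `x ≤ y` make the distance simply `y - x`.
    record Lipschitz (f : Carrier → Carrier) : Set where
      field
        bound constant : Carrier
        constant≥0     : NonNegative constant
        bounded        : ∀ {x} → ∣ x ∣≤ β → ∣ f x ∣≤ bound
        lipschitz      : ∀ {x y} → ∣ x ∣≤ β → ∣ y ∣≤ β → x ≤ y → ∣ f y - f x ∣≤ (constant * (y - x))

    open Lipschitz

    lipschitz-const : ∀ a → Lipschitz (λ _ → a)
    lipschitz-const a = record
      -- This bound works for either sign of `a`: twice its distance to `a`, or to `- a`, is a sum
      -- of squares.
      { bound = a * a + 1#
      ; constant = 0#
      ; constant≥0 = ≤-refl
      ; bounded = λ _ →
          ≥0-half (≥0-resp (solve 1 (λ a → (a :- con (+ 1)) :* (a :- con (+ 1)) :+ (a :* a :+ con (+ 1)) :=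
                                            (a :* a :+ con (+ 1) :- a) :+ (a :* a :+ con (+ 1) :- a)) refl a)
                           (≥0-+ (≥0-square _) (≥0-+ (≥0-square a) ≥0-1)))
        , ≥0-half (≥0-resp (solve 1 (λ a → (a :+ con (+ 1)) :* (a :+ con (+ 1)) :+ (a :* a :+ con (+ 1)) :=
                                            (a :* a :+ con (+ 1) :+ a) :+ (a :* a :+ con (+ 1) :+ a)) refl a)
                           (≥0-+ (≥0-square _) (≥0-+ (≥0-square a) ≥0-1)))
      ; lipschitz = λ {x} {y} _ _ _ →
          ∣∣≤-resp (sym (zeroˡ (y - x))) (sym (-‿inverseʳ a)) (∣≥0∣≤ ≤-refl)
      }

    lipschitz-id : Lipschitz (λ x → x)
    lipschitz-id = record
      { bound = β
      ; constant = 1#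
      ; constant≥0 = ≥0-1
      ; bounded = λ x∈ → x∈
      ; lipschitz = λ _ _ x≤y → ∣∣≤-resp (sym (*-identityˡ _)) refl (∣≥0∣≤ (≤⇒≥0 x≤y))
      }

    lipschitz-+ : ∀ {f g} → Lipschitz f → Lipschitz g → Lipschitz (λ x → f x + g x)
    lipschitz-+ F G = record
      { bound = bound F + bound G
      ; constant = constant F + constant G
      ; constant≥0 = ≥0-+ (constant≥0 F) (constant≥0 G)
      ; bounded = λ x∈ → ∣∣≤-+ (bounded F x∈) (bounded G x∈)
      ; lipschitz = λ x∈ y∈ x≤y → ∣∣≤-resp
          (solve 3 (λ p q d → p :* d :+ q :* d := (p :+ q) :* d) refl _ _ _)
          (solve 4 (λ a b c d → (a :- b) :+ (c :- d) := (a :+ c) :- (b :+ d)) refl _ _ _ _)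
          (∣∣≤-+ (lipschitz F x∈ y∈ x≤y) (lipschitz G x∈ y∈ x≤y))
      }

    lipschitz-neg : ∀ {f} → Lipschitz f → Lipschitz (λ x → - f x)
    lipschitz-neg F = record
      { bound = bound F
      ; constant = constant F
      ; constant≥0 = constant≥0 F
      ; bounded = λ x∈ → ∣-∣≤ (bounded F x∈)
      ; lipschitz = λ x∈ y∈ x≤y → ∣∣≤-resp refl
          (solve 2 (λ a b → :- (a :- b) := :- a :- :- b) refl _ _)
          (∣-∣≤ (lipschitz F x∈ y∈ x≤y))
      }

    lipschitz-* : ∀ {f g} → Lipschitz f → Lipschitz g → ∣ 0# ∣≤ β → Lipschitz (λ x → f x * g x)
    lipschitz-* {f} {g} F G 0∈ = record
      { bound = bound F * bound G
      ; constant = bound F * constant G + constant F * bound G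
      ; constant≥0 = ≥0-+ (*-nonneg (∣∣≤⇒≥0 (bounded F 0∈)) (constant≥0 G))
                          (*-nonneg (constant≥0 F) (∣∣≤⇒≥0 (bounded G 0∈)))
      ; bounded = λ x∈ → ∣∣≤-* (bounded F x∈) (bounded G x∈)
      ; lipschitz = λ {x} {y} x∈ y∈ x≤y → ∣∣≤-resp
          (solve 5 (λ bf bg lf lg d → bf :* (lg :* d) :+ lf :* d :* bg := (bf :* lg :+ lf :* bg) :* d) refl
             (bound F) (bound G) (constant F) (constant G) (y - x))
          (solve 4 (λ fx fy gx gy → fy :* (gy :- gx) :+ (fy :- fx) :* gx := fy :* gy :- fx :* gx) refl
             (f x) (f y) (g x) (g y))
          (∣∣≤-+ (∣∣≤-* (bounded F y∈) (lipschitz G x∈ y∈ x≤y)) (∣∣≤-* (lipschitz F x∈ y∈ x≤y) (bounded G x∈)))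
      }

    -- Abstract, as is everything built on the supremum: the witnesses are too large to normalise.
    abstract
      intermediate-value : ∀ {f lo hi} → Lipschitz f → ∣ lo ∣≤ β → ∣ hi ∣≤ β → lo ≤ hi →
                           f lo ≤ 0# → 0# ≤ f hi → ∃[ s ] f s ≈ 0#
      intermediate-value {f} {lo} {hi} F lo∈ hi∈ lo≤hi f-lo≤0 0≤f-hi = s , f-s≈0 (≥0-total (f s))
        where
        Below : Carrier → Set
        Below t = lo ≤ t × t ≤ hi × f t ≤ 0#

        sup : ∃[ s ] (IsUpperBound Below s × (∀ b → IsUpperBound Below b → s ≤ b))
        sup = supremum Below (lo , ≤-refl , lo≤hi , f-lo≤0) (hi , λ _ → proj₁ ∘ proj₂)
        s : Carrier
        s = proj₁ sup
        upper : IsUpperBound Below s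
        upper = proj₁ (proj₂ sup)
        least : ∀ b → IsUpperBound Below b → s ≤ b
        least = proj₂ (proj₂ sup)

        lo≤s : lo ≤ s
        lo≤s = upper lo (≤-refl , lo≤hi , f-lo≤0)
        s≤hi : s ≤ hi
        s≤hi = least hi λ _ → proj₁ ∘ proj₂

        between : ∀ {t} → lo ≤ t → t ≤ hi → ∣ t ∣≤ β
        between {t} lo≤t t≤hi =
            ≥0-resp (solve 3 (λ b h t → (b :- h) :+ (h :- t) := b :- t) refl β hi t) (≥0-+ (proj₁ hi∈) (≤⇒≥0 t≤hi))
          , ≥0-resp (solve 3 (λ b l t → (b :+ l) :+ (t :- l) := b :+ t) refl β lo t) (≥0-+ (proj₂ lo∈) (≤⇒≥0 lo≤t))
        s∈ : ∣ s ∣≤ β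
        s∈ = between lo≤s s≤hi

        C : Carrier
        C = constant F

        -- A step of length δ changes f by at most Cδ, which is less than (C + 1)δ = ∣ f s ∣.
        step : ∃[ i ] (1# + C) * i ≈ 1#
        step = inverse (1# + C) (1+≥0≉0 (constant≥0 F))
        i : Carrier
        i = proj₁ step
        i≥0 : NonNegative i
        i≥0 = ≥0-inverse (≥0-+ ≥0-1 (constant≥0 F)) (proj₂ step)

        scaled : ∀ y → (1# + C) * (y * i) ≈ y
        scaled y = begin
          (1# + C) * (y * i)   ≈⟨ solve 3 (λ c y i → c :* (y :* i) := y :* (c :* i)) refl (1# + C) y i ⟩
          y * ((1# + C) * i)   ≈⟨ *-congˡ (proj₂ step) ⟩
          y * 1#               ≈⟨ *-identityʳ y ⟩
          y                    ∎

        vanish : ∀ {y} → NonNegative y → NonNegative (- (y * i)) → y ≈ 0#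
        vanish {y} y≥0 -δ≥0 = begin
          y                    ≈⟨ scaled y ⟨
          (1# + C) * (y * i)   ≈⟨ *-congˡ (≥0-antisym (*-nonneg y≥0 i≥0) -δ≥0) ⟩
          (1# + C) * 0#        ≈⟨ zeroʳ _ ⟩
          0#                   ∎

        f-s≈0 : NonNegative (f s) ⊎ NonNegative (- f s) → f s ≈ 0#
        -- A point of `Below` beyond `s - δ` forces `δ ≤ 0`, so in every case `s - δ` is an upper
        -- bound. Leastness of `s` then makes `δ`, and with it `f s`, vanish.
        f-s≈0 (inj₁ fs≥0) = vanish fs≥0
          (≥0-resp (solve 2 (λ s δ → s :- δ :- s := :- δ) refl s δ) (≤⇒≥0 (least (s - δ) below-s-δ)))
          where
          δ : Carrier
          δ = f s * i
          below-s-δ : IsUpperBound Below (s - δ)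
          below-s-δ t (lo≤t , t≤hi , ft≤0) with total t (s - δ)
          ... | inj₁ t≤ = t≤
          ... | inj₂ s-δ≤t = ≥0⇒≤ (≥0-resp (solve 3 (λ s t δ → (s :- t) :+ :- δ := s :- δ :- t) refl s t δ)
                  (≥0-+ (≤⇒≥0 t≤s) -δ≥0))
            where
            t≤s : t ≤ s
            t≤s = upper t (lo≤t , t≤hi , ft≤0)
            -δ≥0 : NonNegative (- δ)
            -δ≥0 = ≥0-resp (begin
              (C * (s - t) - (f s - f t)) + ((0# - f t) + C * (t - (s - δ)))
                ≈⟨ solve 6 (λ c s t fs ft δ → (c :* (s :- t) :- (fs :- ft)) :+ ((con (+ 0) :- ft) :+ c :* (t :- (s :- δ)))
                                                := c :* δ :- fs) refl C s t (f s) (f t) δ ⟩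
              C * δ - f s                ≈⟨ +-congˡ (-‿cong (scaled (f s))) ⟨
              C * δ - (1# + C) * δ       ≈⟨ solve 2 (λ c δ → c :* δ :- (con (+ 1) :+ c) :* δ := :- δ) refl C δ ⟩
              - δ                        ∎)
              (≥0-+ (proj₁ (lipschitz F (between lo≤t t≤hi) s∈ t≤s))
                    (≥0-+ (≤⇒≥0 ft≤0) (*-nonneg (constant≥0 F) (≤⇒≥0 s-δ≤t))))
        -- Up to `s + δ` the function cannot rise above 0. Either `s + δ` belongs to `Below`,
        -- against the bound `s` unless `δ ≤ 0`, or it lies beyond `hi`, and then `0 ≤ f hi` gives
        -- `δ ≤ 0`.
        f-s≈0 (inj₂ -fs≥0) = begin
          f s          ≈⟨ -‿involutive (f s) ⟨
          - - f s      ≈⟨ -‿cong (vanish -fs≥0 (cases (total (s + δ) hi))) ⟩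
          - 0#         ≈⟨ -0#≈0# ⟩
          0#           ∎
          where
          δ : Carrier
          δ = - f s * i
          s≤s+δ : s ≤ s + δ
          s≤s+δ = ≥0⇒≤ (≥0-resp (solve 2 (λ s δ → δ := s :+ δ :- s) refl s δ) (*-nonneg -fs≥0 i≥0))
          cases : s + δ ≤ hi ⊎ hi ≤ s + δ → NonNegative (- δ)
          cases (inj₁ s+δ≤hi) = ≥0-resp (solve 2 (λ s δ → s :- (s :+ δ) := :- δ) refl s δ)
            (≤⇒≥0 (upper t (≤-trans lo≤s s≤s+δ , s+δ≤hi , ≥0⇒≤ (≥0-resp (begin
              (C * (t - s) - (f t - f s)) + δ
                ≈⟨ solve 5 (λ c s δ fs ft → (c :* (s :+ δ :- s) :- (ft :- fs)) :+ δ
                                              := (con (+ 1) :+ c) :* δ :+ fs :- ft) refl C s δ (f s) (f t) ⟩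
              (1# + C) * δ + f s - f t     ≈⟨ +-congʳ (+-congʳ (scaled (- f s))) ⟩
              - f s + f s - f t            ≈⟨ +-congʳ (-‿inverseˡ (f s)) ⟩
              0# - f t                     ∎)
              (≥0-+ (proj₁ (lipschitz F s∈ (between (≤-trans lo≤s s≤s+δ) s+δ≤hi) s≤s+δ)) (*-nonneg -fs≥0 i≥0))))))
            where
            t : Carrier
            t = s + δ
          cases (inj₂ hi≤s+δ) = ≥0-resp (begin
              (C * (hi - s) - (f hi - f s)) + (C * (s + δ - hi) + f hi)
                ≈⟨ solve 6 (λ c s δ h fs fh → (c :* (h :- s) :- (fh :- fs)) :+ (c :* (s :+ δ :- h) :+ fh)
                                                := ((con (+ 1) :+ c) :* δ :+ fs) :- δ) refl C s δ hi (f s) (f hi) ⟩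
              (1# + C) * δ + f s - δ       ≈⟨ +-congʳ (trans (+-congʳ (scaled (- f s))) (-‿inverseˡ (f s))) ⟩
              0# - δ                       ≈⟨ +-identityˡ _ ⟩
              - δ                          ∎)
              (≥0-+ (proj₁ (lipschitz F s∈ hi∈ s≤hi)) (≥0-+ (*-nonneg (constant≥0 F) (≤⇒≥0 hi≤s+δ)) 0≤f-hi))

  abstract
    square-root : ∀ {r} → NonNegative r → ∃[ t ] t * t ≈ r
    square-root {r} r≥0 = proj₁ zero-of-F , x∙y⁻¹≈ε⇒x≈y _ _ (proj₂ zero-of-F)
      where
      β : Carrier
      -- The right endpoint: `β * β - r` equals `(1# + r) + r * r`, which is nonnegative for every
      -- `r ≥ 0`.
      β = 1# + r
      β≥0 : NonNegative β
      β≥0 = ≥0-+ ≥0-1 r≥0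
      0∈ : ∣ 0# ∣≤ β
      0∈ = ≥0-resp (solve 1 (λ b → b := b :- con (+ 0)) refl β) β≥0 , ≥0-resp (sym (+-identityʳ β)) β≥0
      F : Lipschitz β (λ t → t * t - r)
      F = lipschitz-+ β (lipschitz-* β (lipschitz-id β) (lipschitz-id β) 0∈) (lipschitz-const β (- r))
      f0≤0 : 0# * 0# - r ≤ 0#
      f0≤0 = ≥0⇒≤ (≥0-resp (solve 1 (λ r → r := con (+ 0) :- (con (+ 0) :* con (+ 0) :- r)) refl r) r≥0)
      0≤fβ : 0# ≤ β * β - r
      0≤fβ = ≥0-resp (solve 1 (λ r → (con (+ 1) :+ r) :+ r :* r := (con (+ 1) :+ r) :* (con (+ 1) :+ r) :- r) refl r)
        (≥0-+ β≥0 (≥0-square r))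
      zero-of-F : ∃[ t ] t * t - r ≈ 0#
      zero-of-F = intermediate-value β F 0∈ (∣≥0∣≤ β≥0) β≥0 f0≤0 0≤fβ

-- Complex numbers and roots on the unit circle

module ComplexField (ℝ : CompleteOrderedField) where
  private
    module ℝ = CompleteOrderedField ℝ
    module ℂ = Complex ℝ
  open ℂ using (ℂ)
  open OrderedField ℝ
  private
    module S = IntegerSolver ℝ.commutativeRing
    open S using (solve; _:=_; _:+_; _:*_; _:-_; :-_; con)

    assoc : ∀ z w u → ((z ℂ.* w) ℂ.* u) ℂ.≈ (z ℂ.* (w ℂ.* u))
    assoc (a , b) (c , d) (x , y) =
        solve 6 (λ a b c d x y → (a :* c :- b :* d) :* x :- (a :* d :+ b :* c) :* y :=
                                 a :* (c :* x :- d :* y) :- b :* (c :* y :+ d :* x)) ℝ.refl a b c d x y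
      , solve 6 (λ a b c d x y → (a :* c :- b :* d) :* y :+ (a :* d :+ b :* c) :* x :=
                                 a :* (c :* y :+ d :* x) :+ b :* (c :* x :- d :* y)) ℝ.refl a b c d x y

    comm : ∀ z w → (z ℂ.* w) ℂ.≈ (w ℂ.* z)
    comm (a , b) (c , d) =
        solve 4 (λ a b c d → a :* c :- b :* d := c :* a :- d :* b) ℝ.refl a b c d
      , solve 4 (λ a b c d → a :* d :+ b :* c := c :* b :+ d :* a) ℝ.refl a b c d

    distribˡ : ∀ z w u → (z ℂ.* (w ℂ.+ u)) ℂ.≈ ((z ℂ.* w) ℂ.+ (z ℂ.* u))
    distribˡ (a , b) (c , d) (x , y) =
        solve 6 (λ a b c d x y → a :* (c :+ x) :- b :* (d :+ y) := a :* c :- b :* d :+ (a :* x :- b :* y)) ℝ.refl a b c d x y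
      , solve 6 (λ a b c d x y → a :* (d :+ y) :+ b :* (c :+ x) := a :* d :+ b :* c :+ (a :* y :+ b :* x)) ℝ.refl a b c d x y

    distribʳ : ∀ u z w → ((z ℂ.+ w) ℂ.* u) ℂ.≈ ((z ℂ.* u) ℂ.+ (w ℂ.* u))
    distribʳ (x , y) (a , b) (c , d) =
        solve 6 (λ a b c d x y → (a :+ c) :* x :- (b :+ d) :* y := a :* x :- b :* y :+ (c :* x :- d :* y)) ℝ.refl a b c d x y
      , solve 6 (λ a b c d x y → (a :+ c) :* y :+ (b :+ d) :* x := a :* y :+ b :* x :+ (c :* y :+ d :* x)) ℝ.refl a b c d x y

    identityˡ : ∀ z → (ℂ.1# ℂ.* z) ℂ.≈ z
    identityˡ (a , b) =
        solve 2 (λ a b → con (+ 1) :* a :- con (+ 0) :* b := a) ℝ.refl a b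
      , solve 2 (λ a b → con (+ 1) :* b :+ con (+ 0) :* a := b) ℝ.refl a b

    identityʳ : ∀ z → (z ℂ.* ℂ.1#) ℂ.≈ z
    identityʳ (a , b) =
        solve 2 (λ a b → a :* con (+ 1) :- b :* con (+ 0) := a) ℝ.refl a b
      , solve 2 (λ a b → a :* con (+ 0) :+ b :* con (+ 1) := b) ℝ.refl a b

  commutativeRing : CommutativeRing 0ℓ 0ℓ
  commutativeRing = record
    { Carrier = ℂ ; _≈_ = ℂ._≈_ ; _+_ = ℂ._+_ ; _*_ = ℂ._*_ ; -_ = ℂ.-_ ; 0# = ℂ.0# ; 1# = ℂ.1#
    ; isCommutativeRing = record
      { isRing = record
        { +-isAbelianGroup = record
          { isGroup = record
            { isMonoid = record
              { isSemigroup = record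
                { isMagma = record
                  { isEquivalence = record
                    { refl = ℝ.refl , ℝ.refl
                    ; sym = λ (p , q) → ℝ.sym p , ℝ.sym q
                    ; trans = λ (p , q) (p′ , q′) → ℝ.trans p p′ , ℝ.trans q q′ }
                  ; ∙-cong = λ (p , q) (p′ , q′) → ℝ.+-cong p p′ , ℝ.+-cong q q′ }
                ; assoc = λ _ _ _ → ℝ.+-assoc _ _ _ , ℝ.+-assoc _ _ _ }
              ; identity = (λ _ → ℝ.+-identityˡ _ , ℝ.+-identityˡ _) , (λ _ → ℝ.+-identityʳ _ , ℝ.+-identityʳ _) }
            ; inverse = (λ _ → ℝ.-‿inverseˡ _ , ℝ.-‿inverseˡ _) , (λ _ → ℝ.-‿inverseʳ _ , ℝ.-‿inverseʳ _)
            ; ⁻¹-cong = λ (p , q) → ℝ.-‿cong p , ℝ.-‿cong q }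
          ; comm = λ _ _ → ℝ.+-comm _ _ , ℝ.+-comm _ _ }
        ; *-cong = λ (p , q) (p′ , q′) →
              ℝ.+-cong (ℝ.*-cong p p′) (ℝ.-‿cong (ℝ.*-cong q q′))
            , ℝ.+-cong (ℝ.*-cong p q′) (ℝ.*-cong q p′)
        ; *-assoc = assoc
        ; *-identity = identityˡ , identityʳ
        ; distrib = distribˡ , distribʳ }
      ; *-comm = comm } }

  open CommutativeRing commutativeRing hiding (zero)
  open Algebra.Properties.Ring ring
  open Powers commutativeRing
  private
    module ℝ^ = Powers ℝ.commutativeRing
    module R = Relation.Binary.Reasoning.Setoid ℝ.setoid
    module Z = Algebra.Properties.Ring ℝ.ring
  open Relation.Binary.Reasoning.Setoid setoid

  conj : ℂ → ℂ
  conj (a , b) = a , ℝ.- b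

  -- Squared moduli require no square roots, and their multiplicativity is a polynomial identity.
  norm² : ℂ → ℝ.Carrier
  norm² (a , b) = a ℝ.* a ℝ.+ b ℝ.* b

  OnUnitCircle : ℂ → Set
  OnUnitCircle z = norm² z ℝ.≈ ℝ.1#

  norm²-cong : ∀ {z w} → z ≈ w → norm² z ℝ.≈ norm² w
  norm²-cong (p , q) = ℝ.+-cong (ℝ.*-cong p p) (ℝ.*-cong q q)

  norm²-* : ∀ z w → norm² (z * w) ℝ.≈ norm² z ℝ.* norm² w
  norm²-* (a , b) (c , d) =
    solve 4 (λ a b c d → (a :* c :- b :* d) :* (a :* c :- b :* d) :+ (a :* d :+ b :* c) :* (a :* d :+ b :* c) :=
                         (a :* a :+ b :* b) :* (c :* c :+ d :* d)) ℝ.refl a b c d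

  norm²-1 : norm² 1# ℝ.≈ ℝ.1#
  norm²-1 = solve 0 (con (+ 1) :* con (+ 1) :+ con (+ 0) :* con (+ 0) := con (+ 1)) ℝ.refl

  norm²-^ : ∀ z k → norm² (z ^ k) ℝ.≈ norm² z ℝ^.^ k
  norm²-^ z zero    = norm²-1
  norm²-^ z (suc k) = ℝ.trans (norm²-* z (z ^ k)) (ℝ.*-congˡ (norm²-^ z k))

  norm²≥0 : ∀ z → NonNegative (norm² z)
  norm²≥0 (a , b) = ≥0-+ (≥0-square a) (≥0-square b)

  norm²≈0 : ∀ z → norm² z ℝ.≈ ℝ.0# → z ≈ 0#
  norm²≈0 (a , b) eq = sum-of-squares≈0 eq , sum-of-squares≈0 (ℝ.trans (ℝ.+-comm _ _) eq)

  *-conj : ∀ z → z * conj z ≈ (norm² z , ℝ.0#)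
  *-conj (a , b) = solve 2 (λ a b → a :* a :- b :* (:- b) := a :* a :+ b :* b) ℝ.refl a b
                 , solve 2 (λ a b → a :* (:- b) :+ b :* a := con (+ 0)) ℝ.refl a b

  unit-*-conj : ∀ {z} → OnUnitCircle z → z * conj z ≈ 1#
  unit-*-conj {z} unit = trans (*-conj z) (unit , ℝ.refl)

  1≉0 : ¬ 1# ≈ 0#
  1≉0 (1≈0 , _) = ℝ.0≉1 (ℝ.sym 1≈0)

  unit≉0 : ∀ {z} → OnUnitCircle z → ¬ z ≈ 0#
  unit≉0 {z} unit z≈0 = 1≉0 (trans (sym (unit-*-conj {z} unit)) (trans (*-congʳ {conj z} {z} {0#} z≈0) (zeroˡ (conj z))))

  -- Multiplying `z * w` by `conj z` gives `norm² z` times `w`, so each component of `w` is killed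
  -- by a nonzero real.
  ℂ-integral : ∀ {z w} → z * w ≈ 0# → ¬ z ≈ 0# → w ≈ 0#
  ℂ-integral {a , b} {c , d} zw≈0 z≉0 =
      integral (ℝ.trans (solve 4 (λ a b c d → (a :* a :+ b :* b) :* c :=
                                 a :* (a :* c :- b :* d) :+ b :* (a :* d :+ b :* c)) ℝ.refl a b c d)
                        (combine₁ (proj₁ zw≈0) (proj₂ zw≈0))) (z≉0 ∘ norm²≈0 (a , b))
    , integral (ℝ.trans (solve 4 (λ a b c d → (a :* a :+ b :* b) :* d :=
                                 a :* (a :* d :+ b :* c) :- b :* (a :* c :- b :* d)) ℝ.refl a b c d)
                        (combine₂ (proj₂ zw≈0) (proj₁ zw≈0))) (z≉0 ∘ norm²≈0 (a , b))
    where
    combine₁ : ∀ {p q} → p ℝ.≈ ℝ.0# → q ℝ.≈ ℝ.0# → a ℝ.* p ℝ.+ b ℝ.* q ℝ.≈ ℝ.0#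
    combine₁ p≈ q≈ = ℝ.trans (ℝ.+-cong (ℝ.*-congˡ p≈) (ℝ.*-congˡ q≈))
      (solve 2 (λ a b → a :* con (+ 0) :+ b :* con (+ 0) := con (+ 0)) ℝ.refl a b)
    combine₂ : ∀ {p q} → p ℝ.≈ ℝ.0# → q ℝ.≈ ℝ.0# → a ℝ.* p ℝ.- b ℝ.* q ℝ.≈ ℝ.0#
    combine₂ p≈ q≈ = ℝ.trans (ℝ.+-cong (ℝ.*-congˡ p≈) (ℝ.-‿cong (ℝ.*-congˡ q≈)))
      (solve 2 (λ a b → a :* con (+ 0) :- b :* con (+ 0) := con (+ 0)) ℝ.refl a b)

  open Algebra.Properties.Semiring.Mult semiring using () renaming (_×_ to _×ᶜ_)

  characteristic-0 : ∀ k → ¬ (suc k ×ᶜ 1#) ≈ 0#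
  characteristic-0 k (eq , _) = 1+≥0≉0 (multiple≥0 k) eq
    where
    multiple≥0 : ∀ k → NonNegative (proj₁ (k ×ᶜ 1#))
    multiple≥0 zero    = ≥0-resp (ℝ.-‿inverseʳ ℝ.1#) (≤⇒≥0 (IsDecTotalOrder.refl ℝ.isDecTotalOrder))
    multiple≥0 (suc k) = ≥0-+ ≥0-1 (multiple≥0 k)

  -- The squared modulus of `z` is a nonnegative real whose `suc k`-th power is 1.
  root-on-unit-circle : ∀ {z g} k → z ^ suc k ≈ g → OnUnitCircle g → OnUnitCircle z
  root-on-unit-circle {z} {g} k eq unit = ≥0-root-of-unity (norm²≥0 z) k (R.begin
    norm² z ℝ^.^ suc k   R.≈⟨ norm²-^ z (suc k) ⟨
    norm² (z ^ suc k)    R.≈⟨ norm²-cong {z ^ suc k} {g} eq ⟩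
    norm² g              R.≈⟨ unit ⟩
    ℝ.1#                 R.∎)

  abstract
    -- The factor that scales a complex number of squared modulus `r` onto the unit circle.
    reciprocal-root : ∀ {r} → NonNegative r → ¬ r ℝ.≈ ℝ.0# → ∃[ u ] (u ℝ.* u) ℝ.* r ℝ.≈ ℝ.1#
    reciprocal-root {r} r≥0 r≉0 with t , t²≈r ← square-root r≥0 with t ℝ.≟ ℝ.0#
    ... | yes t≈0 = contradiction (ℝ.trans (ℝ.sym t²≈r) (ℝ.trans (ℝ.*-congʳ t≈0) (ℝ.zeroˡ t))) r≉0
    ... | no  t≉0 with u , tu≈1 ← ℝ.inverse t t≉0 = u , (R.begin
      u ℝ.* u ℝ.* r               R.≈⟨ ℝ.*-congˡ t²≈r ⟨
      u ℝ.* u ℝ.* (t ℝ.* t)       R.≈⟨ solve 2 (λ u t → u :* u :* (t :* t) := (t :* u) :* (t :* u)) ℝ.refl u t ⟩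
      t ℝ.* u ℝ.* (t ℝ.* u)       R.≈⟨ ℝ.*-cong tu≈1 tu≈1 ⟩
      ℝ.1# ℝ.* ℝ.1#               R.≈⟨ ℝ.*-identityˡ _ ⟩
      ℝ.1#                        R.∎)

  -- For g ≠ -1 the number 1 + g bisects the angle between 1 and g.
  abstract
    unit-square-root : ∀ g → OnUnitCircle g → ∃[ z ] z * z ≈ g
    unit-square-root g@(a , b) unit with norm² (1# + g) ℝ.≟ ℝ.0#
    -- Only `g ≈ - 1#` lands here, and its root is the imaginary unit.
    ... | yes N≈0 with 1+a≈0 , 0+b≈0 ← norm²≈0 (1# + g) N≈0 = (ℝ.0# , ℝ.1#)
      , (R.begin
          ℝ.0# ℝ.* ℝ.0# ℝ.- ℝ.1# ℝ.* ℝ.1#   R.≈⟨ solve 1 (λ a → con (+ 0) :* con (+ 0) :- con (+ 1) :* con (+ 1) := a :- (con (+ 1) :+ a)) ℝ.refl a ⟩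
          a ℝ.- (ℝ.1# ℝ.+ a)                R.≈⟨ ℝ.+-congˡ (ℝ.-‿cong 1+a≈0) ⟩
          a ℝ.- ℝ.0#                        R.≈⟨ solve 1 (λ a → a :- con (+ 0) := a) ℝ.refl a ⟩
          a                                 R.∎)
      , (R.begin
          ℝ.0# ℝ.* ℝ.1# ℝ.+ ℝ.1# ℝ.* ℝ.0#   R.≈⟨ solve 0 (con (+ 0) :* con (+ 1) :+ con (+ 1) :* con (+ 0) := con (+ 0)) ℝ.refl ⟩
          ℝ.0#                              R.≈⟨ 0+b≈0 ⟨
          ℝ.0# ℝ.+ b                        R.≈⟨ ℝ.+-identityˡ b ⟩
          b                                 R.∎)
    -- The root is `1# + g` divided by its modulus: on the unit circle the square of `1# + g` is `g`
    -- times `norm² (1# + g)`. Both computations isolate the defect as a multiple of `1 - norm² g`.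
    ... | no N≉0 with u , u²N≈1 ← reciprocal-root (norm²≥0 (1# + g)) N≉0 = ((u ℝ.* (ℝ.1# ℝ.+ a)) , (u ℝ.* b))
      , (R.begin
          u ℝ.* (ℝ.1# ℝ.+ a) ℝ.* (u ℝ.* (ℝ.1# ℝ.+ a)) ℝ.- u ℝ.* b ℝ.* (u ℝ.* b)
            R.≈⟨ solve 3 (λ u a b → u :* (con (+ 1) :+ a) :* (u :* (con (+ 1) :+ a)) :- u :* b :* (u :* b) :=
                   a :* (u :* u :* N a b) :+ u :* u :* (con (+ 1) :+ a) :* (con (+ 1) :- (a :* a :+ b :* b))) ℝ.refl u a b ⟩
          a ℝ.* (u ℝ.* u ℝ.* norm² (1# + g)) ℝ.+ u ℝ.* u ℝ.* (ℝ.1# ℝ.+ a) ℝ.* (ℝ.1# ℝ.- norm² g)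
            R.≈⟨ finish a (u ℝ.* u ℝ.* (ℝ.1# ℝ.+ a)) u²N≈1 unit ⟩
          a R.∎)
      , (R.begin
          u ℝ.* (ℝ.1# ℝ.+ a) ℝ.* (u ℝ.* b) ℝ.+ u ℝ.* b ℝ.* (u ℝ.* (ℝ.1# ℝ.+ a))
            R.≈⟨ solve 3 (λ u a b → u :* (con (+ 1) :+ a) :* (u :* b) :+ u :* b :* (u :* (con (+ 1) :+ a)) :=
                   b :* (u :* u :* N a b) :+ u :* u :* b :* (con (+ 1) :- (a :* a :+ b :* b))) ℝ.refl u a b ⟩
          b ℝ.* (u ℝ.* u ℝ.* norm² (1# + g)) ℝ.+ u ℝ.* u ℝ.* b ℝ.* (ℝ.1# ℝ.- norm² g)
            R.≈⟨ finish b (u ℝ.* u ℝ.* b) u²N≈1 unit ⟩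
          b R.∎)
      where
      N : ∀ {n} → S.Polynomial n → S.Polynomial n → S.Polynomial n
      N a b = (con (+ 1) :+ a) :* (con (+ 1) :+ a) :+ (con (+ 0) :+ b) :* (con (+ 0) :+ b)
      finish : ∀ x y {p q} → p ℝ.≈ ℝ.1# → q ℝ.≈ ℝ.1# → x ℝ.* p ℝ.+ y ℝ.* (ℝ.1# ℝ.- q) ℝ.≈ x
      finish x y p≈1 q≈1 = ℝ.trans (ℝ.+-cong (ℝ.*-congˡ p≈1) (ℝ.*-congˡ (ℝ.+-congˡ (ℝ.-‿cong q≈1))))
        (solve 2 (λ x y → x :* con (+ 1) :+ y :* (con (+ 1) :- con (+ 1)) := x) ℝ.refl x y)

  Real : ℂ → Set
  Real z = proj₂ z ℝ.≈ ℝ.0#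

  real-* : ∀ {z w} → Real z → Real w → Real (z * w)
  real-* {a , b} {c , d} b≈0 d≈0 = ℝ.trans (ℝ.+-cong (ℝ.*-congˡ d≈0) (ℝ.*-congʳ b≈0))
    (solve 2 (λ a c → a :* con (+ 0) :+ con (+ 0) :* c := con (+ 0)) ℝ.refl a c)

  real-^ : ∀ {z} → Real z → ∀ k → Real (z ^ k)
  real-^ real zero    = ℝ.refl
  real-^ {z} real (suc k) = real-* {z} {z ^ k} real (real-^ {z} real k)

  real-unit : ∀ {z} → Real z → OnUnitCircle z → z ≈ 1# ⊎ z ≈ - 1#
  real-unit {a , b} b≈0 unit with (a ℝ.- ℝ.1#) ℝ.≟ ℝ.0#
  ... | yes a-1≈0 = inj₁ (Z.x∙y⁻¹≈ε⇒x≈y a ℝ.1# a-1≈0 , b≈0)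
  ... | no  a-1≉0 = inj₂
    ( (R.begin
        a                         R.≈⟨ solve 1 (λ a → a := (a :+ con (+ 1)) :- con (+ 1)) ℝ.refl a ⟩
        (a ℝ.+ ℝ.1#) ℝ.- ℝ.1#     R.≈⟨ ℝ.+-congʳ (integral product≈0 a-1≉0) ⟩
        ℝ.0# ℝ.- ℝ.1#             R.≈⟨ ℝ.+-identityˡ _ ⟩
        ℝ.- ℝ.1#                  R.∎)
    , ℝ.trans b≈0 (ℝ.sym Z.-0#≈0#) )
    where
    product≈0 : (a ℝ.- ℝ.1#) ℝ.* (a ℝ.+ ℝ.1#) ℝ.≈ ℝ.0#
    product≈0 = R.begin
      (a ℝ.- ℝ.1#) ℝ.* (a ℝ.+ ℝ.1#)                   R.≈⟨ solve 2 (λ a b → (a :- con (+ 1)) :* (a :+ con (+ 1)) := (a :* a :+ b :* b) :- con (+ 1) :- b :* b) ℝ.refl a b ⟩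
      norm² (a , b) ℝ.- ℝ.1# ℝ.- b ℝ.* b              R.≈⟨ ℝ.+-cong (ℝ.+-congʳ unit) (ℝ.-‿cong (ℝ.*-cong b≈0 b≈0)) ⟩
      ℝ.1# ℝ.- ℝ.1# ℝ.- ℝ.0# ℝ.* ℝ.0#                 R.≈⟨ solve 0 (con (+ 1) :- con (+ 1) :- con (+ 0) :* con (+ 0) := con (+ 0)) ℝ.refl ⟩
      ℝ.0#                                            R.∎

  odd-power-of-minus-1 : ∀ k → (- 1#) ^ suc (k ℕ.* 2) ≈ - 1#
  odd-power-of-minus-1 zero    = *-identityʳ (- 1#)
  odd-power-of-minus-1 (suc k) = begin
    - 1# * (- 1# * (- 1#) ^ suc (k ℕ.* 2))   ≈⟨ *-congˡ {(- 1#)} (*-congˡ {(- 1#)} (odd-power-of-minus-1 k)) ⟩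
    - 1# * (- 1# * - 1#)                     ≈⟨ *-congˡ {(- 1#)} (trans (-1*x≈-x (- 1#)) (-‿involutive 1#)) ⟩
    - 1# * 1#                                ≈⟨ *-identityʳ (- 1#) ⟩
    - 1#                                     ∎

  -- The path t ↦ (t, 1 - t²) joins -1 to 1 in ℂ ∖ {0}; along it the imaginary
  -- part of the m-th power divided by g changes sign when m is odd.
  module OddRoot (k : ℕ) (g : ℂ) (unit : OnUnitCircle g) where

    private
      m : ℕ
      m = suc (k ℕ.* 2)

      a b : ℝ.Carrier
      a = proj₁ g
      b = proj₂ g

      path : ℝ.Carrier → ℂ
      path t = t , ℝ.1# ℝ.- t ℝ.* t

      -- The imaginary part of `conj g * path t ^ m`; on the unit circle, multiplication by `conj g`
      -- is division by `g`.
      f : ℝ.Carrier → ℝ.Carrier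
      f t = a ℝ.* proj₂ (path t ^ m) ℝ.- b ℝ.* proj₁ (path t ^ m)

      1∈ : ∣ ℝ.1# ∣≤ ℝ.1#
      1∈ = ∣≥0∣≤ ≥0-1

      0∈ : ∣ ℝ.0# ∣≤ ℝ.1#
      0∈ = ≥0-resp (solve 0 (con (+ 1) := con (+ 1) :- con (+ 0)) ℝ.refl) ≥0-1 , ≥0-resp (ℝ.sym (ℝ.+-identityʳ _)) ≥0-1

      infixl 6 _⊞_
      infixl 7 _⊠_
      _⊞_ : ∀ {f g} → Lipschitz ℝ.1# f → Lipschitz ℝ.1# g → Lipschitz ℝ.1# (λ x → f x ℝ.+ g x)
      _⊞_ = lipschitz-+ ℝ.1#
      _⊠_ : ∀ {f g} → Lipschitz ℝ.1# f → Lipschitz ℝ.1# g → Lipschitz ℝ.1# (λ x → f x ℝ.* g x)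
      F ⊠ G = lipschitz-* ℝ.1# F G 0∈
      constant : ∀ a → Lipschitz ℝ.1# (λ _ → a)
      constant = lipschitz-const ℝ.1#
      negate : ∀ {f} → Lipschitz ℝ.1# f → Lipschitz ℝ.1# (λ x → ℝ.- f x)
      negate = lipschitz-neg ℝ.1#

      x-coordinate : Lipschitz ℝ.1# (λ t → proj₁ (path t))
      x-coordinate = lipschitz-id ℝ.1#
      y-coordinate : Lipschitz ℝ.1# (λ t → proj₂ (path t))
      y-coordinate = constant ℝ.1# ⊞ negate (x-coordinate ⊠ x-coordinate)

      power-lipschitz : ∀ j → Lipschitz ℝ.1# (λ t → proj₁ (path t ^ j)) × Lipschitz ℝ.1# (λ t → proj₂ (path t ^ j))
      power-lipschitz zero = constant ℝ.1# , constant ℝ.0#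
      power-lipschitz (suc j) with P , Q ← power-lipschitz j =
        (x-coordinate ⊠ P ⊞ negate (y-coordinate ⊠ Q)) , (x-coordinate ⊠ Q ⊞ y-coordinate ⊠ P)

      f-lipschitz : Lipschitz ℝ.1# f
      f-lipschitz with P , Q ← power-lipschitz m = constant a ⊠ Q ⊞ negate (constant b ⊠ P)

      f-at : ∀ {t w} → path t ^ m ≈ w → f t ℝ.≈ a ℝ.* proj₂ w ℝ.- b ℝ.* proj₁ w
      f-at (p , q) = ℝ.+-cong (ℝ.*-congˡ q) (ℝ.-‿cong (ℝ.*-congˡ p))

      path-1 : path ℝ.1# ^ m ≈ 1#
      path-1 = trans (^-congˡ m {path ℝ.1#} {1#} (ℝ.refl , solve 0 (con (+ 1) :- con (+ 1) :* con (+ 1) := con (+ 0)) ℝ.refl)) (1^ m)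

      path--1 : path (ℝ.- ℝ.1#) ^ m ≈ - 1#
      path--1 = trans (^-congˡ m {path (ℝ.- ℝ.1#)} {(- 1#)} (ℝ.refl , solve 0 (con (+ 1) :- (:- con (+ 1)) :* (:- con (+ 1)) := :- con (+ 0)) ℝ.refl))
                      (odd-power-of-minus-1 k)

      f-1 : f ℝ.1# ℝ.≈ ℝ.- b
      f-1 = ℝ.trans (f-at {ℝ.1#} {1#} path-1) (solve 2 (λ a b → a :* con (+ 0) :- b :* con (+ 1) := :- b) ℝ.refl a b)

      f--1 : f (ℝ.- ℝ.1#) ℝ.≈ b
      f--1 = ℝ.trans (f-at {ℝ.- ℝ.1#} {(- 1#)} path--1) (solve 2 (λ a b → a :* (:- con (+ 0)) :- b :* (:- con (+ 1)) := b) ℝ.refl a b)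

      -1≤1 : (ℝ.- ℝ.1#) ℝ.≤ ℝ.1#
      -1≤1 = ≥0⇒≤ (≥0-resp (solve 0 (con (+ 1) :+ con (+ 1) := con (+ 1) :- :- con (+ 1)) ℝ.refl) (≥0-+ ≥0-1 ≥0-1))

      ≤0 : ∀ {x} → NonNegative (ℝ.- x) → x ℝ.≤ ℝ.0#
      ≤0 -x≥0 = ≥0⇒≤ (≥0-resp (ℝ.sym (ℝ.+-identityˡ _)) -x≥0)

      abstract
        zero-of-f : ∃[ t ] f t ℝ.≈ ℝ.0#
        zero-of-f with ≥0-total b
        ... | inj₂ -b≥0 = intermediate-value ℝ.1# f-lipschitz (∣-∣≤ 1∈) 1∈ -1≤1
                (≤0 (≥0-resp (ℝ.-‿cong (ℝ.sym f--1)) -b≥0)) (≥0-resp (ℝ.sym f-1) -b≥0)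
        -- Now `f` goes from `b ≥ 0` at the left end to `- b` at the right end, so the values of its
        -- negative are the ones in the required order.
        ... | inj₁ b≥0 with t , eq ← intermediate-value ℝ.1# (negate f-lipschitz) (∣-∣≤ 1∈) 1∈ -1≤1
                (≤0 (≥0-resp (ℝ.trans (ℝ.sym f--1) (ℝ.sym (Z.-‿involutive _))) b≥0))
                (≥0-resp (ℝ.trans (ℝ.sym (Z.-‿involutive b)) (ℝ.-‿cong (ℝ.sym f-1))) b≥0)
            = t , ℝ.trans (ℝ.sym (Z.-‿involutive _)) (ℝ.trans (ℝ.-‿cong eq) Z.-0#≈0#)

      t : ℝ.Carrier
      t = proj₁ zero-of-f

      s : ℂ
      s = path t

      c P Q : ℝ.Carrier
      P = proj₁ (s ^ m)
      Q = proj₂ (s ^ m)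
      c = a ℝ.* P ℝ.+ b ℝ.* Q

      -- That `f` vanishes at `t` means that `conj g * s ^ m` is real. Its value is `c`, and
      -- multiplying back by `g` uses that `g` is a unit.
      parallel : s ^ m ≈ (c , ℝ.0#) * g
      parallel =
          ℝ.trans (ℝ.sym (finish P b unit (proj₂ zero-of-f)))
            (solve 4 (λ a b p q → p :* (a :* a :+ b :* b) :+ b :* (a :* q :- b :* p) :=
                                  (a :* p :+ b :* q) :* a :- con (+ 0) :* b) ℝ.refl a b P Q)
        , ℝ.trans (ℝ.sym (finish Q (ℝ.- a) unit (proj₂ zero-of-f)))
            (solve 4 (λ a b p q → q :* (a :* a :+ b :* b) :+ (:- a) :* (a :* q :- b :* p) :=
                                  (a :* p :+ b :* q) :* b :+ con (+ 0) :* a) ℝ.refl a b P Q)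
        where
        finish : ∀ x y {p q} → p ℝ.≈ ℝ.1# → q ℝ.≈ ℝ.0# → x ℝ.* p ℝ.+ y ℝ.* q ℝ.≈ x
        finish x y p≈1 q≈0 = ℝ.trans (ℝ.+-cong (ℝ.*-congˡ p≈1) (ℝ.*-congˡ q≈0))
          (solve 2 (λ x y → x :* con (+ 1) :+ y :* con (+ 0) := x) ℝ.refl x y)

      s≉0 : ¬ norm² s ℝ.≈ ℝ.0#
      s≉0 N≈0 with t≈0 , 1-t²≈0 ← norm²≈0 s N≈0 = ℝ.0≉1 (ℝ.sym (R.begin
        ℝ.1#                                R.≈⟨ solve 1 (λ t → con (+ 1) := (con (+ 1) :- t :* t) :+ t :* t) ℝ.refl t ⟩
        (ℝ.1# ℝ.- t ℝ.* t) ℝ.+ t ℝ.* t      R.≈⟨ ℝ.+-cong 1-t²≈0 (ℝ.*-cong t≈0 t≈0) ⟩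
        ℝ.0# ℝ.+ ℝ.0# ℝ.* ℝ.0#              R.≈⟨ solve 0 (con (+ 0) :+ con (+ 0) :* con (+ 0) := con (+ 0)) ℝ.refl ⟩
        ℝ.0#                                R.∎))

      abstract
        normaliser : ∃[ u ] (u ℝ.* u) ℝ.* norm² s ℝ.≈ ℝ.1#
        normaliser = reciprocal-root (norm²≥0 s) s≉0

      u ζ w : ℂ
      u = proj₁ normaliser , ℝ.0#
      ζ = u * s
      w = u ^ m * (c , ℝ.0#)

      ζ-unit : OnUnitCircle ζ
      ζ-unit = ℝ.trans (norm²-* u s) (ℝ.trans (ℝ.*-congʳ
        (solve 1 (λ u → u :* u :+ con (+ 0) :* con (+ 0) := u :* u) ℝ.refl (proj₁ u))) (proj₂ normaliser))

      ζ^m : ζ ^ m ≈ w * g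
      ζ^m = begin
        ζ ^ m                          ≈⟨ *-^ u s m ⟩
        u ^ m * s ^ m                  ≈⟨ *-congˡ {u ^ m} parallel ⟩
        u ^ m * ((c , ℝ.0#) * g)       ≈⟨ *-assoc (u ^ m) (c , ℝ.0#) g ⟨
        w * g                          ∎

      -- In `ζ ^ m ≈ w * g` both `ζ` and `g` have modulus 1, hence so has `w`. As `w` is also real,
      -- it can only be 1 or -1.
      w-unit : OnUnitCircle w
      w-unit = R.begin
        norm² w                        R.≈⟨ ℝ.*-identityʳ _ ⟨
        norm² w ℝ.* ℝ.1#               R.≈⟨ ℝ.*-congˡ unit ⟨
        norm² w ℝ.* norm² g            R.≈⟨ norm²-* w g ⟨
        norm² (w * g)                  R.≈⟨ norm²-cong {ζ ^ m} {w * g} ζ^m ⟨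
        norm² (ζ ^ m)                  R.≈⟨ norm²-^ ζ m ⟩
        norm² ζ ℝ^.^ m                 R.≈⟨ ℝ^.^-congˡ m ζ-unit ⟩
        ℝ.1# ℝ^.^ m                    R.≈⟨ ℝ^.1^ m ⟩
        ℝ.1#                           R.∎

      normalised-root : w ≈ 1# ⊎ w ≈ - 1# → ∃[ z ] z ^ m ≈ g
      normalised-root (inj₁ w≈1) = ζ , (begin
        ζ ^ m      ≈⟨ ζ^m ⟩
        w * g      ≈⟨ *-congʳ {g} {w} {1#} w≈1 ⟩
        1# * g     ≈⟨ *-identityˡ g ⟩
        g          ∎)
      -- The exponent is odd, so a sign change of `ζ` absorbs the factor -1.
      normalised-root (inj₂ w≈-1) = - 1# * ζ , (begin
        (- 1# * ζ) ^ m          ≈⟨ *-^ (- 1#) ζ m ⟩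
        (- 1#) ^ m * ζ ^ m      ≈⟨ *-cong {(- 1#) ^ m} {(- 1#)} {ζ ^ m} {(- 1#) * g} (odd-power-of-minus-1 k)
                                     (trans ζ^m (*-congʳ {g} {w} {(- 1#)} w≈-1)) ⟩
        - 1# * (- 1# * g)       ≈⟨ trans (-1*x≈-x (- 1# * g)) (trans (-‿cong (-1*x≈-x g)) (-‿involutive g)) ⟩
        g                       ∎)

    abstract
      odd-root : ∃[ z ] z ^ m ≈ g
      odd-root = normalised-root (real-unit {w} (real-* {u ^ m} {c , ℝ.0#} (real-^ {u} ℝ.refl m) ℝ.refl) w-unit)

  private
    half : ∀ n → ∃[ k ] (n ≡ k ℕ.* 2 ⊎ n ≡ suc (k ℕ.* 2))
    half zero    = 0 , inj₁ ≡.refl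
    half (suc n) with half n
    ... | k , inj₁ n≡ = k , inj₂ (≡.cong suc n≡)
    ... | k , inj₂ n≡ = suc k , inj₁ (≡.cong suc n≡)

    even-root : ∀ k {g} → OnUnitCircle g → ∃[ w ] w * w ≈ g →
                (∀ w → OnUnitCircle w → ∃[ z ] z ^ suc k ≈ w) → ∃[ z ] z ^ (suc k ℕ.* 2) ≈ g
    even-root k {g} unit (w , w²≈g) root = proj₁ z , (begin
      proj₁ z ^ (suc k ℕ.* 2)   ≈⟨ ^-assocʳ (proj₁ z) (suc k) 2 ⟨
      (proj₁ z ^ suc k) ^ 2     ≈⟨ ^-congˡ 2 {proj₁ z ^ suc k} {w} (proj₂ z) ⟩
      w * (w * 1#)              ≈⟨ w²≈g′ ⟩
      g                         ∎)
      where
      open Algebra.Properties.Semiring.Exp semiring using (^-assocʳ)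
      w²≈g′ : w ^ 2 ≈ g
      w²≈g′ = trans (*-congˡ {w} (*-identityʳ w)) w²≈g
      z : ∃[ z ] z ^ suc k ≈ w
      z = root w (root-on-unit-circle {w} {g} 1 w²≈g′ unit)

    -- Square roots strip the factors 2 from `ℓ`, and the odd exponent that remains is handled at
    -- once by `OddRoot`. The square root taken on the way is again on the unit circle, as the
    -- recursive call demands.
    unit-root-acc : ∀ {ℓ} → Acc ℕ._<_ ℓ → 0 ℕ.< ℓ → ∀ g → OnUnitCircle g → ∃[ z ] z ^ ℓ ≈ g
    unit-root-acc {ℓ} (acc rs) 0<ℓ g unit with half ℓ
    ... | k     , inj₂ ≡.refl = OddRoot.odd-root k g unit
    ... | suc k , inj₁ ≡.refl = even-root k {g} unit (unit-square-root g unit)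
      (unit-root-acc (rs (ℕ.m<m*n (suc k) 2 (s≤s (s≤s z≤n)))) (s≤s z≤n))

  abstract
    unit-root : ∀ {ℓ} → 0 ℕ.< ℓ → ∀ g → OnUnitCircle g → ∃[ z ] z ^ ℓ ≈ g
    unit-root {ℓ} = unit-root-acc (ℕ.<-wellFounded ℓ)

-- Spectra

module CycleProducts (R : CommutativeRing 0ℓ 0ℓ) where
  open CommutativeRing R hiding (zero)
  open RawSemiringDefs (RawRing.rawSemiring rawRing) using (product)
  open Powers R
  open IntegerSolver R
  open Relation.Binary.Reasoning.Setoid setoid

  -- New factors enter on the right to match the recursion of `Unicyclic.gain`; `∏-head` mediates to
  -- `product`, which grows on the left.
  ∏ : (ℕ → Carrier) → ℕ → Carrier
  ∏ h zero    = 1#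
  ∏ h (suc k) = ∏ h k * h k

  ∏-head : ∀ h k → ∏ h (suc k) ≈ h 0 * ∏ (h ∘ suc) k
  ∏-head h zero    = *-comm 1# (h 0)
  ∏-head h (suc k) = trans (*-congʳ (∏-head h k)) (*-assoc _ _ _)

  product-∏ : ∀ {k} (t : Vector Carrier k) h → (∀ i → t i ≡ h (toℕ i)) → product t ≈ ∏ h k
  product-∏ {zero}  t h t≡h = refl
  product-∏ {suc k} t h t≡h =
    trans (*-cong (reflexive (t≡h zero)) (product-∏ (t ∘ suc) (h ∘ suc) (t≡h ∘ suc))) (sym (∏-head h k))

  telescope : ∀ {z} {f h : ℕ → Carrier} N → (∀ k → k ℕ.< N → z * f k ≈ h k * f (suc k)) →
              z ^ N * f 0 ≈ ∏ h N * f N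
  telescope zero    _    = refl
  telescope {z} {f} {h} (suc N) step = begin
    z * z ^ N * f 0              ≈⟨ *-assoc _ _ _ ⟩
    z * (z ^ N * f 0)            ≈⟨ *-congˡ (telescope N λ k k<N → step k (ℕ.m<n⇒m<1+n k<N)) ⟩
    z * (∏ h N * f N)            ≈⟨ solve 3 (λ z p f → z :* (p :* f) := p :* (z :* f)) refl z _ _ ⟩
    ∏ h N * (z * f N)            ≈⟨ *-congˡ (step N (ℕ.n<1+n N)) ⟩
    ∏ h N * (h N * f (suc N))    ≈⟨ *-assoc _ _ _ ⟨
    ∏ h N * h N * f (suc N)      ∎

  cancel-split : ∀ {x d y} l m → Cancellable x → x ^ l * d ≈ y * x ^ (l ℕ.+ m) → d ≈ y * x ^ m
  cancel-split {x} {d} {y} l m x-cancel eq = ^-cancel x-cancel l (begin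
    x ^ l * d                ≈⟨ eq ⟩
    y * x ^ (l ℕ.+ m)        ≈⟨ *-congˡ (^-homo-* x l m) ⟩
    y * (x ^ l * x ^ m)      ≈⟨ solve 3 (λ y p q → y :* (p :* q) := p :* (y :* q)) refl y _ _ ⟩
    x ^ l * (y * x ^ m)      ∎)
    where open Algebra.Properties.Semiring.Exp semiring using (^-homo-*)

if-yes : ∀ {P A : Set} (d : Dec P) {x y : A} → P → (if does d then x else y) ≡ x
if-yes (yes _) _ = ≡.refl
if-yes (no ¬p) p = contradiction p ¬p

if-no : ∀ {P A : Set} (d : Dec P) {x y : A} → ¬ P → (if does d then x else y) ≡ y
if-no (yes p) ¬p = contradiction p ¬p
if-no (no _)  _  = ≡.refl

-- Spectrum and spectral radius of a gain digraph

module GainSpectrum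
  (ℝ : CompleteOrderedField) {n : ℕ} (Φ : Complex.GainDigraph ℝ n)
  (U : IsUnicyclic (Complex.GainDigraph.digraph Φ))
  where
  private
    module ℝ = CompleteOrderedField ℝ
    module ℂ = Complex ℝ
  open ComplexField ℝ
  open OrderedField ℝ using (≥0-1)
  open CommutativeRing commutativeRing hiding (zero)
  open Algebra.Properties.Semiring.Sum semiring
  open FiniteSums commutativeRing
  open Powers commutativeRing
  open CycleProducts commutativeRing
  open Polynomials rawRing
  open PolynomialRing commutativeRing
  open RootMultiplicity commutativeRing (λ {z} {w} → ℂ-integral {z} {w})
  open Complex.GainDigraph Φ
  open UnicyclicStructure U
  open DirectedCycle (IsUnicyclic.cycle U) using (vertex; arc) renaming (length to ℓ)
  open Relation.Binary.Reasoning.Setoid setoid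

  A : Fin n → Fin n → Carrier
  A = adjacencyMatrix

  g : Carrier
  g = cycleGain (IsUnicyclic.cycle U)

  A-arc : ∀ {i j} (e : i ⟶ j) → A i j ≡ proj₁ (φ i j e)
  A-arc {i} {j} e with T? (adjacent i j)
  -- `φ` takes the proof of adjacency as an argument; the one found by `T?` and the given one are
  -- equal.
  ... | yes e′ = ≡.cong (proj₁ ∘ φ i j) (T-irrelevant e′ e)
  ... | no ¬e  = contradiction e ¬e

  A-no-arc : ∀ {i j} → ¬ i ⟶ j → A i j ≡ 0#
  A-no-arc {i} {j} ¬e with T? (adjacent i j)
  ... | yes e = contradiction e ¬e
  ... | no _  = ≡.refl

  A-support : ∀ i j → A i j ≈ 0# ⊎ i ⟶ j
  A-support i j with T? (adjacent i j)
  ... | yes e = inj₂ e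
  ... | no _  = inj₁ refl

  A-unit : ∀ {i j} → i ⟶ j → OnUnitCircle (A i j)
  A-unit {i} {j} e with A i j | A-arc e
  ... | _ | ≡.refl = ℝ.trans (ℝ.sym (proj₂ (proj₂ (φ i j e)))) (ℝ.*-identityˡ ℝ.1#)

  γ : ℕ → Carrier
  γ k = A (c k) (c (suc k))

  g≈∏γ : g ≈ ∏ γ ℓ
  g≈∏γ = product-∏ (λ i → proj₁ (φ (vertex i) (vertex (next i)) (arc i))) γ λ i →
    ≡.trans (≡.sym (A-arc (arc i))) (≡.cong (λ v → A v (vertex (next i))) (≡.sym (c-toℕ i)))

  ∏-unit : ∀ k → OnUnitCircle (∏ γ k)
  ∏-unit zero    = norm²-1
  ∏-unit (suc k) = ℝ.trans (norm²-* (∏ γ k) (γ k))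
    (ℝ.trans (ℝ.*-cong (∏-unit k) (A-unit (c-arc k))) (ℝ.*-identityˡ ℝ.1#))

  g-unit : OnUnitCircle g
  g-unit = ℝ.trans (norm²-cong {g} {∏ γ ℓ} g≈∏γ) (∏-unit ℓ)

  g≉0 : ¬ g ≈ 0#
  g≉0 = unit≉0 {g} g-unit

  private
    module P = CommutativeRing polynomialRing
    module P^ = Powers polynomialRing
    module D = CharacteristicDeterminant polynomialRing X (λ {p} {q} → X-cancel {p} {q}) {n}
    module DP = DeterminantProperties polynomialRing

  A-poly : Fin n → Fin n → Poly
  A-poly u v = const (A u v)

  A-poly-support : ∀ u v → A-poly u v ≈ₚ [] ⊎ u ⟶ v
  A-poly-support u v with A-support u v
  ... | inj₂ e   = inj₂ e
  ... | inj₁ A≈0 = inj₁ λ { zero → A≈0 ; (suc _) → refl }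

  private
    c-closed : c (suc L) ≡ c 0
    c-closed = ≡.trans (≡.cong c 1+L≡ℓ) c-period

    support : ∀ u v → v ≢ c 0 → A-poly u v ≈ₚ [] ⊎ u ⊏ v
    support u v v≢ with A-poly-support u v
    ... | inj₁ A≈0 = inj₁ A≈0
    ... | inj₂ e   = inj₂ (⊏-arc e v≢)

    support-off : ∀ u v → Off v → A-poly u v ≈ₚ [] ⊎ Off u
    support-off u v off with A-poly-support u v
    ... | inj₁ A≈0 = inj₁ A≈0
    ... | inj₂ e   = inj₂ (arc-into-off e off)

    ≤L⇒<ℓ : ∀ {k} → k ℕ.≤ L → k ℕ.< ℓ
    ≤L⇒<ℓ k≤L = ≡.subst (suc _ ℕ.≤_) 1+L≡ℓ (s≤s k≤L)

    support-on : ∀ k → k ℕ.≤ L → ∀ u → u ≢ c k → A-poly u (c (suc k)) ≈ₚ [] ⊎ Off u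
    support-on k k≤L u u≢ with A-poly-support u (c (suc k))
    ... | inj₁ A≈0 = inj₁ A≈0
    ... | inj₂ e with arc-into-cycle (≤L⇒<ℓ k≤L) e
    ...   | inj₁ u≡  = contradiction u≡ u≢
    ...   | inj₂ off = inj₂ off

    module DU = D.Unicyclic A-poly ⊏-wellFounded ⊏-trans ⊏-irrefl L c c-closed
      (λ k k<L → c-suc≢root (≤L⇒<ℓ k<L)) Off off≢root support support-off support-on

    gain≈ : ∀ k → DU.gain k ≈ₚ const (∏ γ k)
    gain≈ zero    = P.refl {const 1#}
    gain≈ (suc k) = P.trans {DU.gain k *ₚ const (γ k)} {const (∏ γ k) *ₚ const (γ k)} {const (∏ γ k * γ k)}
      (P.*-congʳ {const (γ k)} {DU.gain k} {const (∏ γ k)} (gain≈ k))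
      (P.sym {const (∏ γ k * γ k)} {const (∏ γ k) *ₚ const (γ k)} (const-* (∏ γ k) (γ k)))

    -- The two matrices differ only in how the diagonal is written: a conditional `X` on one side,
    -- `X` times a unit vector on the other.
    charPoly≈det : ℂ.charPoly A ≈ₚ DP.detᶜ (D.col A-poly)
    charPoly≈det = DP.det-cong entry
      where
      entry : ∀ i j → ((if does (i Fin.≟ j) then X else []) +ₚ map (-_) (const (A i j))) ≈ₚ D.col A-poly j i
      entry i j with i Fin.≟ j
      ... | yes _ = P.+-congʳ {map (-_) (const (A i j))} {X} {X *ₚ const 1#} (P.sym {X *ₚ const 1#} {X} (P.*-identityʳ X))
      ... | no  _ = P.+-congʳ {map (-_) (const (A i j))} {[]} {X *ₚ []} (P.sym {X *ₚ []} {[]} (P.zeroʳ X))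

    n≡ : suc L ℕ.+ (n ∸ ℓ) ≡ n
    n≡ = ≡.trans (≡.cong (ℕ._+ (n ∸ ℓ)) 1+L≡ℓ) (ℕ.m+[n∸m]≡n ℓ≤n)

  charPoly≈ : ℂ.charPoly A ≈ₚ (((X P^.^ suc L) +ₚ map (-_) (const g)) *ₚ (X P^.^ (n ∸ ℓ)))
  charPoly≈ = CycleProducts.cancel-split polynomialRing {X} {ℂ.charPoly A} {Y} (suc L) (n ∸ ℓ)
    (λ {p} {q} → X-cancel {p} {q})
    (P.trans {(X P^.^ suc L) *ₚ ℂ.charPoly A} {(X P^.^ suc L) *ₚ Δ} {Y *ₚ (X P^.^ (suc L ℕ.+ (n ∸ ℓ)))}
      (*ₚ-congˡ (X P^.^ suc L) charPoly≈det)
      (P.trans {(X P^.^ suc L) *ₚ Δ} {Y′ *ₚ (X P^.^ n)} {Y *ₚ (X P^.^ (suc L ℕ.+ (n ∸ ℓ)))}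
        DU.det-unicyclic
        (*ₚ-cong {Y′} {Y} {X P^.^ n} {X P^.^ (suc L ℕ.+ (n ∸ ℓ))} Y′≈Y
          (P.reflexive (≡.cong (X P^.^_) (≡.sym n≡))))))
    where
    Δ Y Y′ : Poly
    Δ  = DP.detᶜ (D.col A-poly)
    Y  = (X P^.^ suc L) +ₚ map (-_) (const g)
    Y′ = (X P^.^ suc L) +ₚ map (-_) (DU.gain (suc L))
    gain≈g : DU.gain (suc L) ≈ₚ const g
    gain≈g = P.trans {DU.gain (suc L)} {const (∏ γ (suc L))} {const g} (gain≈ (suc L))
      (∷-cong (trans (reflexive (≡.cong (∏ γ) 1+L≡ℓ)) (sym g≈∏γ)) λ _ → refl)
    Y′≈Y : Y′ ≈ₚ Y
    Y′≈Y = P.+-congˡ {X P^.^ suc L} {map (-_) (DU.gain (suc L))} {map (-_) (const g)}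
      (P.-‿cong {DU.gain (suc L)} {const g} gain≈g)

  spectrum : ℂ.Spec A ≐ (ℂ.zeros (n ∸ ℓ) ℂ.∪ ℂ.⟦ (λ z → (z ℂ.^ ℓ) ℂ.≟ g) ⟧)
  spectrum z = case (z ℂ.≟ 0#) ((z ^ ℓ) ℂ.≟ g)
    where
    power : z ^ suc L ≈ z ^ ℓ
    power = reflexive (≡.cong (z ^_) 1+L≡ℓ)

    count : ∀ {a b} → (if does (z ℂ.≟ 0#) then n ∸ ℓ else 0) ≡ a →
            (if does ((z ^ ℓ) ℂ.≟ g) then 1 else 0) ≡ b → ∀ {k} → a ℕ.+ b ≡ k →
            HasRootMultiplicity (ℂ.charPoly A) z k → ℂ.HasMultiplicity A z ((ℂ.zeros (n ∸ ℓ) ℂ.∪ ℂ.⟦ (λ z → (z ℂ.^ ℓ) ℂ.≟ g) ⟧) z)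
    count p q r = ≡.subst (ℂ.HasMultiplicity A z) (≡.sym (≡.trans (≡.cong₂ ℕ._+_ p q) r))

    case : Dec (z ≈ 0#) → Dec (z ^ ℓ ≈ g) →
           ℂ.HasMultiplicity A z ((ℂ.zeros (n ∸ ℓ) ℂ.∪ ℂ.⟦ (λ z → (z ℂ.^ ℓ) ℂ.≟ g) ⟧) z)
    -- Since `ℓ` is positive and `g` nonzero, 0 is not an `ℓ`-th root of `g`; the two parts of the
    -- multiset never overlap.
    case (yes z≈0) _ = count (if-yes (z ℂ.≟ 0#) z≈0) (if-no ((z ^ ℓ) ℂ.≟ g) zˡ≉g) (ℕ.+-identityʳ (n ∸ ℓ))
      (multiplicity-zero 1≉0 L (n ∸ ℓ) g charPoly≈ z g≉0 z≈0)
      where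
      zˡ≉g : ¬ z ^ ℓ ≈ g
      zˡ≉g zˡ≈g = g≉0 (trans (sym zˡ≈g) (trans (sym power) (trans (*-congʳ {z ^ L} {z} {0#} z≈0) (zeroˡ (z ^ L)))))
    case (no z≉0) (yes zˡ≈g) = count (if-no (z ℂ.≟ 0#) z≉0) (if-yes ((z ^ ℓ) ℂ.≟ g) zˡ≈g) ≡.refl
      (multiplicity-root 1≉0 L (n ∸ ℓ) g charPoly≈ z (characteristic-0 L) z≉0 (trans power zˡ≈g))
    case (no z≉0) (no zˡ≉g) = count (if-no (z ℂ.≟ 0#) z≉0) (if-no ((z ^ ℓ) ℂ.≟ g) zˡ≉g) ≡.refl
      (multiplicity-none 1≉0 L (n ∸ ℓ) g charPoly≈ z z≉0 (zˡ≉g ∘ trans (sym power)))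

  -- The row of a cycle vertex has a single possibly nonzero entry, because its only out-arc is the
  -- one along the cycle.
  cycle-row : ∀ {k} (v : Vector Carrier n) → k ℕ.< ℓ → sum (λ j → A (c k) j * v j) ≈ γ k * v (c (suc k))
  cycle-row {k} v k<ℓ = sum-single {t = λ j → A (c k) j * v j} (c (suc k)) vanish
    where
    vanish : ∀ j → j ≢ c (suc k) → A (c k) j * v j ≈ 0#
    vanish j j≢ with A-support (c k) j
    ... | inj₁ A≈0 = trans (*-congʳ {v j} {A (c k) j} {0#} A≈0) (zeroˡ (v j))
    ... | inj₂ e   = contradiction (arc-from-cycle k<ℓ e) j≢

  unit-modulus : ∀ {z} → OnUnitCircle z → ℂ.IsModulus z ℝ.1#
  unit-modulus unit = ≥0-1 , ℝ.trans (ℝ.*-identityˡ ℝ.1#) (ℝ.sym unit)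

  -- An eigenvector is determined by its value at the root: every vertex other
  -- than the root only points to the root and to vertices above it for _⊏_.
  module Eigenvector (z : Carrier) (zˡ≈g : z ^ ℓ ≈ g) where

    z-unit : OnUnitCircle z
    z-unit = root-on-unit-circle {z} {g} L (trans (reflexive (≡.cong (z ^_) 1+L≡ℓ)) zˡ≈g) g-unit

    private
      Values : Fin n → Set
      Values = WfRec (flip _⊏_) (λ _ → Carrier)

      -- The recursion delivers values only at the heads of arcs that avoid the root. An arc into
      -- the root sees the prescribed value 1, and for an absent arc the default 0 is safe because
      -- `A` has entry 0 there.
      successor : ∀ {u} j → Dec (u ⟶ j) → Dec (j ≡ c 0) → Values u → Carrier
      successor j (no _)  _         value = 0#
      successor j (yes _) (yes _)   value = 1#
      successor j (yes e) (no j≢)   value = value (⊏-arc e j≢)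

      -- The eigenvector equation at `u` solved for the value at `u`, with `conj z` as the inverse
      -- of the unit `z`. At the root the value is normalised to 1, and the equation there is what
      -- `v-closes` has to verify.
      extend : ∀ u → Values u → Carrier
      extend u value = if does (u Fin.≟ c 0) then 1# else
        conj z * sum λ j → A u j * successor j (T? (adjacent u j)) (j Fin.≟ c 0) value

      extend-ext : ∀ u {f h : Values u} → (∀ {j} u⊏j → f {j} u⊏j ≡ h u⊏j) → extend u f ≡ extend u h
      extend-ext u {f} {h} f≡h = ≡.cong (λ s → if does (u Fin.≟ c 0) then 1# else conj z * s)
        (sum-cong-≗ λ j → ≡.cong (A u j *_) (same j (T? (adjacent u j)) (j Fin.≟ c 0)))
        where
        same : ∀ j d d′ → successor j d d′ f ≡ successor j d d′ h
        same j (no _)  _        = ≡.refl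
        same j (yes _) (yes _)  = ≡.refl
        same j (yes e) (no j≢)  = f≡h (⊏-arc e j≢)

    v : Vector Carrier n
    v = All.wfRec ⊏-noetherian 0ℓ (λ _ → Carrier) extend

    private
      v-unfold : ∀ u → v u ≡ extend u (λ {j} _ → v j)
      v-unfold u = FixPoint.unfold-wfRec ⊏-noetherian (λ _ → Carrier) extend extend-ext {u}

    v-root : v (c 0) ≡ 1#
    v-root = ≡.trans (v-unfold (c 0)) (if-yes (c 0 Fin.≟ c 0) ≡.refl)

    v-other : ∀ {u} → u ≢ c 0 → z * v u ≈ sum (λ j → A u j * v j)
    v-other {u} u≢ = begin
      z * v u                   ≈⟨ *-congˡ {z} (reflexive (≡.trans (v-unfold u) (if-no (u Fin.≟ c 0) u≢))) ⟩
      z * (conj z * Σ′)         ≈⟨ *-assoc z (conj z) Σ′ ⟨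
      z * conj z * Σ′           ≈⟨ *-congʳ {Σ′} {z * conj z} {1#} (unit-*-conj {z} z-unit) ⟩
      1# * Σ′                   ≈⟨ *-identityˡ Σ′ ⟩
      Σ′                        ≈⟨ sum-cong-≋ (λ j → summand j (T? (adjacent u j)) (j Fin.≟ c 0)) ⟩
      sum (λ j → A u j * v j)   ∎
      where
      Σ′ : Carrier
      Σ′ = sum λ j → A u j * successor j (T? (adjacent u j)) (j Fin.≟ c 0) (λ {j} _ → v j)
      summand : ∀ j d d′ → A u j * successor j d d′ (λ {j} _ → v j) ≈ A u j * v j
      summand j (yes _) (no _)  = refl
      summand j (yes _) (yes j≡) = *-congˡ {A u j} (reflexive (≡.sym (≡.trans (≡.cong v j≡) v-root)))
      summand j (no ¬e) _       = trans (zeroʳ (A u j))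
        (sym (trans (*-congʳ {v j} {A u j} {0#} (reflexive (A-no-arc ¬e))) (zeroˡ (v j))))

    -- Following the cycle once around returns to the root with the factor zˡ = g.
    v-closes : γ 0 * v (c 1) ≈ z
    v-closes = ^-cancel (nonzero-cancel {z} (unit≉0 {z} z-unit)) L (begin
      z ^ L * (γ 0 * v (c 1))               ≈⟨ solve 3 (λ p h w → p :* (h :* w) := h :* (p :* w)) refl (z ^ L) (γ 0) (v (c 1)) ⟩
      γ 0 * (z ^ L * v (c 1))               ≈⟨ *-congˡ {γ 0} (telescope {z} {v ∘ c ∘ suc} {γ ∘ suc} L steps) ⟩
      γ 0 * (∏ (γ ∘ suc) L * v (c (suc L))) ≈⟨ *-assoc (γ 0) (∏ (γ ∘ suc) L) (v (c (suc L))) ⟨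
      γ 0 * ∏ (γ ∘ suc) L * v (c (suc L))
        ≈⟨ *-cong {γ 0 * ∏ (γ ∘ suc) L} {∏ γ (suc L)} {v (c (suc L))} {1#}
             (sym (∏-head γ L)) (reflexive (≡.trans (≡.cong v c-closed) v-root)) ⟩
      ∏ γ (suc L) * 1#                      ≈⟨ *-identityʳ _ ⟩
      ∏ γ (suc L)                           ≈⟨ trans (reflexive (≡.cong (∏ γ) 1+L≡ℓ)) (trans (sym g≈∏γ) (sym zˡ≈g)) ⟩
      z ^ ℓ                                 ≈⟨ reflexive (≡.cong (z ^_) (≡.sym 1+L≡ℓ)) ⟩
      z * z ^ L                             ≈⟨ *-comm z (z ^ L) ⟩
      z ^ L * z                             ∎)
      where
      open IntegerSolver commutativeRing using (solve; _:=_; _:*_)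
      steps : ∀ k → k ℕ.< L → z * v (c (suc k)) ≈ γ (suc k) * v (c (suc (suc k)))
      steps k k<L = trans (v-other (c-suc≢root (≤L⇒<ℓ k<L))) (cycle-row v (≤L⇒<ℓ k<L))

    isEigenvalue : ℂ.IsEigenvalue A z
    isEigenvalue = v , (λ v≈0 → 1≉0 (trans (sym (reflexive v-root)) (v≈0 (c 0)))) , equation
      where
      equation : ∀ u → sum (λ j → A u j * v j) ≈ z * v u
      equation u = case (u Fin.≟ c 0)
        where
        case : Dec (u ≡ c 0) → sum (λ j → A u j * v j) ≈ z * v u
        case (no u≢)      = sym (v-other u≢)
        case (yes ≡.refl) = begin
          sum (λ j → A (c 0) j * v j)   ≈⟨ cycle-row v 0<ℓ ⟩
          γ 0 * v (c 1)                 ≈⟨ v-closes ⟩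
          z                             ≈⟨ *-identityʳ z ⟨
          z * 1#                        ≈⟨ *-congˡ {z} (reflexive v-root) ⟨
          z * v (c 0)                   ∎

  -- An eigenvector that is nonzero at the root forces `z ^ ℓ ≈ g` by one turn around the cycle. One
  -- that vanishes at the root can only belong to `z ≈ 0#`.
  eigenvalue-0-or-unit : ∀ z → ℂ.IsEigenvalue A z → z ≈ 0# ⊎ OnUnitCircle z
  eigenvalue-0-or-unit z (v , v≉0 , Av≈zv) = case (z ℂ.≟ 0#) (v (c 0) ℂ.≟ 0#)
    where
    around : z ^ ℓ * v (c 0) ≈ g * v (c 0)
    around = begin
      z ^ ℓ * v (c 0)    ≈⟨ telescope {z} {v ∘ c} {γ} ℓ (λ k k<ℓ → trans (sym (Av≈zv (c k))) (cycle-row v k<ℓ)) ⟩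
      ∏ γ ℓ * v (c ℓ)    ≈⟨ *-cong {∏ γ ℓ} {g} {v (c ℓ)} {v (c 0)} (sym g≈∏γ) (reflexive (≡.cong v c-period)) ⟩
      g * v (c 0)        ∎

    module _ (z≉0 : ¬ z ≈ 0#) (v-root≈0 : v (c 0) ≈ 0#) where
      summand : ∀ {u} j → (∀ {j} → u ⊏ j → v j ≈ 0#) → A u j * v j ≈ 0#
      summand {u} j rec with A-support u j
      ... | inj₁ A≈0 = trans (*-congʳ {v j} {A u j} {0#} A≈0) (zeroˡ (v j))
      ... | inj₂ e with j Fin.≟ c 0
      ...   | yes ≡.refl = trans (*-congˡ {A u j} v-root≈0) (zeroʳ (A u j))
      ...   | no j≢      = trans (*-congˡ {A u j} (rec (⊏-arc e j≢))) (zeroʳ (A u j))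

      -- By induction from the top of `_⊏_`: every arc from `u` leads to the root or to a vertex
      -- above `u`, where `v` vanishes, so `z * v u` vanishes too.
      all-zero : ∀ u → Acc (flip _⊏_) u → v u ≈ 0#
      all-zero u (acc rs) = ℂ-integral {z} {v u} (trans (sym (Av≈zv u))
        (sum-zero {t = λ j → A u j * v j} λ j → summand {u} j λ u⊏j → all-zero _ (rs u⊏j))) z≉0

    case : Dec (z ≈ 0#) → Dec (v (c 0) ≈ 0#) → z ≈ 0# ⊎ OnUnitCircle z
    case (yes z≈0) _ = inj₁ z≈0
    case (no z≉0) (yes v-root≈0) = contradiction (λ u → all-zero z≉0 v-root≈0 u (⊏-noetherian u)) v≉0
    case (no z≉0) (no v-root≉0) = inj₂ (Eigenvector.z-unit z
      (nonzero-cancel {v (c 0)} v-root≉0 (trans (*-comm (v (c 0)) (z ^ ℓ)) (trans around (*-comm g (v (c 0)))))))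

  spectral-radius : ℂ.IsSpectralRadius A ℝ.1#
  spectral-radius = attained (unit-root 0<ℓ g g-unit) , λ z eigen → bounded (eigenvalue-0-or-unit z eigen)
    where
    open IsDecTotalOrder ℝ.isDecTotalOrder using () renaming (refl to ≤-refl)
    attained : ∃[ z ] z ^ ℓ ≈ g → ∃[ z ] (ℂ.IsEigenvalue A z × ℂ.IsModulus z ℝ.1#)
    attained (z , zˡ≈g) = z , Eigenvector.isEigenvalue z zˡ≈g , unit-modulus {z} (Eigenvector.z-unit z zˡ≈g)
    bounded : ∀ {z} → z ≈ 0# ⊎ OnUnitCircle z → ∃[ r ] (ℂ.IsModulus z r × r ℝ.≤ ℝ.1#)
    bounded {z} (inj₁ z≈0) = ℝ.0# , (≤-refl , ℝ.sym (ℝ.trans (norm²-cong {z} {0#} z≈0) (ℝ.trans (ℝ.+-congˡ (ℝ.zeroˡ _)) (ℝ.+-identityʳ _)))) , ≥0-1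
    bounded {z} (inj₂ unit) = ℝ.1# , unit-modulus {z} unit , ≤-refl

theorem4p4 :
  (ℝ : CompleteOrderedField) →
  let open Complex ℝ in
  (n : ℕ) (Φ : GainDigraph n) →
  let open GainDigraph Φ in
  (U : IsUnicyclic digraph) →
  let C = IsUnicyclic.cycle U
      ℓ = DirectedCycle.length C
      g = cycleGain C
  in
  (Spec adjacencyMatrix ≐ (zeros (n ∸ ℓ) ∪ ⟦ (λ z → (z ^ ℓ) ≟ g) ⟧))
  × IsSpectralRadius adjacencyMatrix (CompleteOrderedField.1# ℝ)
theorem4p4 ℝ n Φ U = spectrum , spectral-radius
  where open GainSpectrum ℝ Φ U
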